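{- Let $(G,c)$ be an instance of \textsc{Bucket Integrity}, let $n=|V(G)|$, and let $C$ be a minimum vertex cover of $G$. An optimal solution of $(G,c)$ can be computed in $2^{O(|C|\log|C|)}\cdot n^{O(1)}$ time.
   Context: Graphs are finite, simple and undirected. A bucket arrangement of a graph $G$ is a partition of $V(G)$ into an ordered sequence of $k$ buckets $B_1,\dots,B_k$ (for some $k$). Its width is $\max_i |B_i|$. An edge $\{u,v\}$ with $u\in B_i$ and $v\in B_j$ is short if $|i-j|<2$, and long otherwise. \textsc{Bucket Integrity}: given a graph $G$ and a capacity $c\in\mathbb{N}$, find a bucket arrangement of $G$ with width at most $c$ and the minimum number of long edges (among all bucket arrangements of $G$ of width at most $c$). Such an arrangement is called an optimal solution of $(G,c)$. -}

module Defs where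

open import Data.Bool using (Bool; false; T; T?; if_then_else_)
open import Data.Fin as Fin using (Fin; toℕ; fromℕ<; remQuot)
open import Data.Fin.Subset using (Subset; _∈_; ∣_∣)
open import Data.List using (List; allFin; cartesianProduct; filter; length; map)
open import Data.List.Extrema.Nat using (max)
open import Data.Nat
  using (ℕ; _+_; _*_; _∸_; _≤_; _<_; _<?_; _≟_; ∣_-_∣)
open import Data.Product using (_×_; _,_; uncurry)
open import Data.Sum using (_⊎_)
open import Function.Definitions using (StrictlySurjective)
open import Relation.Binary.PropositionalEquality using (_≡_; _≢_; refl)
open import Relation.Nullary
  using (¬_; Dec; does; yes; no; ¬?; _×-dec_; contradiction)

record Graph (n : ℕ) : Set where
  field
    adj    : Fin n → Fin n → Bool
    sym    : ∀ u v → adj u v ≡ adj v u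
    irrefl : ∀ v → adj v v ≡ false

open Graph public using (adj)

IsVertexCover : ∀ {n} → Graph n → Subset n → Set
IsVertexCover G C = ∀ u v → T (adj G u v) → u ∈ C ⊎ v ∈ C

IsMinimumVertexCover : ∀ {n} → Graph n → Subset n → Set
IsMinimumVertexCover G C =
  IsVertexCover G C × (∀ C′ → IsVertexCover G C′ → ∣ C ∣ ≤ ∣ C′ ∣)

-- Each undirected edge {u,v} is listed once, as the pair with u < v.
edges : ∀ {n} → Graph n → List (Fin n × Fin n)
edges {n} G =
  filter (λ (u , v) → u Fin.<? v ×-dec T? (adj G u v))
         (cartesianProduct (allFin n) (allFin n))

-- An ordered partition of the vertices into k buckets is given by the
-- map sending a vertex to the index of its bucket.  The blocks of a
-- partition are nonempty, hence surjectivity.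
record Arrangement (n : ℕ) : Set where
  field
    k        : ℕ
    bucket   : Fin n → Fin k
    nonempty : StrictlySurjective _≡_ bucket

open Arrangement public using (k; bucket)

bucketSize : ∀ {n} (A : Arrangement n) → Fin (k A) → ℕ
bucketSize {n} A i = length (filter (λ v → bucket A v Fin.≟ i) (allFin n))

-- The arrangement of the empty graph has no buckets, and width 0.
width : ∀ {n} → Arrangement n → ℕ
width A = max 0 (map (bucketSize A) (allFin (k A)))

Short : ∀ {n} → Arrangement n → Fin n × Fin n → Set
Short A (u , v) = ∣ toℕ (bucket A u) - toℕ (bucket A v) ∣ < 2

Long : ∀ {n} → Arrangement n → Fin n × Fin n → Set
Long A e = ¬ Short A e

long? : ∀ {n} (A : Arrangement n) (e : Fin n × Fin n) → Dec (Long A e)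
long? A e = ¬? (_ <? 2)

longEdges : ∀ {n} → Graph n → Arrangement n → ℕ
longEdges G A = length (filter (long? A) (edges G))

IsOptimal : ∀ {n} → Graph n → ℕ → Arrangement n → Set
IsOptimal G c A =
  width A ≤ c × (∀ A′ → width A′ ≤ c → longEdges G A ≤ longEdges G A′)

-- A structured unit-cost random access machine whose cells hold natural
-- numbers.  Registers and arrays are named by numerals fixed in the
-- program, so a program has finitely many of each and they can be
-- interleaved into one linear memory; indices into an array are computed.
-- The only arithmetic is addition and truncated subtraction: with
-- multiplication, unit cost would not be polynomially related to Turing
-- machine time.

infixl 6 _⊕_ _⊖_
infix  4 _≔_ _[_]≔_
infixr 3 _⨾_

data Expr : Set where
  lit     : ℕ → Expr
  reg     : ℕ → Expr
  arr     : ℕ → Expr → Expr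
  _⊕_ _⊖_ : Expr → Expr → Expr

-- A test succeeds when its value is nonzero.
data Program : Set where
  skip            : Program
  _≔_             : ℕ → Expr → Program
  _[_]≔_          : ℕ → Expr → Expr → Program
  _⨾_             : Program → Program → Program
  when_then_else_ : Expr → Program → Program → Program
  while_loop_     : Expr → Program → Program

record State : Set where
  constructor ⟨_,_⟩
  field
    regs   : ℕ → ℕ
    arrays : ℕ → ℕ → ℕ

open State public

update : {A : Set} → (ℕ → A) → ℕ → A → ℕ → A
update f i x j = if does (j ≟ i) then x else f j

setReg : State → ℕ → ℕ → State
setReg σ r x = ⟨ update (regs σ) r x , arrays σ ⟩

setCell : State → ℕ → ℕ → ℕ → State
setCell σ a i x = ⟨ regs σ , update (arrays σ) a (update (arrays σ a) i x) ⟩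

eval : Expr → State → ℕ
eval (lit x)   σ = x
eval (reg r)   σ = regs σ r
eval (arr a e) σ = arrays σ a (eval e σ)
eval (e ⊕ e′)  σ = eval e σ + eval e′ σ
eval (e ⊖ e′)  σ = eval e σ ∸ eval e′ σ

cost : Expr → ℕ
cost (lit x)   = 1
cost (reg r)   = 1
cost (arr a e) = 1 + cost e
cost (e ⊕ e′)  = 1 + cost e + cost e′
cost (e ⊖ e′)  = 1 + cost e + cost e′

infix 2 _from_⇓_inTime_

-- p from σ ⇓ τ inTime t: started in σ, p halts in τ after exactly t steps.
data _from_⇓_inTime_ : Program → State → State → ℕ → Set where

  skip : ∀ {σ} → skip from σ ⇓ σ inTime 1

  assign : ∀ {r e σ} →
    (r ≔ e) from σ ⇓ setReg σ r (eval e σ) inTime 1 + cost e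

  store : ∀ {a i e σ} →
    (a [ i ]≔ e) from σ ⇓ setCell σ a (eval i σ) (eval e σ)
      inTime 1 + cost i + cost e

  seq : ∀ {p q σ τ υ s t} →
    p from σ ⇓ τ inTime s →
    q from τ ⇓ υ inTime t →
    (p ⨾ q) from σ ⇓ υ inTime s + t

  when-true : ∀ {e p q σ τ t} → eval e σ ≢ 0 →
    p from σ ⇓ τ inTime t →
    (when e then p else q) from σ ⇓ τ inTime 1 + cost e + t

  when-false : ∀ {e p q σ τ t} → eval e σ ≡ 0 →
    q from σ ⇓ τ inTime t →
    (when e then p else q) from σ ⇓ τ inTime 1 + cost e + t

  while-true : ∀ {e p σ τ υ s t} → eval e σ ≢ 0 →
    p from σ ⇓ τ inTime s →
    (while e loop p) from τ ⇓ υ inTime t →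
    (while e loop p) from σ ⇓ υ inTime 1 + cost e + s + t

  while-false : ∀ {e p σ} → eval e σ ≡ 0 →
    (while e loop p) from σ ⇓ σ inTime 1 + cost e

-- Hence a run exhibited by an existential is the only one.
deterministic : ∀ {p σ τ τ′ t t′} →
  p from σ ⇓ τ inTime t → p from σ ⇓ τ′ inTime t′ → τ ≡ τ′ × t ≡ t′
deterministic skip skip = refl , refl
deterministic assign assign = refl , refl
deterministic store store = refl , refl
deterministic (seq a b) (seq c d) with deterministic a c
... | refl , refl with deterministic b d
... | refl , refl = refl , refl
deterministic (when-true _ a) (when-true _ b) with deterministic a b
... | refl , refl = refl , refl
deterministic (when-true x _) (when-false y _) = contradiction y x
deterministic (when-false x _) (when-true y _) = contradiction x y
deterministic (when-false _ a) (when-false _ b) with deterministic a b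
... | refl , refl = refl , refl
deterministic (while-true _ a b) (while-true _ c d) with deterministic a c
... | refl , refl with deterministic b d
... | refl , refl = refl , refl
deterministic (while-true x _ _) (while-false y) = contradiction y x
deterministic (while-false x) (while-true y _ _) = contradiction x y
deterministic (while-false _) (while-false _) = refl , refl

-- Row-major adjacency matrix: cell u * n + v is 1 if uv is an edge.
adjacencyArray : ∀ {n} → Graph n → ℕ → ℕ
adjacencyArray {n} G i with i <? n * n
... | yes i<n² = if uncurry (adj G) (remQuot n (fromℕ< i<n²)) then 1 else 0
... | no  _    = 0

-- n in register 0, c in register 1, the graph in array 0; all other
-- cells are 0.
input : ∀ {n} → Graph n → ℕ → State
input {n} G c = ⟨ rs , as ⟩
  where
  rs : ℕ → ℕ
  rs 0 = n
  rs 1 = c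
  rs _ = 0

  as : ℕ → ℕ → ℕ
  as 0 = adjacencyArray G
  as _ = λ _ → 0

-- The number of buckets in register 0, the (0-based) bucket index of
-- vertex v in cell v of array 1.
Outputs : ∀ {n} → State → Arrangement n → Set
Outputs σ A =
  regs σ 0 ≡ k A × (∀ v → arrays σ 1 (toℕ v) ≡ toℕ (bucket A v))

-- The vertices of a greedy maximal matching form a cover D with |D| ≤ 2|C|.
-- Only buckets at distance at most 1 from a bucket that meets D matter: if the
-- others are closed up and each of their vertices gets a bucket of its own at
-- the end, no short edge becomes long.  So D may be placed in the first 3|D|
-- buckets, which leaves (3|D|)^|D| guesses.  For a fixed guess it remains to
-- assign the vertices to unit slots of the buckets, which Bertsekas' auction
-- algorithm does: an unassigned vertex takes the slot that minimises weight
-- plus price, evicts the holder and raises the price by 1.  While a vertex is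
-- unassigned some slot is still free of charge, hence prices stay bounded and
-- there are polynomially many bids; the final assignment is optimal up to an
-- additive n, hence optimal, because the weights are multiples of n + 1.

module Submission where

open import Defs
open import Data.Bool using (Bool; true; false; T; T?; not; _∨_; if_then_else_)
open import Data.Fin as Fin using (Fin; toℕ; fromℕ<; combine; remQuot)
open import Data.Fin.Properties
  using (toℕ<n; toℕ-fromℕ<; fromℕ<-toℕ; toℕ-injective; toℕ-combine; remQuot-combine; pigeonhole)
open import Data.Fin.Subset using (Subset; ∣_∣; _∈_)
open import Data.List using (List; []; _∷_; _++_; allFin; cartesianProduct; filter; length; map; tabulate)
open import Data.List.Extrema.Nat using (max≤v⁺; xs≤max)
open import Data.List.Membership.Propositional.Properties using (∈-map⁺; ∈-allFin)
open import Data.List.Properties using (map-tabulate)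
open import Data.List.Relation.Unary.All as All using ()
open import Data.List.Relation.Unary.All.Properties as All using ()
open import Data.Nat
open import Data.Nat.DivMod using (_/_; _%_; m≡m%n+[m/n]*n; m%n<n; m<n*o⇒m/o<n)
open import Data.Nat.Induction using (<-rec)
open import Data.Nat.Logarithm using (⌈log₂_⌉; ⌈log₂⌉-mono-≤; ⌈log₂⌈n/2⌉⌉≡⌈log₂n⌉∸1)
open import Data.Nat.Properties
open import Data.Nat.Tactic.RingSolver using (solve-∀)
open import Data.Product using (Σ-syntax; ∃-syntax; _×_; _,_; proj₁; proj₂; uncurry)
open import Data.Sum using (_⊎_; inj₁; inj₂)
open import Data.Unit using (tt)
open import Data.Vec using ([]; _∷_; lookup)
open import Data.Vec.Properties using ([]=⇒lookup)
open import Function using (_∘_; id)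
open import Relation.Binary.Definitions using (tri<; tri≈; tri>)
open import Relation.Binary.PropositionalEquality
open import Relation.Nullary using (¬_; Dec; does; yes; no; contradiction; _×-dec_)
open import Relation.Nullary.Decidable using (dec-true; dec-false)

-- Runs of programs

-- Once `D` sits at its guessed buckets, every other vertex has all its neighbours in `D`, so what
-- it pays depends on its own bucket alone; this is what makes the rest a linear assignment problem.
-- Cover vertices take part in the assignment as well and are held at the guess by a penalty that
-- exceeds all edge costs together. Edges inside `D` are then charged at both ends, but their charge
-- is a constant of the guess. A guess may overfill a bucket. This does no harm: every assignment to
-- slots respects the capacity, and the long edges of the resulting arrangement are counted afresh
-- instead of being read off from the weights. The capacity is first cut down to n, since otherwise
-- the number of slots would not be polynomial in n. Only the number of guesses has no bound by a
-- fixed power of n, so the other running times are kept as exponents of x = 2 + n. The final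
-- constants 8 and 56 come from counting the guesses and from adding up these exponents.

update-same : ∀ {A : Set} (f : ℕ → A) i x → update f i x i ≡ x
update-same f i x rewrite dec-true (i ≟ i) refl = refl

update-other : ∀ {A : Set} (f : ℕ → A) {i j} x → j ≢ i → update f i x j ≡ f j
update-other f {i} {j} x j≢i rewrite dec-false (j ≟ i) j≢i = refl

writes stores : Program → ℕ → Bool
writes skip                    r = false
writes (q ≔ e)                 r = r ≡ᵇ q
writes (a [ i ]≔ e)            r = false
writes (p ⨾ q)                 r = writes p r ∨ writes q r
writes (when e then p else q)  r = writes p r ∨ writes q r
writes (while e loop p)        r = writes p r
stores skip                    b = false
stores (q ≔ e)                 b = false
stores (a [ i ]≔ e)            b = b ≡ᵇ a
stores (p ⨾ q)                 b = stores p b ∨ stores q b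
stores (when e then p else q)  b = stores p b ∨ stores q b
stores (while e loop p)        b = stores p b

-- The side conditions are implicit because for concrete programs and cells
-- they compute to ⊤.
record Frame (p : Program) (σ τ : State) : Set where
  field
    keepReg   : ∀ r → {T (not (writes p r))} → regs τ r ≡ regs σ r
    keepArray : ∀ a → {T (not (stores p a))} → arrays τ a ≡ arrays σ a

open Frame public

not-∨ˡ : ∀ x {y} → T (not (x ∨ y)) → T (not x)
not-∨ˡ false _ = tt

not-∨ʳ : ∀ x {y} → T (not (x ∨ y)) → T (not y)
not-∨ʳ false h = h

not-∨ : ∀ x {y} → T (not x) → T (not y) → T (not (x ∨ y))
not-∨ false _ h = h

keptReg : ∀ {p σ τ t} → p from σ ⇓ τ inTime t →
  ∀ r → T (not (writes p r)) → regs τ r ≡ regs σ r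
keptReg skip r h = refl
keptReg (assign {q}) r h with r ≡ᵇ q
... | false = refl
keptReg store r h = refl
keptReg (seq {p} d d′) r h =
  trans (keptReg d′ r (not-∨ʳ (writes p r) h)) (keptReg d r (not-∨ˡ (writes p r) h))
keptReg (when-true {p = p} _ d) r h = keptReg d r (not-∨ˡ (writes p r) h)
keptReg (when-false {p = p} _ d) r h = keptReg d r (not-∨ʳ (writes p r) h)
keptReg (while-true _ d d′) r h = trans (keptReg d′ r h) (keptReg d r h)
keptReg (while-false _) r h = refl

keptArray : ∀ {p σ τ t} → p from σ ⇓ τ inTime t →
  ∀ a → T (not (stores p a)) → arrays τ a ≡ arrays σ a
keptArray skip b h = refl
keptArray assign b h = refl
keptArray (store {a}) b h with b ≡ᵇ a
... | false = refl
keptArray (seq {p} d d′) b h =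
  trans (keptArray d′ b (not-∨ʳ (stores p b) h)) (keptArray d b (not-∨ˡ (stores p b) h))
keptArray (when-true {p = p} _ d) b h = keptArray d b (not-∨ˡ (stores p b) h)
keptArray (when-false {p = p} _ d) b h = keptArray d b (not-∨ʳ (stores p b) h)
keptArray (while-true _ d d′) b h = trans (keptArray d′ b h) (keptArray d b h)
keptArray (while-false _) b h = refl

frame : ∀ {p σ τ t} → p from σ ⇓ τ inTime t → Frame p σ τ
frame d .keepReg r {h} = keptReg d r h
frame d .keepArray a {h} = keptArray d a h

frame-refl : ∀ {p σ} → Frame p σ σ
frame-refl .keepReg r = refl
frame-refl .keepArray a = refl

frame-trans : ∀ {p σ τ υ} → Frame p σ τ → Frame p τ υ → Frame p σ υ
frame-trans φ ψ .keepReg r {h} = trans (keepReg ψ r {h}) (keepReg φ r {h})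
frame-trans φ ψ .keepArray a {h} = trans (keepArray ψ a {h}) (keepArray φ a {h})

Runs : Program → State → ℕ → (State → Set) → Set
Runs p σ b Q = ∃[ τ ] ∃[ t ] (p from σ ⇓ τ inTime t) × t ≤ b × Q τ

-- The continuation receives the frame of `p`, so a postcondition only has to mention what `p`
-- changes.
seqRuns : ∀ {p q σ s t} {Q R : State → Set} → Runs p σ s Q →
  (∀ τ → Frame p σ τ → Q τ → Runs q τ t R) → Runs (p ⨾ q) σ (s + t) R
seqRuns (τ , _ , d , le , x) k with k τ (frame d) x
... | υ , _ , d′ , le′ , y = υ , _ , seq d d′ , +-mono-≤ le le′ , y

weaken : ∀ {p σ s t} {Q R : State → Set} → s ≤ t → (∀ τ → Frame p σ τ → Q τ → R τ) →
  Runs p σ s Q → Runs p σ t R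
weaken s≤t f (τ , _ , d , le , q) = τ , _ , d , ≤-trans le s≤t , f τ (frame d) q

-- The index of the invariant bounds the number of remaining iterations.
whileRuns : ∀ {e p σ b} {Q : State → Set} (I : ℕ → State → Set) →
  (∀ m τ → Frame p σ τ → I m τ →
     (eval e τ ≡ 0 × Q τ) ⊎
     (eval e τ ≢ 0 × ∃[ m′ ] m ≡ suc m′ × Runs p τ b (I m′))) →
  ∀ m → I m σ → Runs (while e loop p) σ (1 + cost e + m * (1 + cost e + b)) Q
whileRuns {e} {p} {σ} {b} {Q} I step m i = go m σ frame-refl i
  where
  go : ∀ m τ → Frame p σ τ → I m τ →
    Runs (while e loop p) τ (1 + cost e + m * (1 + cost e + b)) Q
  go m τ φ i with step m τ φ i
  ... | inj₁ (z , q) = τ , _ , while-false z , m≤m+n (1 + cost e) _ , q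
  ... | inj₂ (nz , m′ , refl , υ , s , d , le , j)
      with go m′ υ (frame-trans φ (frame d)) j
  ... | ω , t , d′ , le′ , q = ω , _ , while-true nz d d′ ,
        ≤-trans (+-mono-≤ (+-monoʳ-≤ (1 + cost e) le) le′)
            (≤-reflexive (lemma (cost e) b (m′ * (1 + cost e + b)))) , q
    where
    lemma : ∀ c b u → 1 + c + b + (1 + c + u) ≡ 1 + c + (1 + c + b + u)
    lemma = solve-∀

infix 3 for_below_loop_

for_below_loop_ : ℕ → ℕ → Program → Program
for r below q loop p = r ≔ lit 0 ⨾ while (reg q ⊖ reg r) loop (p ⨾ r ≔ reg r ⊕ lit 1)

-- Running times as powers of a base that is at least 2

module Poly (x : ℕ) (2≤x : 2 ≤ x) where

  private instance
    x≢0 : NonZero x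
    x≢0 = >-nonZero (≤-trans (s≤s z≤n) 2≤x)

  ^-mono : ∀ {a b} → a ≤ b → x ^ a ≤ x ^ b
  ^-mono = ^-monoʳ-≤ x

  lit≤ : ∀ {c} e → {h : T (c ≤ᵇ 2 ^ e)} → c ≤ x ^ e
  lit≤ {c} e {h} = ≤-trans (≤ᵇ⇒≤ c (2 ^ e) h) (^-monoˡ-≤ e 2≤x)

  double : ∀ e → x ^ e + x ^ e ≤ x ^ suc e
  double e = ≤-trans (≤-reflexive (cong (x ^ e +_) (sym (+-identityʳ _)))) (*-monoˡ-≤ (x ^ e) 2≤x)

  sum≤ : ∀ {s t e} → s ≤ x ^ e → t ≤ x ^ e → s + t ≤ x ^ suc e
  sum≤ {e = e} a b = ≤-trans (+-mono-≤ a b) (double e)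

  prod≤ : ∀ {s t} a b → s ≤ x ^ a → t ≤ x ^ b → s * t ≤ x ^ (a + b)
  prod≤ a b p q = ≤-trans (*-mono-≤ p q) (≤-reflexive (sym (^-distribˡ-+-* x a b)))

  linear≤ : ∀ {n} → n < x → n ≤ x ^ 1
  linear≤ n<x = ≤-trans (<⇒≤ n<x) (≤-reflexive (sym (*-identityʳ x)))

  square< : ∀ {n} → n < x → suc (n * n) ≤ x ^ 2
  square< {n} n<x = ≤-trans (s≤s (m≤n+m (n * n) (n + n))) (≤-trans (≤-reflexive (lemma n)) (^-monoˡ-≤ 2 n<x))
    where
    lemma : ∀ n → 1 + (n + n + n * n) ≡ (1 + n) * ((1 + n) * 1)
    lemma = solve-∀

  -- Time is recorded through an exponent only: since x is at least 2, doubling costs one exponent,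
  -- so sequencing and branching add 1, and numeric side conditions are decided at base 2. A record
  -- keeps `e` recoverable by unification, which `x ^ e` would not.
  record Halts (p : Program) (σ : State) (e : ℕ) (Q : State → Set) : Set where
    constructor halts
    field run : Runs p σ (x ^ e) Q

  open Halts public

  skipR : ∀ {σ} e {Q : State → Set} → Q σ → Halts skip σ e Q
  skipR e q = halts (_ , _ , skip , lit≤ e {≤⇒≤ᵇ (m^n>0 2 e)} , q)

  assignR : ∀ {r f σ e} {Q : State → Set} → {h : T (1 + cost f ≤ᵇ 2 ^ e)} →
    Q (setReg σ r (eval f σ)) → Halts (r ≔ f) σ e Q
  assignR {e = e} {h = h} q = halts (_ , _ , assign , lit≤ e {h} , q)

  storeR : ∀ {a i f σ e} {Q : State → Set} → {h : T (1 + cost i + cost f ≤ᵇ 2 ^ e)} →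
    Q (setCell σ a (eval i σ) (eval f σ)) → Halts (a [ i ]≔ f) σ e Q
  storeR {e = e} {h = h} q = halts (_ , _ , store , lit≤ e {h} , q)

  infixr 3 _then_

  _then_ : ∀ {p q σ e} {Q R : State → Set} → Halts p σ e Q →
    (∀ τ → Frame p σ τ → Q τ → Halts q τ e R) → Halts (p ⨾ q) σ (suc e) R
  _then_ {e = e} r k =
    halts (weaken (double e) (λ _ _ q → q) (seqRuns (run r) (λ τ φ q → run (k τ φ q))))

  whenR : ∀ {f p q σ e} {Q : State → Set} → {h : T (1 + cost f ≤ᵇ 2 ^ e)} →
    (eval f σ ≢ 0 → Halts p σ e Q) → (eval f σ ≡ 0 → Halts q σ e Q) →
    Halts (when f then p else q) σ (suc e) Q
  whenR {f} {σ = σ} {e = e} {h = h} a b with eval f σ ≟ 0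
  ... | yes z with run (b z)
  ... | τ , t , d , le , y = halts (τ , _ , when-false z d , sum≤ {e = e} (lit≤ e {h}) le , y)
  whenR {f} {σ = σ} {e = e} {h = h} a b | no nz with run (a nz)
  ... | τ , t , d , le , y = halts (τ , _ , when-true nz d , sum≤ {e = e} (lit≤ e {h}) le , y)

  mapR : ∀ {p σ d e} {Q R : State → Set} → {h : T (d ≤ᵇ e)} →
    (∀ τ → Frame p σ τ → Q τ → R τ) → Halts p σ d Q → Halts p σ e R
  mapR {d = d} {e} {h = h} f r = halts (weaken (^-mono (≤ᵇ⇒≤ d e h)) f (run r))

  weak : ∀ {p σ d e} {Q : State → Set} → {h : T (d ≤ᵇ e)} → Halts p σ d Q → Halts p σ e Q
  weak {h = h} = mapR {h = h} (λ _ _ q → q)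

  -- Test and body together cost at most `x ^ suc e`, all iterations at most `x ^ (a + suc e)`, and
  -- the final failing test accounts for one more exponent.
  whileR : ∀ {f p σ} e a {Q : State → Set} (I : ℕ → State → Set) → {h : T (1 + cost f ≤ᵇ 2 ^ e)} →
    (∀ m τ → Frame p σ τ → I m τ →
       (eval f τ ≡ 0 × Q τ) ⊎
       (eval f τ ≢ 0 × ∃[ m′ ] m ≡ suc m′ × Halts p τ e (I m′))) →
    ∀ m → m ≤ x ^ a → I m σ → Halts (while f loop p) σ (a + (2 + e)) Q
  whileR {f} {p} e a {Q} I {h} step m m≤ i =
    halts (weaken (≤-trans (sum≤ {e = a + suc e}
              (≤-trans (lit≤ e {h}) (^-mono (≤-trans (n≤1+n e) (m≤n+m (suc e) a))))
              (prod≤ a (suc e) m≤ (sum≤ {e = e} (lit≤ e {h}) ≤-refl)))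
              (≤-reflexive (cong (x ^_) (sym (+-suc a (suc e))))))
      (λ _ _ q → q) (whileRuns I step′ m i))
    where
    step′ : ∀ m τ → Frame p _ τ → I m τ →
       (eval f τ ≡ 0 × Q τ) ⊎
       (eval f τ ≢ 0 × ∃[ m′ ] m ≡ suc m′ × Runs p τ (x ^ e) (I m′))
    step′ m τ φ i with step m τ φ i
    ... | inj₁ q = inj₁ q
    ... | inj₂ (nz , m′ , eq , r) = inj₂ (nz , m′ , eq , run r)

  -- The invariant is demanded with the counter already advanced, so a proof about the body never
  -- meets the increment. The frame starts at the state before the loop, so that facts about cells
  -- which the body leaves alone can be carried in from outside.
  forR : ∀ {r q p σ e} a N (I : ℕ → State → Set) → {h₁ : T (not (writes p r))} →
    {h₂ : T (not (writes p q))} → {h₃ : T (not (q ≡ᵇ r))} → {h₄ : T (8 ≤ᵇ 2 ^ e)} →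
    N ≤ x ^ a → regs σ q ≡ N → I 0 (setReg σ r 0) →
    (∀ i τ → i < N → Frame (p ⨾ r ≔ reg r ⊕ lit 1) σ τ → regs τ r ≡ i → I i τ →
       Halts p τ e (λ υ → I (suc i) (setReg υ r (suc i)))) →
    Halts (for r below q loop p) σ (a + (4 + e)) (I N)
  forR {r} {q} {p} {σ} {e} a N I {h₁} {h₂} {h₃} {h₄} N≤ bnd i₀ step =
    subst (λ k → Halts (for r below q loop p) σ k (I N)) (sym (+-suc a (3 + e)))
      (initial then λ τ φ i → whileR (suc e) a Loop {h₅} body N N≤ i)
    where
    p⁺ = p ⨾ r ≔ reg r ⊕ lit 1
    h₅ : T (1 + 3 ≤ᵇ 2 ^ suc e)
    h₅ = ≤⇒≤ᵇ (≤-trans (s≤s (s≤s (s≤s (s≤s z≤n)))) (≤-trans (≤ᵇ⇒≤ 8 _ h₄) (^-monoʳ-≤ 2 (n≤1+n e))))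
    σ₀ = setReg σ r 0
    Loop : ℕ → State → Set
    Loop m τ = ∃[ i ] i + m ≡ N × regs τ r ≡ i × Frame p⁺ σ τ × I i τ
    initial : Halts (r ≔ lit 0) σ (a + (2 + suc e)) (Loop N)
    initial = halts (_ , _ , assign ,
      ≤-trans (lit≤ 1) (^-mono (≤-trans (s≤s z≤n) (m≤n+m (3 + e) a))) ,
      0 , refl , update-same (regs σ) r 0 , fr , i₀)
      where
      fr : Frame p⁺ σ σ₀
      fr .keepReg s {h} with s ≡ᵇ r | not-∨ʳ (writes p s) h
      ... | false | _ = refl
      fr .keepArray s = refl
    nq : T (not (writes p⁺ q))
    nq = not-∨ (writes p q) h₂ h₃
    body : ∀ {ρ} m τ → Frame p⁺ ρ τ → Loop m τ →
      (eval (reg q ⊖ reg r) τ ≡ 0 × I N τ) ⊎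
      (eval (reg q ⊖ reg r) τ ≢ 0 × ∃[ m′ ] m ≡ suc m′ × Halts p⁺ τ (suc e) (Loop m′))
    body zero τ _ (i , eq , ri , φ , inv) =
      inj₁ (trans (cong₂ _∸_ (trans (keepReg φ q {nq}) bnd) ri)
                  (m≤n⇒m∸n≡0 (≤-reflexive (trans (sym eq) (+-identityʳ i))))
           , subst (λ k → I k τ) (trans (sym (+-identityʳ i)) eq) inv)
    body (suc m) τ _ (i , eq , ri , φ , inv) = inj₂
      ( (λ z → <⇒≱ i<N (subst₂ _≤_ (trans (keepReg φ q {nq}) bnd) ri (m∸n≡0⇒m≤n z)))
      , m , refl
      , (step i τ i<N φ ri inv then λ υ ψ inv′ → inc υ ψ inv′))
      where
      i<N : i < N
      i<N = subst (i <_) eq (m<m+n i (s≤s z≤n))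
      inc : ∀ υ → Frame p τ υ → I (suc i) (setReg υ r (suc i)) →
        Halts (r ≔ reg r ⊕ lit 1) υ e (Loop m)
      inc υ ψ inv′ = halts (_ , _ , d , ≤-trans (s≤s (s≤s (s≤s (s≤s z≤n)))) (lit≤ e {h₄}) ,
        suc i , trans (sym (+-suc i m)) eq , trans (update-same (regs υ) r _) val ,
        frame-trans φ fr , subst (λ k → I (suc i) (setReg υ r k)) (sym val) inv′)
        where
        d : (r ≔ reg r ⊕ lit 1) from υ ⇓ _ inTime _
        d = assign
        val : regs υ r + 1 ≡ suc i
        val = trans (+-comm _ 1) (cong suc (trans (keepReg ψ r {h₁}) ri))
        fr : Frame p⁺ τ (setReg υ r (regs υ r + 1))
        fr .keepReg s {h} = trans (keptReg d s (not-∨ʳ (writes p s) h)) (keepReg ψ s {not-∨ˡ (writes p s) h})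
        fr .keepArray s {h} = keepArray ψ s {not-∨ˡ (stores p s) h}

-- Finite sums

-- The last summand is split off because an accumulating loop adds its terms in this order.
∑ : ℕ → (ℕ → ℕ) → ℕ
∑ zero    f = 0
∑ (suc n) f = ∑ n f + f n

∑-cong : ∀ n {f g : ℕ → ℕ} → (∀ {i} → i < n → f i ≡ g i) → ∑ n f ≡ ∑ n g
∑-cong zero    h = refl
∑-cong (suc n) h = cong₂ _+_ (∑-cong n λ i<n → h (m<n⇒m<1+n i<n)) (h ≤-refl)

∑-mono : ∀ n {f g : ℕ → ℕ} → (∀ {i} → i < n → f i ≤ g i) → ∑ n f ≤ ∑ n g
∑-mono zero    h = z≤n
∑-mono (suc n) h = +-mono-≤ (∑-mono n λ i<n → h (m<n⇒m<1+n i<n)) (h ≤-refl)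

∑-+ : ∀ n f g → ∑ n (λ i → f i + g i) ≡ ∑ n f + ∑ n g
∑-+ zero    f g = refl
∑-+ (suc n) f g = trans (cong (_+ (f n + g n)) (∑-+ n f g)) (lemma (∑ n f) (∑ n g) (f n) (g n))
  where
  lemma : ∀ a b c d → a + b + (c + d) ≡ a + c + (b + d)
  lemma = solve-∀

∑-* : ∀ n c f → ∑ n (λ i → c * f i) ≡ c * ∑ n f
∑-* zero    c f = sym (*-zeroʳ c)
∑-* (suc n) c f = trans (cong (_+ c * f n) (∑-* n c f)) (sym (*-distribˡ-+ c _ _))

∑-const : ∀ n c → ∑ n (λ _ → c) ≡ n * c
∑-const zero    c = refl
∑-const (suc n) c = trans (cong (_+ c) (∑-const n c)) (+-comm _ c)

∑-≤const : ∀ n {f : ℕ → ℕ} {c} → (∀ {i} → i < n → f i ≤ c) → ∑ n f ≤ n * c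
∑-≤const n {c = c} h = ≤-trans (∑-mono n h) (≤-reflexive (∑-const n c))

∑-zero : ∀ n {f : ℕ → ℕ} → (∀ {i} → i < n → f i ≡ 0) → ∑ n f ≡ 0
∑-zero n h = trans (∑-cong n h) (trans (∑-const n 0) (*-zeroʳ n))

∑-swap : ∀ m n (f : ℕ → ℕ → ℕ) → ∑ m (λ i → ∑ n (f i)) ≡ ∑ n (λ j → ∑ m (λ i → f i j))
∑-swap zero    n f = sym (∑-zero n λ _ → refl)
∑-swap (suc m) n f = trans (cong (_+ ∑ n (f m)) (∑-swap m n f)) (sym (∑-+ n _ _))

term≤∑ : ∀ {n i} f → i < n → f i ≤ ∑ n f
term≤∑ {suc n} f i<1+n with m≤n⇒m<n∨m≡n (s≤s⁻¹ i<1+n)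
... | inj₁ i<n  = m≤n⇒m≤n+o (f n) (term≤∑ f i<n)
... | inj₂ refl = m≤n+m (f n) (∑ n f)

∑-monoˡ : ∀ {m n} f → m ≤ n → ∑ m f ≤ ∑ n f
∑-monoˡ {m} {zero} f z≤n = z≤n
∑-monoˡ {m} {suc n} f m≤ with m≤n⇒m<n∨m≡n m≤
... | inj₁ m<  = m≤n⇒m≤n+o (f n) (∑-monoˡ f (s≤s⁻¹ m<))
... | inj₂ refl = ≤-refl

∑-head : ∀ n f → ∑ (suc n) f ≡ f 0 + ∑ n (λ i → f (suc i))
∑-head zero    f = sym (+-identityʳ (f 0))
∑-head (suc n) f = trans (cong (_+ f (suc n)) (∑-head n f)) (+-assoc (f 0) _ _)

∑-append : ∀ m n f → ∑ (m + n) f ≡ ∑ m f + ∑ n (λ i → f (m + i))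
∑-append m zero f rewrite +-identityʳ m = sym (+-identityʳ _)
∑-append m (suc n) f rewrite +-suc m n =
  trans (cong (_+ f (m + n)) (∑-append m n f)) (+-assoc (∑ m f) _ _)

∑-blocks : ∀ m c f → ∑ (m * c) f ≡ ∑ m (λ i → ∑ c (λ s → f (i * c + s)))
∑-blocks zero    c f = refl
∑-blocks (suc m) c f rewrite +-comm c (m * c) =
  trans (∑-append (m * c) c f) (cong (_+ ∑ c (λ s → f (m * c + s))) (∑-blocks m c f))

∑-bump : ∀ {n i} (f g : ℕ → ℕ) y → i < n → (∀ {j} → j ≢ i → g j ≡ f j) → g i ≡ f i + y → ∑ n g ≡ ∑ n f + y
∑-bump {suc n} {i} f g y i< same bump with m≤n⇒m<n∨m≡n (s≤s⁻¹ i<)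
... | inj₁ i<n rewrite ∑-bump {n} f g y i<n same bump | same {n} (λ { refl → <-irrefl refl i<n }) =
  lemma (∑ n f) y (f n)
  where
  lemma : ∀ a b c → a + b + c ≡ a + c + b
  lemma = solve-∀
... | inj₂ refl rewrite ∑-cong n {g} {f} (λ {j} j<n → same {j} λ { refl → <-irrefl refl j<n }) | bump =
  sym (+-assoc (∑ n f) (f n) y)

-- Kronecker delta, and sums along injective and surjective maps

δ : ℕ → ℕ → ℕ
δ i j = if i ≡ᵇ j then 1 else 0

δ-yes : ∀ {i j} → i ≡ j → δ i j ≡ 1
δ-yes {i} refl rewrite dec-true (i ≟ i) refl = refl

δ-no : ∀ {i j} → i ≢ j → δ i j ≡ 0
δ-no {i} {j} i≢j rewrite dec-false (i ≟ j) i≢j = refl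

δ-cases : ∀ i j → (i ≡ j × δ i j ≡ 1) ⊎ (i ≢ j × δ i j ≡ 0)
δ-cases i j with i ≟ j
... | yes p = inj₁ (p , δ-yes p)
... | no  p = inj₂ (p , δ-no p)

δ-mono : ∀ {i j k l} → (i ≡ j → k ≡ l) → δ i j ≤ δ k l
δ-mono {i} {j} h with δ-cases i j
... | inj₁ (p , e) = ≤-reflexive (trans e (sym (δ-yes (h p))))
... | inj₂ (_ , e) = ≤-trans (≤-reflexive e) z≤n

δ≤1 : ∀ i j → δ i j ≤ 1
δ≤1 i j = δ-mono {i} {j} {0} {0} λ _ → refl

InjectiveBelow : ℕ → (ℕ → ℕ) → Set
InjectiveBelow n g = ∀ {u v} → u < n → v < n → g u ≡ g v → u ≡ v

count-injective : ∀ n {g : ℕ → ℕ} j → InjectiveBelow n g → ∑ n (λ v → δ (g v) j) ≤ 1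
count-injective zero j inj = z≤n
count-injective (suc n) {g} j inj with δ-cases (g n) j
... | inj₂ (_ , e) rewrite e | +-identityʳ (∑ n (λ v → δ (g v) j)) =
  count-injective n j λ u<n v<n → inj (m<n⇒m<1+n u<n) (m<n⇒m<1+n v<n)
... | inj₁ (refl , e) rewrite e | ∑-zero n {λ v → δ (g v) j}
    (λ {v} v<n → δ-no {g v} λ eq → <⇒≢ v<n (inj (m<n⇒m<1+n v<n) ≤-refl eq)) = ≤-refl

∑-δ≤1 : ∀ n i → ∑ n (λ j → δ i j) ≤ 1
∑-δ≤1 n i = ≤-trans (∑-mono n λ {j} _ → δ-mono {i} {j} {j} {i} sym) (count-injective n i λ _ _ e → e)

∑-δ : ∀ {n i} (h : ℕ → ℕ) → i < n → ∑ n (λ j → δ i j * h j) ≡ h i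
∑-δ {n} {i} h i<n =
  trans (∑-bump {n} {i} (λ _ → 0) (λ j → δ i j * h j) (h i) i<n
           (λ {j} j≢i → cong (_* h j) (δ-no {i} {j} λ e → j≢i (sym e)))
           (trans (cong (_* h i) (δ-yes {i} refl)) (+-identityʳ (h i))))
        (cong (_+ h i) (∑-zero n λ _ → refl))

-- Double counting: the summands are grouped by the value of `g`, and each index is weighted by the
-- size of its fibre. The next two lemmas bound the fibres by 1 from above and from below.
∑-reindex : ∀ n m (g h : ℕ → ℕ) → (∀ {v} → v < n → g v < m) →
  ∑ n (λ v → h (g v)) ≡ ∑ m (λ j → ∑ n (λ v → δ (g v) j) * h j)
∑-reindex n m g h g< = begin
  ∑ n (λ v → h (g v))                       ≡⟨ ∑-cong n (λ v<n → sym (∑-δ h (g< v<n))) ⟩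
  ∑ n (λ v → ∑ m (λ j → δ (g v) j * h j))   ≡⟨ ∑-swap n m _ ⟩
  ∑ m (λ j → ∑ n (λ v → δ (g v) j * h j))   ≡⟨ ∑-cong m (λ {j} _ → pull j) ⟩
  ∑ m (λ j → ∑ n (λ v → δ (g v) j) * h j)   ∎
  where
  open ≡-Reasoning
  pull : ∀ j → ∑ n (λ v → δ (g v) j * h j) ≡ ∑ n (λ v → δ (g v) j) * h j
  pull j = trans (∑-cong n λ {v} _ → *-comm (δ (g v) j) (h j))
                 (trans (∑-* n (h j) _) (*-comm (h j) _))

∑-injective : ∀ n m (g h : ℕ → ℕ) → (∀ {v} → v < n → g v < m) → InjectiveBelow n g →
  ∑ n (λ v → h (g v)) ≤ ∑ m h
∑-injective n m g h g< inj = ≤-trans (≤-reflexive (∑-reindex n m g h g<))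
  (∑-mono m λ {j} _ → ≤-trans (*-monoˡ-≤ (h j) (count-injective n j inj)) (≤-reflexive (*-identityˡ (h j))))

-- An index without preimage is allowed where `h` vanishes; in the auction these are the unsold
-- slots, whose price is 0.
∑-surjective : ∀ n m (g h : ℕ → ℕ) → (∀ {v} → v < n → g v < m) →
  (∀ {j} → j < m → h j ≡ 0 ⊎ ∃[ v ] v < n × g v ≡ j) → ∑ m h ≤ ∑ n (λ v → h (g v))
∑-surjective n m g h g< sur = ≤-trans (∑-mono m term) (≤-reflexive (sym (∑-reindex n m g h g<)))
  where
  term : ∀ {j} → j < m → h j ≤ ∑ n (λ v → δ (g v) j) * h j
  term {j} j<m with sur j<m
  ... | inj₁ e rewrite e = z≤n
  ... | inj₂ (v , v<n , refl) = ≤-trans (≤-reflexive (sym (*-identityˡ (h j))))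
    (*-monoˡ-≤ (h j) (≤-trans (≤-reflexive (sym (δ-yes {g v} refl))) (term≤∑ (λ u → δ (g u) j) v<n)))

∑≢0 : ∀ n {f : ℕ → ℕ} → ∑ n f ≢ 0 → ∃[ i ] i < n × f i ≢ 0
∑≢0 zero    h = contradiction refl h
∑≢0 (suc n) {f} h with f n ≟ 0
... | no ne = n , ≤-refl , ne
... | yes e with ∑≢0 n {f} (λ z → h (cong₂ _+_ z e))
...   | i , i<n , ne = i , m<n⇒m<1+n i<n , ne

∑≡0 : ∀ {n i} (f : ℕ → ℕ) → ∑ n f ≡ 0 → i < n → f i ≡ 0
∑≡0 f e i<n = n≤0⇒n≡0 (≤-trans (term≤∑ f i<n) (≤-reflexive e))

choose : ∀ n {P : ℕ → ℕ → Set} → (∀ {v} → v < n → ∃[ j ] P v j) → Σ[ f ∈ (ℕ → ℕ) ] (∀ {v} → v < n → P v (f v))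
choose n {P} h = f , λ {v} → spec v
  where
  f : ℕ → ℕ
  f v with v <? n
  ... | yes v<n = proj₁ (h v<n)
  ... | no _    = 0
  spec : ∀ v → v < n → P v (f v)
  spec v v<n with v <? n
  ... | yes p = proj₂ (h p)
  ... | no ¬p = contradiction v<n ¬p

-- The auction algorithm

module AuctionTheory (n S W : ℕ) (w : ℕ → ℕ → ℕ) where

  -- owner j is 0 if slot j is free, and suc v if it is held by v.
  record IsAuction (price owner : ℕ → ℕ) : Set where
    field
      distinct : ∀ {i j} → i < S → j < S → owner i ≢ 0 → owner i ≡ owner j → i ≡ j
      range    : ∀ {j} → j < S → owner j ≤ n
      unsold   : ∀ {j} → j < S → owner j ≡ 0 → price j ≡ 0
      -- Complementary slackness relaxed by one price increment, with the prices as dual variables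
      -- of the assignment problem.
      slack    : ∀ {i j v} → i < S → j < S → owner j ≡ suc v → w v j + price j ≤ suc (w v i + price i)
      bounded  : ∀ {j} → j < S → price j ≤ suc W

  open IsAuction public

  initial : ∀ {price owner} → (∀ {j} → j < S → price j ≡ 0) → (∀ {j} → j < S → owner j ≡ 0) →
    IsAuction price owner
  initial {price} {owner} p0 o0 = record
    { distinct = λ i< _ nz _ → contradiction (o0 i<) nz
    ; range    = λ j< → subst (_≤ n) (sym (o0 j<)) z≤n
    ; unsold   = λ j< _ → p0 j<
    ; slack    = λ _ j< e → contradiction (trans (sym (o0 j<)) e) λ ()
    ; bounded  = λ j< → subst (_≤ suc W) (sym (p0 j<)) z≤n
    }

  module _ {price owner : ℕ → ℕ} (inv : IsAuction price owner) {u : ℕ} (n≤S : n ≤ S) (u<n : u < n)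
           (unowned : ∀ {j} → j < S → owner j ≢ suc u) where

    -- If every slot were held, then `u` together with the holders would give `suc S` distinct
    -- vertices, although there are only n ≤ S of them.
    free-slot : ∃[ j ] j < S × owner j ≡ 0
    free-slot with anyUpTo? (λ j → owner j ≟ 0) S
    ... | yes p = p
    ... | no all-owned = contradiction (proj₂ (proj₂ (proj₂ collision)))
        (clash _ _ (proj₁ (proj₂ (proj₂ collision))))
      where
      owned : ∀ {j} → j < S → owner j ≢ 0
      owned j< e = all-owned (_ , j< , e)
      suc-pred-owner : ∀ {j} → j < S → suc (pred (owner j)) ≡ owner j
      suc-pred-owner j< = suc-pred _ {{≢-nonZero (owned j<)}}
      holder : Fin (suc S) → ℕ
      holder Fin.zero    = u
      holder (Fin.suc j) = pred (owner (toℕ j))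
      holder<n : ∀ i → holder i < n
      holder<n Fin.zero    = u<n
      holder<n (Fin.suc j) = subst (_≤ n) (sym (suc-pred-owner (toℕ<n j))) (range inv (toℕ<n j))
      clash : ∀ i j → i Fin.< j → holder i ≢ holder j
      clash Fin.zero (Fin.suc j) _ e = unowned (toℕ<n j)
        (trans (sym (suc-pred-owner (toℕ<n j))) (cong suc (sym e)))
      clash (Fin.suc i) (Fin.suc j) i<j e = <⇒≢ (s≤s⁻¹ i<j)
        (distinct inv (toℕ<n i) (toℕ<n j) (owned (toℕ<n i))
          (trans (sym (suc-pred-owner (toℕ<n i))) (trans (cong suc e) (suc-pred-owner (toℕ<n j)))))
      collision : ∃[ i ] ∃[ j ] i Fin.< j × holder i ≡ holder j
      collision with pigeonhole (s≤s n≤S) (λ i → fromℕ< (holder<n i))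
      ... | i , j , i<j , e = i , j , i<j ,
        trans (sym (toℕ-fromℕ< (holder<n i))) (trans (cong toℕ e) (toℕ-fromℕ< (holder<n j)))

    -- The new holder took a cheapest slot, so raising its price by 1 stays within the permitted
    -- slack; for every other holder only the right-hand side can grow.
    bid : ∀ {b} → (∀ {j} → j < S → w u j ≤ W) → b < S →
      (∀ {i} → i < S → w u b + price b ≤ w u i + price i) →
      IsAuction (update price b (suc (price b))) (update owner b (suc u))
    bid {b} w≤W b<S best = record
      { distinct = distinct′ ; range = range′ ; unsold = unsold′ ; slack = slack′ ; bounded = bounded′ }
      where
      price′ = update price b (suc (price b))
      owner′ = update owner b (suc u)
      rises : ∀ i → price i ≤ price′ i
      rises i with i ≟ b
      ... | yes refl rewrite update-same price b (suc (price b)) = n≤1+n _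
      ... | no i≢b rewrite update-other price (suc (price b)) i≢b = ≤-refl
      distinct′ : ∀ {i j} → i < S → j < S → owner′ i ≢ 0 → owner′ i ≡ owner′ j → i ≡ j
      distinct′ {i} {j} i< j< nz e with i ≟ b | j ≟ b
      ... | yes refl | yes refl = refl
      ... | yes refl | no j≢b = contradiction
        (trans (sym (update-other owner (suc u) j≢b)) (trans (sym e) (update-same owner b (suc u)))) (unowned j<)
      ... | no i≢b | yes refl = contradiction
        (trans (sym (update-other owner (suc u) i≢b)) (trans e (update-same owner b (suc u)))) (unowned i<)
      ... | no i≢b | no j≢b rewrite update-other owner (suc u) i≢b | update-other owner (suc u) j≢b =
        distinct inv i< j< nz e
      range′ : ∀ {j} → j < S → owner′ j ≤ n
      range′ {j} j< with j ≟ b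
      ... | yes refl rewrite update-same owner b (suc u) = u<n
      ... | no j≢b rewrite update-other owner (suc u) j≢b = range inv j<
      unsold′ : ∀ {j} → j < S → owner′ j ≡ 0 → price′ j ≡ 0
      unsold′ {j} j< e with j ≟ b
      ... | yes refl = contradiction (trans (sym (update-same owner b (suc u))) e) λ ()
      ... | no j≢b rewrite update-other price (suc (price b)) j≢b =
        unsold inv j< (trans (sym (update-other owner (suc u) j≢b)) e)
      slack′ : ∀ {i j v} → i < S → j < S → owner′ j ≡ suc v → w v j + price′ j ≤ suc (w v i + price′ i)
      slack′ {i} {j} {v} i< j< e with j ≟ b
      ... | yes refl with trans (sym (update-same owner b (suc u))) e
      ...   | refl rewrite update-same price b (suc (price b)) | +-suc (w u b) (price b) =
        s≤s (≤-trans (best i<) (+-monoʳ-≤ (w u i) (rises i)))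
      slack′ {i} {j} {v} i< j< e | no j≢b rewrite update-other price (suc (price b)) j≢b =
        ≤-trans (slack inv i< j< (trans (sym (update-other owner (suc u) j≢b)) e))
                (s≤s (+-monoʳ-≤ (w v i) (rises i)))
      bounded′ : ∀ {j} → j < S → price′ j ≤ suc W
      bounded′ {j} j< with j ≟ b
      ... | no j≢b rewrite update-other price (suc (price b)) j≢b = bounded inv j<
      ... | yes refl rewrite update-same price b (suc (price b)) with free-slot
      -- The free slot `i` has price 0, so the winning total, and with it the old price of `b`, is
      -- at most the weight of `i`, hence at most `W`.
      ...   | i , i< , e = s≤s (≤-trans (m≤n+m (price b) (w u b))
        (≤-trans (best i<) (≤-trans (≤-reflexive (trans (cong (w u i +_) (unsold inv i< e)) (+-identityʳ _)))
            (w≤W i<))))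

  -- Each of the n vertices is within one price increment of its best offer.
  near-optimal : ∀ {price owner} → IsAuction price owner →
    ∀ f → (∀ {v} → v < n → f v < S × owner (f v) ≡ suc v) →
    ∀ g → (∀ {v} → v < n → g v < S) → InjectiveBelow n g →
    ∑ n (λ v → w v (f v)) ≤ ∑ n (λ v → w v (g v)) + n
  near-optimal {price} {owner} inv f holds g g< inj = +-cancelʳ-≤ (∑ S price) _ _ (begin
    -- All prices are added to both sides: unsold slots cost nothing, so the slots of `f` account
    -- for the whole price sum, while the injective `g` pays at most that sum.
    ∑ n (λ v → w v (f v)) + ∑ S price               ≤⟨ +-monoʳ-≤ (∑ n (λ v → w v (f v)))
        (∑-surjective n S f price (λ v< → proj₁ (holds v<)) sold) ⟩
    ∑ n (λ v → w v (f v)) + ∑ n (λ v → price (f v)) ≡⟨ sym (∑-+ n _ _) ⟩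
    ∑ n (λ v → w v (f v) + price (f v))             ≤⟨ ∑-mono n
        (λ v< → slack inv (g< v<) (proj₁ (holds v<)) (proj₂ (holds v<))) ⟩
    ∑ n (λ v → 1 + (w v (g v) + price (g v)))       ≡⟨ ∑-+ n (λ _ → 1) _ ⟩
    ∑ n (λ _ → 1) + ∑ n (λ v → w v (g v) + price (g v))
                                                    ≡⟨ cong₂ _+_ (trans (∑-const n 1) (*-identityʳ n)) (∑-+ n _ _) ⟩
    n + (∑ n (λ v → w v (g v)) + ∑ n (λ v → price (g v)))
                                                    ≤⟨ +-monoʳ-≤ n (+-monoʳ-≤ (∑ n (λ v → w v (g v)))
                                                        (∑-injective n S g price g< inj)) ⟩
    n + (∑ n (λ v → w v (g v)) + ∑ S price)         ≡⟨ lemma n (∑ n (λ v → w v (g v))) (∑ S price) ⟩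
    ∑ n (λ v → w v (g v)) + n + ∑ S price           ∎)
    where
    open ≤-Reasoning
    lemma : ∀ a b c → a + (b + c) ≡ b + a + c
    lemma = solve-∀
    sold : ∀ {j} → j < S → price j ≡ 0 ⊎ ∃[ v ] v < n × f v ≡ j
    sold {j} j< with owner j in eq
    ... | zero  = inj₁ (unsold inv j< eq)
    ... | suc v = inj₂ (v , v<n , distinct inv (proj₁ (holds v<n)) j<
          (λ e → contradiction (trans (sym (proj₂ (holds v<n))) e) λ ()) (trans (proj₂ (holds v<n)) (sym eq)))
      where
      v<n : v < n
      v<n = subst (_≤ n) eq (range inv j<)

-- Bucket arrangements

-- Nonzero numbers are true; both connectives take values in {0, 1} and are
-- values of machine expressions.
truth : ℕ → ℕ
truth x = 1 ∸ (1 ∸ x)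

conj : ℕ → ℕ → ℕ
conj x y = 1 ∸ ((1 ∸ x) + (1 ∸ y))

differ far : ℕ → ℕ → ℕ
differ i j = (i ∸ j) + (j ∸ i)
far i j = differ i j ∸ 1

truth≤1 : ∀ x → truth x ≤ 1
truth≤1 x = m∸n≤m 1 (1 ∸ x)

truth≤ : ∀ x → truth x ≤ x
truth≤ zero    = z≤n
truth≤ (suc x) rewrite 0∸n≡0 x = s≤s z≤n

truth-suc : ∀ x → truth (suc x) ≡ 1
truth-suc x rewrite 0∸n≡0 x = refl

truth≢0 : ∀ {x} → x ≢ 0 → truth x ≡ 1
truth≢0 {zero} h = contradiction refl h
truth≢0 {suc x} h = truth-suc x

conj-truth : ∀ x y → conj x y ≡ truth x * truth y
conj-truth zero y = 0∸n≡0 (1 ∸ y)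
conj-truth (suc x) y rewrite 0∸n≡0 x = sym (+-identityʳ (truth y))

conj≤1 : ∀ x y → conj x y ≤ 1
conj≤1 x y = m∸n≤m 1 ((1 ∸ x) + (1 ∸ y))

conj-zeroˡ : ∀ {x} y → x ≡ 0 → conj x y ≡ 0
conj-zeroˡ y refl = 0∸n≡0 (1 ∸ y)

conj-comm : ∀ x y → conj x y ≡ conj y x
conj-comm x y = cong (1 ∸_) (+-comm (1 ∸ x) (1 ∸ y))

conj-zeroʳ : ∀ x {y} → y ≡ 0 → conj x y ≡ 0
conj-zeroʳ x {y} e = trans (conj-comm x y) (conj-zeroˡ x e)

conj-one : ∀ {x y} → x ≢ 0 → y ≢ 0 → conj x y ≡ 1
conj-one {x} {y} p q = trans (conj-truth x y) (cong₂ _*_ (truth≢0 p) (truth≢0 q))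

conj-monoʳ : ∀ x {y z} → y ≤ z → conj x y ≤ conj x z
conj-monoʳ x y≤z = ∸-monoʳ-≤ 1 (+-monoʳ-≤ (1 ∸ x) (∸-monoʳ-≤ 1 y≤z))

conj≢0ˡ : ∀ {x y} → conj x y ≢ 0 → x ≢ 0
conj≢0ˡ {y = y} h refl = h (conj-zeroˡ y refl)

conj≢0ʳ : ∀ {x y} → conj x y ≢ 0 → y ≢ 0
conj≢0ʳ {x} h refl = h (conj-zeroʳ x refl)

differ-comm : ∀ i j → differ i j ≡ differ j i
differ-comm i j = +-comm (i ∸ j) (j ∸ i)

differ≢0 : ∀ {i j} → i ≢ j → differ i j ≢ 0
differ≢0 {i} {j} i≢j e = i≢j (≤-antisym (m∸n≡0⇒m≤n (m+n≡0⇒m≡0 (i ∸ j) e)) (m∸n≡0⇒m≤n (m+n≡0⇒n≡0 (i ∸ j) e)))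

differ-self : ∀ {i j} → i ≡ j → differ i j ≡ 0
differ-self {i} refl rewrite n∸n≡0 i = refl

differ≡0⇒≡ : ∀ {i j} → differ i j ≡ 0 → i ≡ j
differ≡0⇒≡ {i} {j} e with i ≟ j
... | yes p = p
... | no  p = contradiction e (differ≢0 p)

differ-≤ : ∀ {i j} → i ≤ j → differ i j ≡ j ∸ i
differ-≤ {i} {j} i≤j = cong (_+ (j ∸ i)) (m≤n⇒m∸n≡0 i≤j)

far-comm : ∀ i j → far i j ≡ far j i
far-comm i j = cong (_∸ 1) (differ-comm i j)

-- Ordered pairs are counted, so for a symmetric irreflexive `a` this is twice the number of long
-- edges. It spares the comparison u < v in sums and in the loops of the program.
Λ : ℕ → (ℕ → ℕ → ℕ) → (ℕ → ℕ) → ℕ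
Λ n a f = ∑ n λ u → ∑ n λ v → conj (a u v) (far (f u) (f v))

Λ≤ : ∀ n a f → Λ n a f ≤ n * n
Λ≤ n a f = ∑-≤const n λ {u} _ → ≤-trans (∑-≤const n λ {v} _ → conj≤1 (a u v) (far (f u) (f v)))
    (≤-reflexive (*-identityʳ n))

Λ-cong : ∀ n a {f g} → (∀ {v} → v < n → f v ≡ g v) → Λ n a f ≡ Λ n a g
Λ-cong n a h = ∑-cong n λ {u} u<n → ∑-cong n λ {v} v<n → cong₂ (λ i j → conj (a u v) (far i j)) (h u<n) (h v<n)

-- Buckets may be empty here; nonemptiness is restored only when the output is closed up.
Fits : ℕ → ℕ → (ℕ → ℕ) → Set
Fits n c f = ∀ i → ∑ n (λ v → δ (f v) i) ≤ c

-- Each bucket of `g` lies inside a single bucket of `f`.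
Fits-refine : ∀ {n c f g} → (∀ {u v} → u < n → v < n → g u ≡ g v → f u ≡ f v) → Fits n c f → Fits n c g
Fits-refine {n} {c} {f} {g} h fits i with anyUpTo? (λ v → g v ≟ i) n
... | yes (v , v<n , refl) =
  ≤-trans (∑-mono n λ {u} u<n → δ-mono {g u} {g v} {f u} {f v} (h u<n v<n)) (fits (f v))
... | no none =
  ≤-trans (≤-reflexive (∑-zero n λ {v} v<n → δ-no {g v} λ e → none (v , v<n , e))) z≤n

-- Closing up the buckets that are not kept

module Rank (kept : ℕ → ℕ) (kept≤1 : ∀ i → kept i ≤ 1) where

  rank : ℕ → ℕ
  rank i = ∑ i kept

  rank-mono : ∀ {i j} → i ≤ j → rank i ≤ rank j
  rank-mono = ∑-monoˡ kept

  rank-+ : ∀ i k → rank (i + k) ≤ rank i + k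
  rank-+ i k = ≤-trans (≤-reflexive (∑-append i k kept))
    (+-monoʳ-≤ (rank i) (≤-trans (∑-≤const k λ _ → kept≤1 _) (≤-reflexive (*-identityʳ k))))

  -- `rank` is monotone and gains at most 1 per index, so closing gaps never increases a distance
  -- and no short edge becomes long.
  differ-rank-≤ : ∀ {i j} → i ≤ j → differ (rank i) (rank j) ≤ differ i j
  differ-rank-≤ {i} {j} i≤j rewrite differ-≤ (rank-mono i≤j) | differ-≤ i≤j = m≤n+o⇒m∸n≤o (rank j) (rank i)
    (≤-trans (≤-reflexive (cong rank (sym (m+[n∸m]≡n i≤j)))) (rank-+ i (j ∸ i)))

  differ-rank : ∀ i j → differ (rank i) (rank j) ≤ differ i j
  differ-rank i j with ≤-total i j
  ... | inj₁ i≤j = differ-rank-≤ i≤j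
  ... | inj₂ j≤i = subst₂ _≤_ (differ-comm (rank j) (rank i)) (differ-comm j i) (differ-rank-≤ j≤i)

  far-rank : ∀ i j → far (rank i) (rank j) ≤ far i j
  far-rank i j = ∸-monoˡ-≤ 1 (differ-rank i j)

  rank-< : ∀ {i j} → kept i ≢ 0 → i < j → rank i < rank j
  rank-< {i} k i<j = ≤-trans
    (≤-trans (≤-reflexive (+-comm 1 (rank i))) (+-monoʳ-≤ (rank i) (n≢0⇒n>0 k))) (rank-mono i<j)

  rank-injective : ∀ {i j} → kept i ≢ 0 → kept j ≢ 0 → rank i ≡ rank j → i ≡ j
  rank-injective {i} {j} ki kj e with <-cmp i j
  ... | tri< i<j _ _ = contradiction e (<⇒≢ (rank-< ki i<j))
  ... | tri≈ _ i≡j _ = i≡j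
  ... | tri> _ _ j<i = contradiction (sym e) (<⇒≢ (rank-< kj j<i))

-- Normal form: the cover within the first 3|D| buckets

module Normalise (n : ℕ) (a : ℕ → ℕ → ℕ) (a-sym : ∀ u v → a u v ≡ a v u)
  (D : ℕ → ℕ) (D≤1 : ∀ v → D v ≤ 1)
  (covers : ∀ {u v} → u < n → v < n → a u v ≢ 0 → D u ≢ 0 ⊎ D v ≢ 0)
  (f : ℕ → ℕ) where

  near : ℕ → ℕ → ℕ
  near i j = 1 ∸ far i j

  -- Only `j` equal to `i`, to its successor or to its predecessor is near `i`; the predecessor is
  -- expressed by `i ≡ suc j` to avoid truncation at 0.
  near≤δ : ∀ i j → near i j ≤ δ i j + (δ (suc i) j + δ i (suc j))
  near≤δ i j with <-cmp i j
  ... | tri≈ _ refl _ rewrite δ-yes {i} refl = ≤-trans (m∸n≤m 1 (far i i)) (s≤s z≤n)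
  ... | tri< i<j _ _ with m≤n⇒m<n∨m≡n i<j
  ...   | inj₂ refl rewrite δ-yes {suc i} refl = ≤-trans (m∸n≤m 1 (far i (suc i)))
            (≤-trans (s≤s z≤n) (m≤n+m (suc (δ i (suc (suc i)))) (δ i (suc i))))
  ...   | inj₁ 1+i<j = ≤-trans (≤-reflexive (m≤n⇒m∸n≡0 (∸-monoˡ-≤ 1 (m≤n⇒m≤o+n (i ∸ j)
            (≤-trans (≤-reflexive (sym (m+n∸n≡m 2 i))) (∸-monoˡ-≤ i 1+i<j)))))) z≤n
  near≤δ i j | tri> _ _ j<i with m≤n⇒m<n∨m≡n j<i
  ...   | inj₂ refl rewrite δ-yes {suc j} refl =
            ≤-trans (m∸n≤m 1 (far (suc j) j)) (m≤n⇒m≤o+n (δ (suc j) j) (m≤n⇒m≤o+n (δ (suc (suc j)) j) ≤-refl))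
  ...   | inj₁ 1+j<i = ≤-trans (≤-reflexive (m≤n⇒m∸n≡0 (∸-monoˡ-≤ 1 (m≤n⇒m≤n+o (j ∸ i)
            (≤-trans (≤-reflexive (sym (m+n∸n≡m 2 j))) (∸-monoˡ-≤ j 1+j<i)))))) z≤n

  ∑-near≤3 : ∀ m i → ∑ m (near i) ≤ 3
  ∑-near≤3 m i = begin
    ∑ m (near i)                                            ≤⟨ ∑-mono m (λ {j} _ → near≤δ i j) ⟩
    ∑ m (λ j → δ i j + (δ (suc i) j + δ i (suc j)))         ≡⟨ ∑-+ m _ _ ⟩
    ∑ m (δ i) + ∑ m (λ j → δ (suc i) j + δ i (suc j))       ≡⟨ cong (∑ m (δ i) +_) (∑-+ m _ _) ⟩
    ∑ m (δ i) + (∑ m (δ (suc i)) + ∑ m (λ j → δ i (suc j))) ≤⟨ +-mono-≤ (∑-δ≤1 m i)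
        (+-mono-≤ (∑-δ≤1 m (suc i)) last) ⟩
    3                                                       ∎
    where
    open ≤-Reasoning
    last : ∑ m (λ j → δ i (suc j)) ≤ 1
    last = ≤-trans (m≤n+m _ (δ i 0)) (≤-trans (≤-reflexive (sym (∑-head m (δ i)))) (∑-δ≤1 (suc m) i))

  -- The buckets at distance at most 1 from a bucket that meets the cover.
  support : ℕ → ℕ
  support j = ∑ n λ u → D u * near (f u) j

  opaque

    relevant : ℕ → ℕ
    relevant j = truth (support j)

    relevant≤1 : ∀ j → relevant j ≤ 1
    relevant≤1 j = truth≤1 (support j)

    relevant≤ : ∀ j → relevant j ≤ support j
    relevant≤ j = truth≤ (support j)

    relevant≡0 : ∀ {j} → relevant j ≡ 0 → support j ≡ 0
    relevant≡0 {j} e = n≤0⇒n≡0 (≮⇒≥ λ s>0 → contradiction (trans (sym (truth≢0 (>⇒≢ s>0))) e) λ ())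

  open Rank relevant relevant≤1

  d L : ℕ
  d = ∑ n D
  L = d + d + d

  -- Every relevant bucket is near some cover vertex, and each cover vertex has at most three
  -- buckets near it.
  rank≤L : ∀ m → rank m ≤ L
  rank≤L m = begin
    ∑ m relevant                            ≤⟨ ∑-mono m (λ {j} _ → relevant≤ j) ⟩
    ∑ m support                             ≡⟨ ∑-swap m n _ ⟩
    ∑ n (λ u → ∑ m λ j → D u * near (f u) j) ≡⟨ ∑-cong n (λ {u} _ → ∑-* m (D u) _) ⟩
    ∑ n (λ u → D u * ∑ m (near (f u)))      ≤⟨ ∑-mono n (λ {u} _ → *-monoʳ-≤ (D u) (∑-near≤3 m (f u))) ⟩
    ∑ n (λ u → D u * 3)                     ≡⟨ ∑-cong n (λ {u} _ → *-comm (D u) 3) ⟩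
    ∑ n (λ u → 3 * D u)                     ≡⟨ ∑-* n 3 D ⟩
    3 * d                                   ≡⟨ lemma d ⟩
    L                                       ∎
    where
    open ≤-Reasoning
    lemma : ∀ d → 3 * d ≡ d + d + d
    lemma = solve-∀

  relevant-near : ∀ {u j} → u < n → D u ≢ 0 → far (f u) j ≡ 0 → relevant j ≢ 0
  relevant-near {u} {j} u<n Du far0 r0 = <⇒≱ (n≢0⇒n>0 Du) (begin
    D u                 ≡⟨ sym (trans (cong (λ k → D u * (1 ∸ k)) far0) (*-identityʳ (D u))) ⟩
    D u * near (f u) j  ≤⟨ term≤∑ (λ u → D u * near (f u) j) u<n ⟩
    support j           ≡⟨ relevant≡0 r0 ⟩
    0                   ∎)
    where open ≤-Reasoning

  relevant-cover : ∀ {u} → u < n → D u ≢ 0 → relevant (f u) ≢ 0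
  relevant-cover {u} u<n Du = relevant-near u<n Du (cong (_∸ 1) (differ-self {f u} refl))

  -- An irrelevant vertex has only long edges, so it may get any bucket of its own.
  normal : ℕ → ℕ
  normal v with relevant (f v) ≟ 0
  ... | yes _ = L + v
  ... | no  _ = rank (f v)

  normal-relevant : ∀ {v} → relevant (f v) ≢ 0 → normal v ≡ rank (f v)
  normal-relevant {v} ne with relevant (f v) ≟ 0
  ... | yes e = contradiction e ne
  ... | no _  = refl

  rank<L : ∀ {i} → relevant i ≢ 0 → rank i < L
  rank<L {i} r = ≤-trans (rank-< r ≤-refl) (rank≤L (suc i))

  normal-cover : ∀ {v} → v < n → D v ≢ 0 → normal v < L
  normal-cover v<n Dv with relevant-cover v<n Dv
  ... | r = subst (_< L) (sym (normal-relevant r)) (rank<L r)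

  normal< : ∀ {v} → v < n → normal v < L + n
  normal< {v} v<n with relevant (f v) ≟ 0
  ... | yes e = +-monoʳ-< L v<n
  ... | no r  = ≤-trans (rank<L r) (m≤m+n L n)

  -- Ranks of relevant buckets are distinct and lie below `L`, the private buckets start at `L`;
  -- hence buckets are at most split, never merged, and the width cannot grow.
  normal-unmerged : ∀ {u v} → u < n → v < n → normal u ≡ normal v → f u ≡ f v
  normal-unmerged {u} {v} _ _ e with relevant (f u) ≟ 0 | relevant (f v) ≟ 0
  ... | yes _ | yes _ = cong f (+-cancelˡ-≡ L u v e)
  ... | yes _ | no r  = contradiction (≤-trans (m≤m+n L u) (≤-reflexive e)) (<⇒≱ (rank<L r))
  ... | no r  | yes _ = contradiction (≤-trans (m≤m+n L v) (≤-reflexive (sym e))) (<⇒≱ (rank<L r))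
  ... | no r  | no r′ = rank-injective r r′ e

  normal-fits : ∀ {c} → Fits n c f → Fits n c normal
  normal-fits = Fits-refine normal-unmerged

  -- If the bucket of `v` is irrelevant, it is not near the bucket of the cover vertex `u`, so an
  -- edge between them is already long under `f`. Otherwise both ends move by `rank`, which does not
  -- increase distances.
  normal-long : ∀ {u v} → u < n → v < n → D u ≢ 0 →
    conj (a u v) (far (normal u) (normal v)) ≤ conj (a u v) (far (f u) (f v))
  normal-long {u} {v} u<n v<n Du = go (a u v ≟ 0) (relevant (f v) ≟ 0)
    where
    go : Dec (a u v ≡ 0) → Dec (relevant (f v) ≡ 0) →
      conj (a u v) (far (normal u) (normal v)) ≤ conj (a u v) (far (f u) (f v))
    go (yes e) _ = ≤-trans (≤-reflexive (conj-zeroˡ (far (normal u) (normal v)) e)) z≤n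
    go (no ne) (yes r0) = ≤-trans (conj≤1 (a u v) (far (normal u) (normal v)))
      (≤-reflexive (sym (conj-one ne λ far0 → relevant-near u<n Du far0 r0)))
    go (no ne) (no r) = conj-monoʳ (a u v)
      (subst₂ (λ k l → far k l ≤ far (f u) (f v)) (sym (normal-relevant (relevant-cover u<n Du)))
        (sym (normal-relevant r)) (far-rank (f u) (f v)))

  normal-Λ : Λ n a normal ≤ Λ n a f
  normal-Λ = ∑-mono n λ u<n → ∑-mono n λ v<n → term u<n v<n
    where
    flip : ∀ u v (g : ℕ → ℕ) → conj (a v u) (far (g v) (g u)) ≡ conj (a u v) (far (g u) (g v))
    flip u v g = cong₂ conj (a-sym v u) (far-comm (g v) (g u))
    term : ∀ {u v} → u < n → v < n →
      conj (a u v) (far (normal u) (normal v)) ≤ conj (a u v) (far (f u) (f v))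
    term {u} {v} u<n v<n with a u v ≟ 0
    ... | yes e = ≤-trans (≤-reflexive (conj-zeroˡ (far (normal u) (normal v)) e)) z≤n
    ... | no ne with covers u<n v<n ne
    ...   | inj₁ Du = normal-long u<n v<n Du
    ...   | inj₂ Dv = subst₂ _≤_ (flip u v normal) (flip u v f) (normal-long v<n u<n Dv)

conj-unit : ∀ {x y} → x ≢ 0 → y ≤ 1 → conj x y ≡ y
conj-unit {x} {zero} _ _ = conj-zeroʳ x refl
conj-unit {x} {suc zero} x≢0 _ = conj-one {x} {1} x≢0 λ ()
conj-unit {x} {suc (suc _)} _ (s≤s ())

-- Arrangements of width at most c as injective choices of unit slots

module Slots (n c M : ℕ) (slot : ℕ → ℕ)
  (slot-block : ∀ {i s} → i < M → s < c → slot (i * c + s) ≡ i) where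

  S : ℕ
  S = M * c

  in-block : ∀ {i s} → i < M → s < c → i * c + s < S
  in-block {i} {s} i<M s<c = ≤-trans (+-monoʳ-< (i * c) s<c)
    (≤-trans (≤-reflexive (+-comm (i * c) c)) (*-monoˡ-≤ c i<M))

  slot<M : ∀ {j} → j < S → slot j < M
  slot<M {j} j<S = subst (λ k → slot k < M) (sym decomposition)
      (subst (_< M) (sym (slot-block q<M (m%n<n j c))) q<M)
    where
    instance
      c≢0 : NonZero c
      c≢0 = ≢-nonZero λ c≡0 → <⇒≱ j<S (≤-trans (≤-reflexive (trans (cong (M *_) c≡0) (*-zeroʳ M))) z≤n)
    q<M : j / c < M
    q<M = m<n*o⇒m/o<n j<S
    decomposition : j ≡ j / c * c + j % c
    decomposition = trans (m≡m%n+[m/n]*n j c) (+-comm (j % c) (j / c * c))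

  -- By injectivity the sum over vertices is at most the sum over all slots, and each bucket owns a
  -- block of only c slots.
  slots-fit : ∀ {f} → (∀ {v} → v < n → f v < S) → InjectiveBelow n f → Fits n c (λ v → slot (f v))
  slots-fit {f} f< inj i = begin
    ∑ n (λ v → δ (slot (f v)) i)                    ≤⟨ ∑-injective n S f (λ j → δ (slot j) i) f< inj ⟩
    ∑ S (λ j → δ (slot j) i)                        ≡⟨ ∑-blocks M c _ ⟩
    ∑ M (λ k → ∑ c λ s → δ (slot (k * c + s)) i)    ≡⟨ ∑-cong M
        (λ k<M → ∑-cong c λ s<c → cong (λ k → δ k i) (slot-block k<M s<c)) ⟩
    ∑ M (λ k → ∑ c λ s → δ k i)                     ≡⟨ ∑-cong M (λ {k} _ → ∑-const c (δ k i)) ⟩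
    ∑ M (λ k → c * δ k i)                           ≡⟨ ∑-* M c (λ k → δ k i) ⟩
    c * ∑ M (λ k → δ k i)                           ≤⟨ *-monoʳ-≤ c (count-injective M i λ _ _ e → e) ⟩
    c * 1                                           ≡⟨ *-identityʳ c ⟩
    c                                               ∎
    where open ≤-Reasoning

  -- The converse direction, which turns any competing arrangement into a competitor of the auction:
  -- the vertices of a bucket take its slots in increasing order, so `offset v` counts the smaller
  -- vertices in the bucket of `v`.
  module Place (g : ℕ → ℕ) (g<M : ∀ {v} → v < n → g v < M) (fits : Fits n c g) where

    offset place : ℕ → ℕ
    offset v = ∑ v λ u → δ (g u) (g v)
    place v = g v * c + offset v

    offset-< : ∀ {u v} → u < v → g u ≡ g v → offset u < offset v
    offset-< {u} {v} u<v e = begin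
      suc (offset u)                       ≡⟨ +-comm 1 (offset u) ⟩
      offset u + 1                         ≡⟨ cong₂ _+_ (∑-cong u λ {w} _ → cong (δ (g w)) e) (sym (δ-yes e)) ⟩
      ∑ (suc u) (λ w → δ (g w) (g v))      ≤⟨ ∑-monoˡ (λ w → δ (g w) (g v)) u<v ⟩
      offset v                             ∎
      where open ≤-Reasoning

    offset<c : ∀ {v} → v < n → offset v < c
    offset<c {v} v<n = begin
      suc (offset v)                       ≡⟨ +-comm 1 (offset v) ⟩
      offset v + 1                         ≡⟨ cong (offset v +_) (sym (δ-yes {g v} refl)) ⟩
      ∑ (suc v) (λ w → δ (g w) (g v))      ≤⟨ ∑-monoˡ (λ w → δ (g w) (g v)) v<n ⟩
      ∑ n (λ w → δ (g w) (g v))            ≤⟨ fits (g v) ⟩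
      c                                    ∎
      where open ≤-Reasoning

    place<S : ∀ {v} → v < n → place v < S
    place<S v<n = in-block (g<M v<n) (offset<c v<n)

    slot-place : ∀ {v} → v < n → slot (place v) ≡ g v
    slot-place v<n = slot-block (g<M v<n) (offset<c v<n)

    place-injective : InjectiveBelow n place
    place-injective {u} {v} u<n v<n e = cases
      where
      same-bucket : g u ≡ g v
      same-bucket = trans (sym (slot-place u<n)) (trans (cong slot e) (slot-place v<n))
      same-offset : offset u ≡ offset v
      same-offset = +-cancelˡ-≡ (g u * c) _ _ (trans e (cong (λ k → k * c + offset v) (sym same-bucket)))
      cases : u ≡ v
      cases with <-cmp u v
      ... | tri< u<v _ _ = contradiction same-offset (<⇒≢ (offset-< u<v same-bucket))
      ... | tri≈ _ u≡v _ = u≡v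
      ... | tri> _ _ v<u = contradiction (sym same-offset) (<⇒≢ (offset-< v<u (sym same-bucket)))

-- Edge costs as weights of an assignment

module Cost (n : ℕ) (a : ℕ → ℕ → ℕ) (a-sym : ∀ u v → a u v ≡ a v u) (D : ℕ → ℕ)
  (covers : ∀ {u v} → u < n → v < n → a u v ≢ 0 → D u ≢ 0 ⊎ D v ≢ 0) (p : ℕ → ℕ) where

  -- The far end `u` is taken at its guessed bucket `p u`, whatever its actual one; this makes the
  -- charge of `v` independent of where the other vertices go.
  crossing : ℕ → ℕ → ℕ → ℕ
  crossing v i u = conj (D u) (conj (a v u) (far (p u) i))

  crossings displaced : ℕ → ℕ → ℕ
  crossings v i = ∑ n (crossing v i)
  displaced v i = conj (D v) (differ (p v) i)

  -- The factor suc n outweighs the additive error n of the auction, and the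
  -- penalty outweighs all edges together, so that cover vertices stay at p.
  penalty W : ℕ
  penalty = suc (n * n) * suc n
  W = suc n * n + penalty

  weight : ℕ → ℕ → ℕ
  weight v i = suc n * crossings v i + penalty * displaced v i

  crossings≤n : ∀ v i → crossings v i ≤ n
  crossings≤n v i = ≤-trans (∑-≤const n λ {u} _ → conj≤1 (D u) (conj (a v u) (far (p u) i)))
      (≤-reflexive (*-identityʳ n))

  weight≤W : ∀ v i → weight v i ≤ W
  weight≤W v i = +-mono-≤ (*-monoʳ-≤ (suc n) (crossings≤n v i))
    (≤-trans (*-monoʳ-≤ penalty (conj≤1 (D v) (differ (p v) i))) (≤-reflexive (*-identityʳ penalty)))

  ∑-weight : ∀ (f : ℕ → ℕ) → ∑ n (λ v → weight v (f v)) ≡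
    suc n * ∑ n (λ v → crossings v (f v)) + penalty * ∑ n (λ v → displaced v (f v))
  ∑-weight f = trans (∑-+ n _ _) (cong₂ _+_ (∑-* n (suc n) _) (∑-* n penalty _))

  Agrees : (ℕ → ℕ) → Set
  Agrees f = ∀ {v} → v < n → D v ≢ 0 → f v ≡ p v

  private
    long inner : (ℕ → ℕ) → ℕ → ℕ → ℕ
    long f v u = conj (a v u) (far (f v) (f u))
    inner f v u = conj (D v) (conj (D u) (long f v u))

    long-comm : ∀ f u v → long f u v ≡ long f v u
    long-comm f u v = cong₂ conj (a-sym u v) (far-comm (f u) (f v))

    long≤1 : ∀ f v u → long f v u ≤ 1
    long≤1 f v u = conj≤1 (a v u) (far (f v) (f u))

    crossing-agrees : ∀ {f} → Agrees f → ∀ v {u} → u < n → crossing v (f v) u ≡ conj (D u) (long f v u)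
    crossing-agrees {f} ag v {u} u<n with D u ≟ 0
    ... | yes e = trans (conj-zeroˡ (conj (a v u) (far (p u) (f v))) e) (sym (conj-zeroˡ (long f v u) e))
    ... | no ne = cong (λ k → conj (D u) (conj (a v u) k))
                    (trans (cong (λ k → far k (f v)) (sym (ag u<n ne))) (far-comm (f u) (f v)))

    -- An edge inside the cover has both ends at their guessed buckets, so its contribution is a
    -- constant of the guess and cancels in comparisons.
    inner-agrees : ∀ {f g} → Agrees f → Agrees g → ∀ {v u} → v < n → u < n → inner f v u ≡ inner g v u
    inner-agrees {f} {g} af ag {v} {u} v<n u<n with D v ≟ 0 | D u ≟ 0
    ... | yes e | _ = trans (conj-zeroˡ (conj (D u) (long f v u)) e) (sym (conj-zeroˡ (conj (D u) (long g v u)) e))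
    ... | no _ | yes e = cong (conj (D v)) (trans (conj-zeroˡ (long f v u) e) (sym (conj-zeroˡ (long g v u) e)))
    ... | no nv | no nu = cong (λ k → conj (D v) (conj (D u) (conj (a v u) k)))
          (cong₂ far (trans (af v<n nv) (sym (ag v<n nv))) (trans (af u<n nu) (sym (ag u<n nu))))

    -- Inclusion–exclusion on the ends that lie in the cover.
    long-split : ∀ f {v u} → v < n → u < n →
      long f v u + inner f v u ≡ conj (D u) (long f v u) + conj (D v) (long f v u)
    long-split f {v} {u} v<n u<n with D v ≟ 0 | D u ≟ 0
    ... | yes ev | yes eu = trans (cong₂ _+_ no-edge (conj-zeroˡ (conj (D u) (long f v u)) ev))
                                  (sym (cong₂ _+_ (conj-zeroˡ (long f v u) eu) (conj-zeroˡ (long f v u) ev)))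
      where
      no-edge : long f v u ≡ 0
      no-edge with a v u ≟ 0
      ... | yes e = conj-zeroˡ (far (f v) (f u)) e
      ... | no ne with covers v<n u<n ne
      ...   | inj₁ x = contradiction ev x
      ...   | inj₂ x = contradiction eu x
    ... | yes ev | no nu = cong₂ _+_ (sym (conj-unit nu (long≤1 f v u)))
            (trans (conj-zeroˡ (conj (D u) (long f v u)) ev) (sym (conj-zeroˡ (long f v u) ev)))
    ... | no nv | yes eu = trans (+-comm (long f v u) (inner f v u)) (cong₂ _+_
            (trans (conj-zeroʳ (D v) (conj-zeroˡ (long f v u) eu)) (sym (conj-zeroˡ (long f v u) eu)))
            (sym (conj-unit nv (long≤1 f v u))))
    ... | no nv | no nu = cong₂ _+_ (sym (conj-unit nu (long≤1 f v u)))
            (cong (conj (D v)) (conj-unit nu (long≤1 f v u)))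

    total : (ℕ → ℕ) → ℕ
    total f = ∑ n λ v → crossings v (f v)

    total-agrees : ∀ {f} → Agrees f → total f ≡ ∑ n λ v → ∑ n λ u → conj (D u) (long f v u)
    total-agrees ag = ∑-cong n λ {v} _ → ∑-cong n λ u<n → crossing-agrees ag v u<n

    -- A long edge counts 2 in `Λ`. In `total` it counts 1 if one end is in the cover and 2 if both
    -- are; `inner` makes up the difference after doubling.
    Λ-split : ∀ {f} → Agrees f → Λ n a f + ∑ n (λ v → ∑ n (inner f v)) ≡ total f + total f
    Λ-split {f} ag = begin
      Λ n a f + ∑ n (λ v → ∑ n (inner f v))
        ≡⟨ sym (∑-+ n _ _) ⟩
      ∑ n (λ v → ∑ n (long f v) + ∑ n (inner f v))
        ≡⟨ ∑-cong n (λ {v} v<n → trans (sym (∑-+ n _ _))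
            (trans (∑-cong n λ u<n → long-split f v<n u<n) (∑-+ n _ _))) ⟩
      ∑ n (λ v → ∑ n (λ u → conj (D u) (long f v u)) + ∑ n (λ u → conj (D v) (long f v u)))
        ≡⟨ ∑-+ n _ _ ⟩
      ∑ n (λ v → ∑ n λ u → conj (D u) (long f v u)) + ∑ n (λ v → ∑ n λ u → conj (D v) (long f v u))
        ≡⟨ cong₂ _+_ (sym (total-agrees ag)) (trans (∑-swap n n _) (trans swapped (sym (total-agrees ag)))) ⟩
      total f + total f ∎
      where
      open ≡-Reasoning
      swapped : ∑ n (λ u → ∑ n λ v → conj (D v) (long f v u)) ≡ ∑ n (λ u → ∑ n λ v → conj (D v) (long f u v))
      swapped = ∑-cong n λ {u} _ → ∑-cong n λ {v} _ → cong (conj (D v)) (long-comm f v u)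

    Λ-from-total : ∀ {f g} → Agrees f → Agrees g → total f ≤ total g → Λ n a f ≤ Λ n a g
    Λ-from-total {f} {g} af ag le = +-cancelʳ-≤ (∑ n (λ v → ∑ n (inner g v))) _ _ (begin
      Λ n a f + ∑ n (λ v → ∑ n (inner g v)) ≡⟨ cong (Λ n a f +_)
          (∑-cong n λ v<n → ∑-cong n λ u<n → inner-agrees ag af v<n u<n) ⟩
      Λ n a f + ∑ n (λ v → ∑ n (inner f v)) ≡⟨ Λ-split af ⟩
      total f + total f                     ≤⟨ +-mono-≤ le le ⟩
      total g + total g                     ≡⟨ sym (Λ-split ag) ⟩
      Λ n a g + ∑ n (λ v → ∑ n (inner g v)) ∎)
      where open ≤-Reasoning

  -- Agreement of `f` with the guess is a consequence, not an assumption: `g` pays no penalty, and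
  -- the bound leaves `f` room for less than a single one. What remains are multiples of `suc n`,
  -- and an excess of at most n cannot separate two of them.
  Λ-optimal : ∀ {f g} → Agrees g →
    ∑ n (λ v → weight v (f v)) ≤ ∑ n (λ v → weight v (g v)) + n → Λ n a f ≤ Λ n a g
  Λ-optimal {f} {g} ag le = Λ-from-total agrees-f ag total-≤
    where
    open ≤-Reasoning
    shifts : (ℕ → ℕ) → ℕ
    shifts h = ∑ n λ v → displaced v (h v)
    shifts-g : shifts g ≡ 0
    shifts-g = ∑-zero n stays
      where
      stays : ∀ {v} → v < n → displaced v (g v) ≡ 0
      stays {v} v<n with D v ≟ 0
      ... | yes e = conj-zeroˡ (differ (p v) (g v)) e
      ... | no ne = conj-zeroʳ (D v) (differ-self {p v} {g v} (sym (ag v<n ne)))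
    bound : suc n * total f + penalty * shifts f < suc n * suc (total g)
    bound = begin-strict
      suc n * total f + penalty * shifts f   ≡⟨ sym (∑-weight f) ⟩
      ∑ n (λ v → weight v (f v))             ≤⟨ le ⟩
      ∑ n (λ v → weight v (g v)) + n         ≡⟨ cong (_+ n)
          (trans (∑-weight g) (cong (λ k → suc n * total g + penalty * k) shifts-g)) ⟩
      suc n * total g + penalty * 0 + n      ≡⟨ cong (_+ n)
          (trans (cong (suc n * total g +_) (*-zeroʳ penalty)) (+-identityʳ _)) ⟩
      suc n * total g + n                    <⟨ +-monoʳ-< (suc n * total g) ≤-refl ⟩
      suc n * total g + suc n                ≡⟨ trans (+-comm _ (suc n)) (sym (*-suc (suc n) (total g))) ⟩
      suc n * suc (total g)                  ∎
    total-≤ : total f ≤ total g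
    total-≤ = s≤s⁻¹ (*-cancelˡ-< (suc n) _ _ (≤-<-trans (m≤m+n (suc n * total f) (penalty * shifts f)) bound))
    shifts-f : shifts f ≡ 0
    shifts-f with shifts f ≟ 0
    ... | yes e = e
    ... | no ne = contradiction bound (≤⇒≯ (begin
      suc n * suc (total g)                  ≤⟨ *-monoʳ-≤ (suc n) (s≤s (∑-≤const n λ {v} _ → crossings≤n v (g v))) ⟩
      suc n * suc (n * n)                    ≡⟨ *-comm (suc n) (suc (n * n)) ⟩
      penalty                                ≡⟨ sym (*-identityʳ penalty) ⟩
      penalty * 1                            ≤⟨ *-monoʳ-≤ penalty (n≢0⇒n>0 ne) ⟩
      penalty * shifts f                     ≤⟨ m≤n+m (penalty * shifts f) (suc n * total f) ⟩
      suc n * total f + penalty * shifts f   ∎))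
    agrees-f : Agrees f
    agrees-f {v} v<n Dv with differ (p v) (f v) ≟ 0
    ... | yes e = sym (differ≡0⇒≡ {p v} {f v} e)
    ... | no ne = contradiction
      (≤-trans (≤-reflexive (sym (conj-one {D v} {differ (p v) (f v)} Dv ne)))
          (≤-trans (term≤∑ (λ v → displaced v (f v)) v<n) (≤-reflexive shifts-f))) λ ()

-- Guesses, matchings and the number of guesses

-- Mixed-radix numerals: digit v runs below L if D v ≡ 1, and is 0 if D v ≡ 0.
module Numeral (n L : ℕ) (D : ℕ → ℕ) where

  base radix : ℕ → ℕ
  base v = L ^ D v
  radix k = L ^ ∑ k D

  value : (ℕ → ℕ) → ℕ → ℕ
  value p k = ∑ k λ v → p v * radix v

  Valid : (ℕ → ℕ) → Set
  Valid p = ∀ {v} → v < n → p v < base v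

  radix-suc : ∀ k → radix (suc k) ≡ base k * radix k
  radix-suc k = trans (^-distribˡ-+-* L (∑ k D) (D k)) (*-comm (radix k) (base k))

  value-suc< : ∀ {p k} → p k < base k → value p k < radix k → value p (suc k) < radix (suc k)
  value-suc< {p} {k} pk< rest< = begin-strict
    value p k + p k * radix k   <⟨ +-monoˡ-< (p k * radix k) rest< ⟩
    suc (p k) * radix k         ≤⟨ *-monoˡ-≤ (radix k) pk< ⟩
    base k * radix k            ≡⟨ sym (radix-suc k) ⟩
    radix (suc k)               ∎
    where open ≤-Reasoning

  value< : ∀ {p} → Valid p → ∀ {k} → k ≤ n → value p k < radix k
  value< vp {zero} _ = s≤s z≤n
  value< {p} vp {suc k} k<n = value-suc< {p} {k} (vp k<n) (value< vp (<⇒≤ k<n))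

  private
    leading-< : ∀ {B r s a b} → r < B → a < b → r + a * B < s + b * B
    leading-< {B} {r} {s} {a} {b} r<B a<b = begin-strict
      r + a * B   <⟨ +-monoˡ-< (a * B) r<B ⟩
      suc a * B   ≤⟨ *-monoˡ-≤ B a<b ⟩
      b * B       ≤⟨ m≤n+m (b * B) s ⟩
      s + b * B   ∎
      where open ≤-Reasoning

    leading : ∀ {B r s a b} → r < B → s < B → r + a * B ≡ s + b * B → a ≡ b
    leading {B} {r} {s} {a} {b} r<B s<B e with <-cmp a b
    ... | tri< a<b _ _ = contradiction e (<⇒≢ (leading-< {B} {r} {s} r<B a<b))
    ... | tri≈ _ a≡b _ = a≡b
    ... | tri> _ _ b<a = contradiction (sym e) (<⇒≢ (leading-< {B} {s} {r} s<B b<a))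

  value-injective : ∀ {p q} → Valid p → Valid q → ∀ k → k ≤ n → value p k ≡ value q k → ∀ {v} → v < k → p v ≡ q v
  value-injective {p} {q} vp vq (suc k) k<n e {v} v<1+k = cases (m≤n⇒m<n∨m≡n (s≤s⁻¹ v<1+k))
    where
    top : p k ≡ q k
    top = leading {radix k} {value p k} {value q k} (value< vp (<⇒≤ k<n)) (value< vq (<⇒≤ k<n)) e
    cases : v < k ⊎ v ≡ k → p v ≡ q v
    cases (inj₂ refl) = top
    cases (inj₁ v<k) = value-injective vp vq k (<⇒≤ k<n)
      (+-cancelʳ-≡ (p k * radix k) _ _ (trans e (cong (λ t → value q k + t * radix k) (sym top)))) v<k

  -- Digits below k have been processed in passing from p₀ to its successor;
  -- the carry is what remains to be added to digit k.
  record Stage (p₀ : ℕ → ℕ) (k : ℕ) (p : ℕ → ℕ) (carry : ℕ) : Set where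
    field
      valid   : Valid p
      pending : ∀ {u} → k ≤ u → p u ≡ p₀ u
      -- As long as the carry is pending, all digits below `k` were maximal and have become 0. For
      -- `k ≡ n` this says that `p₀` was the last numeral.
      count   : (carry ≡ 1 × value p k ≡ 0 × suc (value p₀ k) ≡ radix k) ⊎
                (carry ≡ 0 × value p k ≡ suc (value p₀ k))

  open Stage public

  start : ∀ {p₀} → Valid p₀ → Stage p₀ 0 p₀ 1
  start v = record { valid = v ; pending = λ _ → refl ; count = inj₁ (refl , refl , refl) }

  idle : ∀ {p₀ k p} → Stage p₀ k p 0 → Stage p₀ (suc k) p 0
  idle {p₀} {k} {p} s = record
    { valid = valid s ; pending = λ k<u → pending s (<⇒≤ k<u) ; count = inj₂ (refl , done (count s)) }
    where
    done : _ ⊎ _ → value p (suc k) ≡ suc (value p₀ (suc k))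
    done (inj₁ (() , _))
    done (inj₂ (_ , e)) = cong₂ (λ x y → x + y * radix k) e (pending s ≤-refl)

  private
    update-valid : ∀ {p k x} → Valid p → x < base k → Valid (update p k x)
    update-valid {p} {k} {x} vp x< {v} v<n with v ≟ k
    ... | yes refl = subst (_< base k) (sym (update-same p k x)) x<
    ... | no v≢k = subst (_< base v) (sym (update-other p x v≢k)) (vp v<n)

    update-pending : ∀ {p₀ k p c} x → Stage p₀ k p c → ∀ {u} → suc k ≤ u → update p k x u ≡ p₀ u
    update-pending {k = k} {p} x s k<u = trans (update-other p x (>⇒≢ k<u)) (pending s (<⇒≤ k<u))

    value-update : ∀ p k x → value (update p k x) k ≡ value p k
    value-update p k x = ∑-cong k λ {v} v<k → cong (_* radix v) (update-other p x (<⇒≢ v<k))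

  bump : ∀ {p₀ k p} → Stage p₀ k p 1 → suc (p k) < base k → Stage p₀ (suc k) (update p k (suc (p k))) 0
  bump {p₀} {k} {p} s room = record
    { valid = update-valid (valid s) room ; pending = update-pending _ s ; count = inj₂ (refl , done (count s)) }
    where
    open ≡-Reasoning
    done : _ ⊎ _ → value (update p k (suc (p k))) (suc k) ≡ suc (value p₀ (suc k))
    done (inj₁ (_ , e₀ , e)) = begin
      value (update p k (suc (p k))) (suc k)  ≡⟨ cong₂ (λ y z → y + z * radix k)
                                                   (trans (value-update p k _) e₀) (update-same p k _) ⟩
      radix k + p k * radix k               ≡⟨ cong₂ (λ y z → y + z * radix k) (sym e) (pending s ≤-refl) ⟩
      suc (value p₀ k + p₀ k * radix k)      ∎
    done (inj₂ (() , _))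

  wrap : ∀ {p₀ k p} → Stage p₀ k p 1 → base k ≡ suc (p k) → Stage p₀ (suc k) (update p k 0) 1
  wrap {p₀} {k} {p} s full = record
    { valid = update-valid (valid s) (subst (0 <_) (sym full) (s≤s z≤n))
    ; pending = update-pending 0 s
    ; count = done (count s) }
    where
    open ≡-Reasoning
    done : _ ⊎ _ → _
    done (inj₁ (_ , e₀ , e)) = inj₁ (refl
      , cong₂ (λ y z → y + z * radix k) (trans (value-update p k 0) e₀) (update-same p k 0)
      , (begin
        suc (value p₀ k) + p₀ k * radix k  ≡⟨ cong₂ (λ y z → y + z * radix k) e (sym (pending s ≤-refl)) ⟩
        suc (p k) * radix k                ≡⟨ cong (_* radix k) (sym full) ⟩
        base k * radix k                   ≡⟨ sym (radix-suc k) ⟩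
        radix (suc k)                      ∎))
    done (inj₂ (() , _))

  -- Connects the test made by the machine with the radix. A digit outside the cover has base 1: it
  -- is always full and passes the carry on unchanged.
  advance : ∀ {p₀ k p} → (∀ v → D v ≤ 1) → k < n → Stage p₀ k p 1 →
    (conj (D k) (L ∸ (p k + 1)) ≢ 0 → suc (p k) < base k) ×
    (conj (D k) (L ∸ (p k + 1)) ≡ 0 → base k ≡ suc (p k))
  advance {p₀} {k} {p} D≤1 k<n s = room (D k) (D≤1 k) , full (D k) (D≤1 k) (valid s k<n)
    where
    room : ∀ x → x ≤ 1 → conj x (L ∸ (p k + 1)) ≢ 0 → suc (p k) < L ^ x
    room zero _ h = contradiction (conj-zeroˡ (L ∸ (p k + 1)) refl) h
    room (suc zero) _ h = ≤-trans (≤-reflexive (cong suc (+-comm 1 (p k))))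
        (≤-trans (m∸n≢0⇒n<m (conj≢0ʳ {1} h)) (≤-reflexive (sym (*-identityʳ L))))
    room (suc (suc _)) (s≤s ())
    full : ∀ x → x ≤ 1 → p k < L ^ x → conj x (L ∸ (p k + 1)) ≡ 0 → L ^ x ≡ suc (p k)
    full zero _ pk< _ = cong suc (sym (n<1⇒n≡0 pk<))
    full (suc zero) _ pk< e with L ∸ (p k + 1) ≟ 0
    ... | no ne = contradiction (trans (sym (conj-one {1} {L ∸ (p k + 1)} (λ ()) ne)) e) λ ()
    ... | yes z = ≤-antisym (≤-trans (≤-reflexive (*-identityʳ L))
        (≤-trans (m∸n≡0⇒m≤n z) (≤-reflexive (+-comm (p k) 1)))) pk<
    full (suc (suc _)) (s≤s ()) 

module Matching (n : ℕ) (χ : ℕ → ℕ) where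

  -- What is remembered of the matching, which itself is never stored: each matched edge puts two
  -- new vertices into `D`, and at least one of them lies in the cover `χ`.
  record HalfCovered (D : ℕ → ℕ) : Set where
    field
      bits : ∀ v → D v ≤ 1
      half : ∑ n D ≤ 2 * ∑ n (λ v → D v * χ v)

  open HalfCovered public

  private
    set : (ℕ → ℕ) → ℕ → ℕ → ℕ
    set D u = update D u 1

    set-bits : ∀ {D u} → (∀ v → D v ≤ 1) → ∀ v → set D u v ≤ 1
    set-bits {D} {u} bd v with v ≟ u
    ... | yes refl = ≤-reflexive (update-same D v 1)
    ... | no v≢u = subst (_≤ 1) (sym (update-other D 1 v≢u)) (bd v)

    set-sum : ∀ {D u} → u < n → D u ≡ 0 → ∑ n (set D u) ≡ ∑ n D + 1
    set-sum {D} {u} u<n e = ∑-bump D (set D u) 1 u<n (update-other D 1)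
      (trans (update-same D u 1) (cong (_+ 1) (sym e)))

    set-sum-χ : ∀ {D u} → u < n → D u ≡ 0 → ∑ n (λ v → set D u v * χ v) ≡ ∑ n (λ v → D v * χ v) + χ u
    set-sum-χ {D} {u} u<n e = ∑-bump _ _ (χ u) u<n (λ {j} j≢u → cong (_* χ j) (update-other D 1 j≢u))
      (trans (cong (_* χ u) (update-same D u 1)) (trans (+-identityʳ (χ u)) (cong (λ k → k * χ u + χ u) (sym e))))

  match : ∀ {D u v} → u < n → v < n → u ≢ v → D u ≡ 0 → D v ≡ 0 → 1 ≤ χ u + χ v → HalfCovered D →
    HalfCovered (update (update D u 1) v 1)
  match {D} {u} {v} u<n v<n u≢v Du Dv covered h = record
    { bits = set-bits (set-bits (bits h))
    ; half = begin
        ∑ n (set (set D u) v)                          ≡⟨ trans (set-sum v<n Dv′) (cong (_+ 1) (set-sum u<n Du)) ⟩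
        ∑ n D + 1 + 1                                  ≡⟨ +-assoc (∑ n D) 1 1 ⟩
        ∑ n D + 2 * 1                                  ≤⟨ +-mono-≤ (half h) (*-monoʳ-≤ 2 covered) ⟩
        2 * X + 2 * (χ u + χ v)                        ≡⟨ lemma X (χ u) (χ v) ⟩
        2 * (X + χ u + χ v)                            ≡⟨ cong (2 *_)
            (sym (trans (set-sum-χ v<n Dv′) (cong (_+ χ v) (set-sum-χ u<n Du)))) ⟩
        2 * ∑ n (λ w → set (set D u) v w * χ w)        ∎ }
    where
    open ≤-Reasoning
    X = ∑ n (λ w → D w * χ w)
    Dv′ : set D u v ≡ 0
    Dv′ = trans (update-other D 1 (≢-sym u≢v)) Dv
    lemma : ∀ a b c → 2 * a + 2 * (b + c) ≡ 2 * (a + b + c)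
    lemma = solve-∀

  half≤ : ∀ {D} → HalfCovered D → ∑ n D ≤ 2 * ∑ n χ
  half≤ {D} h = ≤-trans (half h) (*-monoʳ-≤ 2 (∑-mono n λ {v} _ →
    ≤-trans (*-monoˡ-≤ (χ v) (bits h v)) (≤-reflexive (*-identityˡ (χ v)))))

n≤2^⌈log₂n⌉ : ∀ n → n ≤ 2 ^ ⌈log₂ n ⌉
n≤2^⌈log₂n⌉ = <-rec _ go
  where
  go : ∀ n → (∀ {m} → m < n → m ≤ 2 ^ ⌈log₂ m ⌉) → n ≤ 2 ^ ⌈log₂ n ⌉
  go zero _ = z≤n
  go (suc zero) _ = s≤s z≤n
  go n@(suc (suc m)) rec = begin
    n                                   ≡⟨ sym (⌊n/2⌋+⌈n/2⌉≡n n) ⟩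
    ⌊ n /2⌋ + ⌈ n /2⌉                   ≤⟨ +-monoˡ-≤ ⌈ n /2⌉ (⌊n/2⌋≤⌈n/2⌉ n) ⟩
    ⌈ n /2⌉ + ⌈ n /2⌉                   ≡⟨ cong (⌈ n /2⌉ +_) (sym (+-identityʳ _)) ⟩
    2 * ⌈ n /2⌉                         ≤⟨ *-monoʳ-≤ 2 (rec (⌈n/2⌉<n m)) ⟩
    2 ^ suc ⌈log₂ ⌈ n /2⌉ ⌉             ≡⟨ cong (λ l → 2 ^ suc l) (⌈log₂⌈n/2⌉⌉≡⌈log₂n⌉∸1 n) ⟩
    2 ^ suc (⌈log₂ n ⌉ ∸ 1)             ≡⟨ cong (2 ^_)
        (suc-pred ⌈log₂ n ⌉ {{≢-nonZero (>⇒≢ (⌈log₂⌉-mono-≤ {2} {n} (s≤s (s≤s z≤n))))}}) ⟩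
    2 ^ ⌈log₂ n ⌉                       ∎
    where open ≤-Reasoning

-- For k at least 2 the logarithm l is at least 1, so 3d ≤ 6k ≤ 2 ^ (3 + l) ≤ 2 ^ (4 * l); raising
-- this to the power d ≤ 2k gives the exponent 8kl. For k at most 1 the logarithm is 0 and offers no
-- room: the worst case there is 6 ^ 2 = 36 ≤ 2 ^ 6, which the factor `x ^ 6` absorbs.
candidates-bound : ∀ {d k} x → 2 ≤ x → d ≤ 2 * k →
  (d + d + d) ^ d ≤ 2 ^ (8 * (k * ⌈log₂ k ⌉)) * x ^ 6
candidates-bound {zero} {zero} x 2≤x z≤n =
  ≤-trans (m^n>0 x {{>-nonZero (<⇒≤ 2≤x)}} 6) (≤-reflexive (sym (*-identityˡ (x ^ 6))))
candidates-bound {d} {suc zero} x 2≤x d≤2 = begin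
  (d + d + d) ^ d    ≤⟨ small d d≤2 ⟩
  2 ^ 6              ≤⟨ ^-monoˡ-≤ 6 2≤x ⟩
  x ^ 6              ≡⟨ sym (*-identityˡ (x ^ 6)) ⟩
  1 * x ^ 6          ∎
  where
  open ≤-Reasoning
  small : ∀ d → d ≤ 2 → (d + d + d) ^ d ≤ 2 ^ 6
  small 0 _ = s≤s z≤n
  small 1 _ = ≤ᵇ⇒≤ 3 64 _
  small 2 _ = ≤ᵇ⇒≤ 36 64 _
  small (suc (suc (suc _))) (s≤s (s≤s ()))
candidates-bound {d} {k@(suc (suc _))} x 2≤x d≤2k = begin
  (d + d + d) ^ d                  ≤⟨ ^-monoˡ-≤ d base≤ ⟩
  (2 ^ (4 * l)) ^ d                ≡⟨ ^-*-assoc 2 (4 * l) d ⟩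
  2 ^ (4 * l * d)                  ≤⟨ ^-monoʳ-≤ 2 (*-monoʳ-≤ (4 * l) d≤2k) ⟩
  2 ^ (4 * l * (2 * k))            ≡⟨ cong (2 ^_) (lemma l k) ⟩
  2 ^ (8 * (k * l))                ≤⟨ m≤m*n _ (x ^ 6) {{>-nonZero (m^n>0 x {{>-nonZero (<⇒≤ 2≤x)}} 6)}} ⟩
  2 ^ (8 * (k * l)) * x ^ 6        ∎
  where
  open ≤-Reasoning
  l = ⌈log₂ k ⌉
  lemma : ∀ l k → 4 * l * (2 * k) ≡ 8 * (k * l)
  lemma = solve-∀
  triple : ∀ k → 2 * k + 2 * k + 2 * k ≡ 6 * k
  triple = solve-∀
  base≤ : d + d + d ≤ 2 ^ (4 * l)
  base≤ = begin
    d + d + d                  ≤⟨ +-mono-≤ (+-mono-≤ d≤2k d≤2k) d≤2k ⟩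
    2 * k + 2 * k + 2 * k      ≡⟨ triple k ⟩
    6 * k                      ≤⟨ *-mono-≤ (≤ᵇ⇒≤ 6 8 _) (n≤2^⌈log₂n⌉ k) ⟩
    2 ^ 3 * 2 ^ l              ≡⟨ sym (^-distribˡ-+-* 2 3 l) ⟩
    2 ^ (3 + l)                ≤⟨ ^-monoʳ-≤ 2 (+-monoˡ-≤ l (*-monoʳ-≤ 3 (⌈log₂⌉-mono-≤ {2} {k} (s≤s (s≤s z≤n))))) ⟩
    2 ^ (3 * l + l)            ≡⟨ cong (2 ^_) (+-comm (3 * l) l) ⟩
    2 ^ (4 * l)                ∎

-- The program

conjE differE : Expr → Expr → Expr
conjE e f = lit 1 ⊖ ((lit 1 ⊖ e) ⊕ (lit 1 ⊖ f))
differE e f = (e ⊖ f) ⊕ (f ⊖ e)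

farE edgeE : Expr → Expr → Expr
farE e f = differE e f ⊖ lit 1
edgeE u v = arr 0 (arr 8 u ⊕ v)

-- Registers: 0 order n, 1 capacity (at most n), 2 n², 3 number of bucket
-- indices offered to the cover, 4 number of buckets, 5 number of slots,
-- 6 best value so far, 7 carry, 8 and up scratch.
-- Arrays: 0 adjacency matrix, 1 output, 2 cover, 3 guess, 4 prices,
-- 5 owners, 6 bucket of a slot, 7 best arrangement so far, 8 multiples
-- of n, 9 and 10 multiples of n + 1 and of the penalty, 11 bucket of the
-- owner of a slot, 12 nonempty buckets, 13 their ranks.

-- The machine cannot multiply, so products arise by repeated addition. Arrays 9 and 10 are later
-- read only at indices 0 and 1, where a lookup multiplies a truth value by `n + 1` or by the
-- penalty.
constants : Program
constants =
  (for 10 below 0 loop 8 [ reg 10 ⊕ lit 1 ]≔ arr 8 (reg 10) ⊕ reg 0) ⨾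
  2 ≔ arr 8 (reg 0) ⨾
  9 ≔ reg 2 ⊕ lit 1 ⨾
  (for 10 below 9 loop 8 ≔ reg 8 ⊕ (reg 0 ⊕ lit 1)) ⨾
  9 [ lit 1 ]≔ reg 0 ⊕ lit 1 ⨾
  10 [ lit 1 ]≔ reg 8 ⨾
  -- n² + 1 exceeds every possible number of long ordered pairs, so it marks that no arrangement has
  -- been recorded yet.
  6 ≔ reg 9

matchEdge : Program
matchEdge =
  when conjE (edgeE (reg 10) (reg 11)) (lit 1 ⊖ (arr 2 (reg 10) ⊕ arr 2 (reg 11)))
  then (2 [ reg 10 ]≔ lit 1 ⨾ 2 [ reg 11 ]≔ lit 1)
  else skip

matching : Program
matching = for 10 below 0 loop for 11 below 0 loop matchEdge

slotTable : Program
slotTable =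
  (for 10 below 0 loop 3 ≔ reg 3 ⊕ (arr 2 (reg 10) ⊕ arr 2 (reg 10) ⊕ arr 2 (reg 10))) ⨾
  4 ≔ reg 3 ⊕ reg 0 ⨾
  (for 10 below 4 loop for 11 below 1 loop (6 [ reg 5 ]≔ reg 10 ⨾ 5 ≔ reg 5 ⊕ lit 1))

findUnassigned : Program
findUnassigned =
  8 ≔ lit 0 ⨾
  (for 10 below 0 loop
    (11 ≔ lit 0 ⨾
    (for 12 below 5 loop 11 ≔ reg 11 ⊕ (lit 1 ⊖ differE (arr 5 (reg 12)) (reg 10 ⊕ lit 1))) ⨾
    when reg 11 then skip else (8 ≔ reg 10 ⊕ lit 1)))

-- The price of slot reg 12 plus its weight for vertex reg 13.
offer : Program
offer =
  16 ≔ arr 4 (reg 12) ⊕ arr 10 (conjE (arr 2 (reg 13)) (differE (arr 3 (reg 13)) (arr 6 (reg 12)))) ⨾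
  (for 17 below 0 loop
    16 ≔ reg 16 ⊕ arr 9 (conjE (arr 2 (reg 17))
        (conjE (edgeE (reg 13) (reg 17)) (farE (arr 3 (reg 17)) (arr 6 (reg 12))))))

bestOffer : Program
bestOffer =
  14 ≔ lit 0 ⨾
  (for 12 below 5 loop
    (offer ⨾
    -- A disjunction: no slot recorded so far (register 14 is 0, since slots are stored shifted by
    -- 1), or the new offer is strictly smaller.
    when (lit 1 ⊖ reg 14) ⊕ (reg 15 ⊖ reg 16)
    then (14 ≔ reg 12 ⊕ lit 1 ⨾ 15 ≔ reg 16)
    else skip))

bidding : Program
bidding =
  13 ≔ reg 8 ⊖ lit 1 ⨾
  bestOffer ⨾
  14 ≔ reg 14 ⊖ lit 1 ⨾
  5 [ reg 14 ]≔ reg 8 ⨾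
  4 [ reg 14 ]≔ arr 4 (reg 14) ⊕ lit 1

auction : Program
auction =
  (for 10 below 5 loop 4 [ reg 10 ]≔ lit 0) ⨾
  (for 10 below 5 loop 5 [ reg 10 ]≔ lit 0) ⨾
  findUnassigned ⨾
  (while reg 8 loop (bidding ⨾ findUnassigned))

-- The value is recomputed from the arrangement itself, so it is correct even if the auction could
-- not respect the guess.
evaluate : Program
evaluate =
  -- Vertex v owns cell v + 1; all free slots write into cell 0, which is never read.
  (for 10 below 5 loop 11 [ arr 5 (reg 10) ]≔ arr 6 (reg 10)) ⨾
  8 ≔ lit 0 ⨾
  (for 10 below 0 loop for 11 below 0 loop
    8 ≔ reg 8 ⊕ conjE (edgeE (reg 10) (reg 11)) (farE (arr 11 (reg 10 ⊕ lit 1)) (arr 11 (reg 11 ⊕ lit 1)))) ⨾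
  (when reg 6 ⊖ reg 8
   then (6 ≔ reg 8 ⨾ (for 10 below 0 loop 7 [ reg 10 ]≔ arr 11 (reg 10 ⊕ lit 1)))
   else skip)

-- A carry that survives all digits remains in register 7 and thereby ends the search.
increment : Program
increment =
  7 ≔ lit 1 ⨾
  (for 10 below 0 loop
    when reg 7
    then (when conjE (arr 2 (reg 10)) (reg 3 ⊖ (arr 3 (reg 10) ⊕ lit 1))
          then (3 [ reg 10 ]≔ arr 3 (reg 10) ⊕ lit 1 ⨾ 7 ≔ lit 0)
          else (3 [ reg 10 ]≔ lit 0))
    else skip)

search : Program
search = while lit 1 ⊖ reg 7 loop (auction ⨾ evaluate ⨾ increment)

output : Program
output =
  (for 10 below 0 loop 12 [ arr 7 (reg 10) ]≔ lit 1) ⨾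
  (for 10 below 4 loop 13 [ reg 10 ⊕ lit 1 ]≔ arr 13 (reg 10) ⊕ arr 12 (reg 10)) ⨾
  (for 10 below 0 loop 1 [ reg 10 ]≔ arr 13 (arr 7 (reg 10))) ⨾
  -- Register 0 still bounds the loops above, so n is overwritten last.
  0 ≔ arr 13 (reg 4)

bucketIntegrity : Program
bucketIntegrity =
  -- The minimum of c and n. No bucket can hold more than n vertices, so nothing is lost, and the
  -- number of slots becomes polynomial in n.
  1 ≔ reg 1 ⊖ (reg 1 ⊖ reg 0) ⨾
  (when reg 1
   then (constants ⨾ matching ⨾ slotTable ⨾ search ⨾ output)
   else skip)

arrays-same : ∀ σ a i y → arrays (setCell σ a i y) a i ≡ y
arrays-same σ a i y rewrite update-same (arrays σ) a (update (arrays σ a) i y) = update-same (arrays σ a) i y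

arrays-other : ∀ σ a {i j} y → j ≢ i → arrays (setCell σ a i y) a j ≡ arrays σ a j
arrays-other σ a {i} y j≢i rewrite update-same (arrays σ) a (update (arrays σ a) i y) = update-other
    (arrays σ a) y j≢i

≢-from-T : ∀ {q r} → T (not (q ≡ᵇ r)) → q ≢ r
≢-from-T {zero}  {suc r} _ ()
≢-from-T {suc q} {zero}  _ ()
≢-from-T {suc q} {suc r} h e = ≢-from-T {q} {r} h (suc-injective e)

-- Loops that accumulate a sum, fill an array or tabulate prefix sums

module Loops (x : ℕ) (2≤x : 2 ≤ x) where

  open Poly x 2≤x

  setR : ∀ {r f σ e} y → {h : T (1 + cost f ≤ᵇ 2 ^ e)} → eval f σ ≡ y →
    Halts (r ≔ f) σ e (λ τ → regs τ r ≡ y)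
  setR {r} {f} {σ} y {h} e = assignR {h = h} (trans (update-same (regs σ) r (eval f σ)) e)

  sumR : ∀ {r q acc f σ k} a N (g : ℕ → ℕ) →
    {h₁ : T (not (r ≡ᵇ acc))} → {h₂ : T (not (q ≡ᵇ acc))} → {h₃ : T (not (q ≡ᵇ r))} → {h₄ : T (not (acc ≡ᵇ r))} →
    {h₅ : T (8 ≤ᵇ 2 ^ k)} → {h₆ : T (1 + cost (reg acc ⊕ f) ≤ᵇ 2 ^ k)} →
    N ≤ x ^ a → regs σ q ≡ N →
    (∀ i τ → i < N → Frame (acc ≔ reg acc ⊕ f ⨾ r ≔ reg r ⊕ lit 1) σ τ → regs τ r ≡ i → eval f τ ≡ g i) →
    Halts (for r below q loop acc ≔ reg acc ⊕ f) σ (a + (4 + k)) (λ τ → regs τ acc ≡ regs σ acc + ∑ N g)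
  sumR {r} {q} {acc} {f} {σ} {k} a N g {h₁} {h₂} {h₃} {h₄} {h₅} {h₆} N≤ eq val =
    forR a N (λ i τ → regs τ acc ≡ regs σ acc + ∑ i g) {h₁} {h₂} {h₃} {h₅} N≤ eq
      (trans (update-other (regs σ) {r} 0 acc≢r) (sym (+-identityʳ _)))
      λ i τ i<N φ ri inv → assignR {h = h₆}
        (trans (update-other (regs (setReg τ acc _)) {r} (suc i) acc≢r) (trans (update-same (regs τ) acc _)
          (trans (cong₂ _+_ inv (val i τ i<N φ ri)) (+-assoc _ (∑ i g) (g i)))))
    where
    acc≢r : acc ≢ r
    acc≢r = ≢-from-T h₄

  fillR : ∀ {r q b f σ k} a N (g : ℕ → ℕ) → {h₃ : T (not (q ≡ᵇ r))} →
    {h₅ : T (8 ≤ᵇ 2 ^ k)} → {h₆ : T (1 + cost (reg r) + cost f ≤ᵇ 2 ^ k)} →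
    N ≤ x ^ a → regs σ q ≡ N →
    (∀ i τ → i < N → Frame (b [ reg r ]≔ f ⨾ r ≔ reg r ⊕ lit 1) σ τ → regs τ r ≡ i → eval f τ ≡ g i) →
    Halts (for r below q loop b [ reg r ]≔ f) σ (a + (4 + k)) (λ τ → ∀ {i} → i < N → arrays τ b i ≡ g i)
  fillR {r} {q} {b} {f} {σ} {k} a N g {h₃} {h₅} {h₆} N≤ eq val =
    forR a N (λ i τ → ∀ {j} → j < i → arrays τ b j ≡ g j) {h₃ = h₃} {h₅} N≤ eq (λ ())
      λ i τ i<N φ ri inv → storeR {h = h₆} λ {j} j<1+i → write i τ ri (val i τ i<N φ ri) inv
          (m≤n⇒m<n∨m≡n (s≤s⁻¹ j<1+i))
    where
    write : ∀ i τ → regs τ r ≡ i → eval f τ ≡ g i → (∀ {j} → j < i → arrays τ b j ≡ g j) →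
      ∀ {j} → j < i ⊎ j ≡ i → arrays (setCell τ b (regs τ r) (eval f τ)) b j ≡ g j
    write i τ refl e inv (inj₁ j<i)  = trans (arrays-other τ b _ (<⇒≢ j<i)) (inv j<i)
    write i τ refl e inv (inj₂ refl) = trans (arrays-same τ b _ _) e

  prefixR : ∀ {r q b f σ k} a N (g : ℕ → ℕ) → {h₃ : T (not (q ≡ᵇ r))} →
    {h₅ : T (8 ≤ᵇ 2 ^ k)} → {h₆ : T (1 + cost (reg r ⊕ lit 1) + cost (arr b (reg r) ⊕ f) ≤ᵇ 2 ^ k)} →
    N ≤ x ^ a → regs σ q ≡ N → arrays σ b 0 ≡ 0 →
    (∀ i τ → i < N → Frame (b [ reg r ⊕ lit 1 ]≔ arr b (reg r) ⊕ f ⨾ r ≔ reg r ⊕ lit 1) σ τ → regs τ r ≡ i →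
        eval f τ ≡ g i) →
    Halts (for r below q loop b [ reg r ⊕ lit 1 ]≔ arr b (reg r) ⊕ f) σ (a + (4 + k))
      (λ τ → ∀ {i} → i ≤ N → arrays τ b i ≡ ∑ i g)
  prefixR {r} {q} {b} {f} {σ} {k} a N g {h₃} {h₅} {h₆} N≤ eq zero-cell val =
    forR a N (λ i τ → ∀ {j} → j ≤ i → arrays τ b j ≡ ∑ j g) {h₃ = h₃} {h₅} N≤ eq (λ { z≤n → zero-cell })
      λ i τ i<N φ ri inv → storeR {h = h₆} λ {j} j≤1+i → write i τ ri (val i τ i<N φ ri) inv (m≤n⇒m<n∨m≡n j≤1+i)
    where
    write : ∀ i τ → regs τ r ≡ i → eval f τ ≡ g i → (∀ {j} → j ≤ i → arrays τ b j ≡ ∑ j g) →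
      ∀ {j} → j < suc i ⊎ j ≡ suc i →
      arrays (setCell τ b (regs τ r + 1) (arrays τ b (regs τ r) + eval f τ)) b j ≡ ∑ j g
    write i τ refl e inv (inj₁ j<)   =
      trans (arrays-other τ b _ (λ j≡ → <⇒≢ j< (trans j≡ (+-comm i 1)))) (inv (s≤s⁻¹ j<))
    write i τ refl e inv (inj₂ refl) = trans
      (subst (λ l → arrays (setCell τ b l (arrays τ b i + eval f τ)) b (suc i) ≡ arrays τ b i + eval f τ)
          (+-comm 1 i)
        (arrays-same τ b (suc i) _))
      (cong₂ _+_ (inv ≤-refl) e)

infixl 9 _·_

_·_ : ∀ {f g : ℕ → ℕ} {i j} → f ≡ g → i ≡ j → f i ≡ g j
_·_ = cong₂ (λ f i → f i)

-- Correctness and running time of the search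

module SearchPhase (x : ℕ) (2≤x : 2 ≤ x) (n c L : ℕ) (a : ℕ → ℕ → ℕ) (a-sym : ∀ u v → a u v ≡ a v u)
  (D : ℕ → ℕ) (D≤1 : ∀ v → D v ≤ 1)
  (covers : ∀ {u v} → u < n → v < n → a u v ≢ 0 → D u ≢ 0 ⊎ D v ≢ 0)
  (slot : ℕ → ℕ) (slot-block : ∀ {i s} → i < L + n → s < c → slot (i * c + s) ≡ i)
  (n≤S : n ≤ (L + n) * c)
  (L-positive : ∀ {v} → v < n → D v ≢ 0 → L ≢ 0)
  (n<x : n < x) (S≤ : (L + n) * c ≤ x ^ 5) where

  open Loops x 2≤x
  open Poly x 2≤x
  open Slots n c (L + n) slot slot-block

  n≤ : n ≤ x ^ 1
  n≤ = linear≤ n<x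

  penalty : ℕ
  penalty = suc (n * n) * suc n

  -- The data that the search reads but never changes, so that it can be transported along frames.
  record Env (σ : State) : Set where
    field
      order    : regs σ 0 ≡ n
      range    : regs σ 3 ≡ L
      slots    : regs σ 5 ≡ S
      edge     : ∀ {u v} → u < n → v < n → arrays σ 0 (arrays σ 8 u + v) ≡ a u v
      cover    : arrays σ 2 ≡ D
      bucketOf : arrays σ 6 ≡ slot
      unit     : ∀ {y} → y ≤ 1 → arrays σ 9 y ≡ suc n * y
      charge   : ∀ {y} → y ≤ 1 → arrays σ 10 y ≡ penalty * y

  env-frame : ∀ {p σ τ} →
    {_ : T (not (writes p 0))} {_ : T (not (writes p 3))} {_ : T (not (writes p 5))}
    {_ : T (not (stores p 0))} {_ : T (not (stores p 2))} {_ : T (not (stores p 6))}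
    {_ : T (not (stores p 8))} {_ : T (not (stores p 9))} {_ : T (not (stores p 10))} →
    Frame p σ τ → Env σ → Env τ
  env-frame {h₀} {σ} {τ} {r₀} {r₃} {r₅} {a₀} {a₂} {a₆} {a₈} {a₉} {a₁₀} φ ρ = record
    { order    = trans (keepReg φ 0 {r₀}) (Env.order ρ)
    ; range    = trans (keepReg φ 3 {r₃}) (Env.range ρ)
    ; slots    = trans (keepReg φ 5 {r₅}) (Env.slots ρ)
    ; edge     = λ {u} {v} u<n v<n → trans
        (keepArray φ 0 {a₀} · cong (_+ v) (keepArray φ 8 {a₈} · refl)) (Env.edge ρ u<n v<n)
    ; cover    = trans (keepArray φ 2 {a₂}) (Env.cover ρ)
    ; bucketOf = trans (keepArray φ 6 {a₆}) (Env.bucketOf ρ)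
    ; unit     = λ y≤1 → trans (keepArray φ 9 {a₉} · refl) (Env.unit ρ y≤1)
    ; charge   = λ y≤1 → trans (keepArray φ 10 {a₁₀} · refl) (Env.charge ρ y≤1)
    }

  edge-at : ∀ {σ u v i j} → Env σ → i ≡ u → j ≡ v → u < n → v < n → arrays σ 0 (arrays σ 8 i + j) ≡ a u v
  edge-at ρ refl refl = Env.edge ρ

  Assigned Unassigned : (ℕ → ℕ) → ℕ → Set
  Assigned owner v = ∃[ j ] j < S × owner j ≡ suc v
  Unassigned owner v = ∀ {j} → j < S → owner j ≢ suc v

  -- The value left in register 8 by findUnassigned.
  Found : (ℕ → ℕ) → ℕ → ℕ → Set
  Found owner m r = (r ≡ 0 × (∀ {v} → v < m → Assigned owner v)) ⊎
                    (∃[ u ] r ≡ suc u × u < n × Unassigned owner u)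

  findR : ∀ {σ} → Env σ → Halts findUnassigned σ 22 (λ τ → Found (arrays τ 5) n (regs τ 8))
  findR {σ} ρ = mapR (λ τ φ f → subst (λ o → Found o n (regs τ 8)) (sym (keepArray φ 5)) f)
    (setR 0 refl then λ σ₁ φ₁ e₁ →
      forR 1 n (λ i τ → Found owner i (regs τ 8)) n≤ (trans (keepReg φ₁ 0) (Env.order ρ)) (inj₁ (e₁ , λ ()))
        λ i τ i<n φ ri inv →
          let ρτ = env-frame φ (env-frame φ₁ ρ)
              own = trans (keepArray φ 5) (keepArray φ₁ 5) in
          (setR 0 refl then λ τ₁ ψ₁ z →
           sumR {k = 5} 5 S (λ j → 1 ∸ differ (owner j) (suc i)) S≤ (trans (keepReg ψ₁ 5) (Env.slots ρτ))
             (λ j υ j<S χ rj → cong₂ (λ p q → 1 ∸ differ p q)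
                (trans (keepArray χ 5) (trans (keepArray ψ₁ 5) own) · rj)
                (trans (+-comm _ 1) (cong suc (trans (keepReg χ 10) (trans (keepReg ψ₁ 10) ri)))))
           then λ τ₂ ψ₂ cnt →
           whenR (λ ne → skipR 13 (occupied i (trans cnt (cong (_+ holders i) z)) ne
                            (subst (Found owner i) (sym (trans (keepReg ψ₂ 8) (keepReg ψ₁ 8))) inv)))
                 (λ z′ → assignR (vacant i i<n (trans cnt (cong (_+ holders i) z)) z′
                            (trans (+-comm _ 1) (cong suc (trans (keepReg ψ₂ 10) (trans (keepReg ψ₁ 10) ri)))))))
        )
    where
    owner = arrays σ 5
    holders : ℕ → ℕ
    holders i = ∑ S (λ j → 1 ∸ differ (owner j) (suc i))
    occupied : ∀ i {r s} → s ≡ holders i → s ≢ 0 → Found owner i r → Found owner (suc i) r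
    occupied i e ne (inj₂ u) = inj₂ u
    occupied i e ne (inj₁ (z , all)) = inj₁ (z , λ {v} v<1+i → cases (m≤n⇒m<n∨m≡n (s≤s⁻¹ v<1+i)))
      where
      hit : Assigned owner i
      hit with ∑≢0 S (λ w → ne (trans e w))
      ... | j , j<S , nz with differ (owner j) (suc i) ≟ 0
      ...   | yes d = j , j<S , differ≡0⇒≡ d
      ...   | no nd = contradiction (m≤n⇒m∸n≡0 (n≢0⇒n>0 nd)) nz
      cases : ∀ {v} → v < i ⊎ v ≡ i → Assigned owner v
      cases (inj₁ v<i)  = all v<i
      cases (inj₂ refl) = hit
    vacant : ∀ i {r s} → i < n → s ≡ holders i → s ≡ 0 → r ≡ suc i → Found owner (suc i) r
    vacant i i<n e z r = inj₂ (i , r , i<n , λ {j} j<S o →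
      contradiction (trans (sym (cong (1 ∸_) (differ-self {owner j} o)))
          (∑≡0 {S} (λ j → 1 ∸ differ (owner j) (suc i)) (trans (sym e) z) j<S)) λ ())

  Sound : ℕ → (ℕ → ℕ) → Set
  Sound y f = (∀ {v} → v < n → f v < L + n) × Fits n c f × Λ n a f ≡ y

  Sound-cong : ∀ {y f g} → (∀ {v} → v < n → f v ≡ g v) → Sound y f → Sound y g
  Sound-cong e (f< , fits , eq) = (λ v<n → subst (_< L + n) (e v<n) (f< v<n))
    , Fits-refine (λ u<n v<n e′ → trans (e u<n) (trans e′ (sym (e v<n)))) fits
    , trans (sym (Λ-cong n a e)) eq

  -- The first alternative is the initial mark, which no value of `Λ` attains.
  Incumbent : ℕ → (ℕ → ℕ) → Set
  Incumbent y f = y ≡ suc (n * n) ⊎ Sound y f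

  -- Only competitors that follow the guess on the cover are considered, so the statement is vacuous
  -- for a guess that overfills a bucket.
  Beaten : (ℕ → ℕ) → ℕ → Set
  Beaten q y = ∀ g → (∀ {v} → v < n → g v < L + n) → Fits n c g →
    (∀ {v} → v < n → D v ≢ 0 → g v ≡ q v) → y ≤ Λ n a g

  module Guess (p : ℕ → ℕ) where

    open Cost n a a-sym D covers p hiding (penalty) public

    w : ℕ → ℕ → ℕ
    w v j = weight v (slot j)

    open AuctionTheory n S W w public

    offerR : ∀ {σ v j} → Env σ → arrays σ 3 ≡ p → regs σ 13 ≡ v → v < n → regs σ 12 ≡ j →
      Halts offer σ 12 (λ τ → regs τ 16 ≡ w v j + arrays σ 4 j)
    offerR {σ} {v} {j} ρ e₃ rv v<n rj = mapR {d = 12}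
        {Q = λ τ → regs τ 16 ≡ arrays σ 4 j + penalty * displaced v (slot j) + suc n * crossings v (slot j)}
      (λ τ φ e → trans e (lemma (arrays σ 4 j) (penalty * displaced v (slot j)) (suc n * crossings v (slot j))))
      (setR (arrays σ 4 j + penalty * displaced v (slot j))
         (cong₂ _+_ (cong (arrays σ 4) rj)
           (trans (cong (arrays σ 10) (cong₂ conj (Env.cover ρ · rv)
               (cong₂ differ (e₃ · rv) (Env.bucketOf ρ · rj))))
             (Env.charge ρ (conj≤1 (D v) (differ (p v) (slot j))))))
      then λ σ₁ φ₁ e₁ → mapR {d = 11} (λ τ φ e → trans e (cong₂ _+_ e₁ (∑-* n (suc n) (crossing v (slot j)))))
        (sumR {k = 6} 1 n (λ u → suc n * crossing v (slot j) u) n≤ (trans (keepReg φ₁ 0) (Env.order ρ))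
          λ u τ u<n φ ru →
            let ρτ = env-frame φ (env-frame φ₁ ρ)
                rv′ = trans (keepReg φ 13) (trans (keepReg φ₁ 13) rv)
                rj′ = trans (keepReg φ 12) (trans (keepReg φ₁ 12) rj)
                e₃′ = trans (keepArray φ 3) (trans (keepArray φ₁ 3) e₃) in
            trans (cong (arrays τ 9) (cong₂ conj (Env.cover ρτ · ru) (cong₂ conj (edge-at ρτ rv′ ru v<n u<n)
                    (cong₂ far (e₃′ · ru) (Env.bucketOf ρτ · rj′)))))
              (Env.unit ρτ (conj≤1 (D u) (conj (a v u) (far (p u) (slot j)))))))
      where
      lemma : ∀ a b c → a + b + c ≡ c + b + a
      lemma = solve-∀

    Best : (ℕ → ℕ) → ℕ → ℕ → ℕ → Set
    Best price v m b = b < m × (∀ {i} → i < m → w v b + price b ≤ w v i + price i)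

    bestR : ∀ {σ v} → Env σ → arrays σ 3 ≡ p → regs σ 13 ≡ v → v < n →
      Halts bestOffer σ 23 (λ τ → ∃[ b ] regs τ 14 ≡ suc b × Best (arrays σ 4) v S b)
    bestR {σ} {v} ρ e₃ rv v<n =
      setR 0 refl then λ σ₁ φ₁ e₁ → mapR (λ τ φ → final τ)
        (forR 5 S I S≤ (trans (keepReg φ₁ 5) (Env.slots ρ)) (inj₁ (refl , e₁))
          λ j τ j<S φ rj inv →
            let ρτ = env-frame φ (env-frame φ₁ ρ)
                e₃′ = trans (keepArray φ 3) (trans (keepArray φ₁ 3) e₃)
                rv′ = trans (keepReg φ 13) (trans (keepReg φ₁ 13) rv)
                e₄ = trans (keepArray φ 4) (keepArray φ₁ 4) in
            (offerR ρτ e₃′ rv′ v<n rj then λ τ₁ ψ₁ o →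
              let o′ = trans o (cong (w v j +_) (e₄ · refl))
                  inv′ = subst₂ (Inv j) (sym (keepReg ψ₁ 14)) (sym (keepReg ψ₁ 15)) inv in
              whenR (λ ne → setR (suc j) (trans (+-comm _ 1) (cong suc (trans (keepReg ψ₁ 12) rj))) then λ τ₂ ψ₂ e →
                       assignR (inj₂ (j , e , trans (keepReg ψ₂ 16) o′ ,
                         better j (subst (λ y → (1 ∸ regs τ₁ 14) + (regs τ₁ 15 ∸ y) ≢ 0) o′ ne) inv′)))
                    (λ z → skipR 11 (worse j (subst (λ y → (1 ∸ regs τ₁ 14) + (regs τ₁ 15 ∸ y) ≡ 0) o′ z) inv′)))
        )
      where
      price = arrays σ 4
      bid-at : ℕ → ℕ
      bid-at j = w v j + price j
      Inv : ℕ → ℕ → ℕ → Set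
      Inv i r s = (i ≡ 0 × r ≡ 0) ⊎ (∃[ b ] r ≡ suc b × s ≡ bid-at b × Best price v i b)
      I : ℕ → State → Set
      I i τ = Inv i (regs τ 14) (regs τ 15)
      better : ∀ j {r s} → (1 ∸ r) + (s ∸ bid-at j) ≢ 0 → Inv j r s → Best price v (suc j) j
      better j _ (inj₁ (refl , _)) = s≤s z≤n , λ { (s≤s z≤n) → ≤-refl }
      better j ne (inj₂ (b , refl , refl , b<j , best)) = ≤-refl , λ {i} i<1+j → cases (m≤n⇒m<n∨m≡n (s≤s⁻¹ i<1+j))
        where
        cases : ∀ {i} → i < j ⊎ i ≡ j → bid-at j ≤ bid-at i
        cases (inj₁ i<j)  = ≤-trans (<⇒≤
            (m∸n≢0⇒n<m (subst (λ k → k + (bid-at b ∸ bid-at j) ≢ 0) (0∸n≡0 b) ne))) (best i<j)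
        cases (inj₂ refl) = ≤-refl
      worse : ∀ j {r s} → (1 ∸ r) + (s ∸ bid-at j) ≡ 0 → Inv j r s → Inv (suc j) r s
      worse j z (inj₁ (_ , refl)) = contradiction z λ ()
      worse j z (inj₂ (b , refl , refl , b<j , best)) =
        inj₂ (b , refl , refl , m<n⇒m<1+n b<j , λ {i} i<1+j → cases (m≤n⇒m<n∨m≡n (s≤s⁻¹ i<1+j)))
        where
        cases : ∀ {i} → i < j ⊎ i ≡ j → bid-at b ≤ bid-at i
        cases (inj₁ i<j)  = best i<j
        cases (inj₂ refl) = m∸n≡0⇒m≤n (m+n≡0⇒n≡0 (1 ∸ suc b) z)
      final : ∀ τ → I S τ → ∃[ b ] regs τ 14 ≡ suc b × Best price v S b
      -- The bidder `v` exists, so n and hence the number of slots is positive and some slot has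
      -- been recorded.
      final τ (inj₁ (S≡0 , _)) = contradiction (≤-trans v<n (≤-trans n≤S (≤-reflexive S≡0))) λ ()
      final τ (inj₂ (b , e , _ , best)) = b , e , best

    -- The fuel of the auction: every bid raises the sum of the S prices by exactly 1, and no price
    -- exceeds `suc W`. The additional 1 keeps the remaining fuel positive at all times.
    total-price : ℕ
    total-price = suc (S * suc W)

    biddingR : ∀ {σ u} → Env σ → arrays σ 3 ≡ p → IsAuction (arrays σ 4) (arrays σ 5) →
      regs σ 8 ≡ suc u → u < n → Unassigned (arrays σ 5) u →
      Halts bidding σ 25 (λ τ → IsAuction (arrays τ 4) (arrays τ 5) × ∑ S (arrays τ 4) ≡ ∑ S (arrays σ 4) + 1)
    biddingR {σ} {u} ρ e₃ auc r₈ u<n free =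
      setR u (cong (_∸ 1) r₈) then λ σ₁ φ₁ e₁ →
      weak (bestR (env-frame φ₁ ρ) (trans (keepArray φ₁ 3) e₃) e₁ u<n) then λ σ₂ φ₂ (b , r₁₄ , b<S , best) →
      setR b (cong (_∸ 1) r₁₄) then λ σ₃ φ₃ e₃ →
      let same₄ = trans (keepArray φ₃ 4) (trans (keepArray φ₂ 4) (keepArray φ₁ 4))
          same₅ = trans (keepArray φ₃ 5) (trans (keepArray φ₂ 5) (keepArray φ₁ 5))
          best′ = λ {i} i<S → subst (λ f → w u b + f b ≤ w u i + f i) (keepArray φ₁ 4) (best {i} i<S)
          r₈′ = trans (keepReg φ₃ 8) (trans (keepReg φ₂ 8) (trans (keepReg φ₁ 8) r₈)) in
      storeR {Q = λ τ → arrays τ 5 ≡ update (arrays σ 5) b (suc u)}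
        (trans (cong (λ f → update f (regs σ₃ 14) (regs σ₃ 8)) same₅) (cong₂ (update (arrays σ 5)) e₃ r₈′))
            then λ σ₄ φ₄ e₄ →
      storeR (conclude (trans (keepArray φ₄ 4) same₄) e₄ (trans (keepReg φ₄ 14) e₃) b<S best′)
      where
      price = arrays σ 4
      conclude : ∀ {f g b j} → f ≡ price → g ≡ update (arrays σ 5) b (suc u) → j ≡ b → b < S →
        (∀ {i} → i < S → w u b + price b ≤ w u i + price i) →
        IsAuction (update f j (f j + 1)) g × ∑ S (update f j (f j + 1)) ≡ ∑ S price + 1
      conclude {b = b} refl refl refl b<S best =
        subst (λ y → IsAuction (update price b y) (update (arrays σ 5) b (suc u))) (+-comm 1 (price b))
          (bid auc n≤S u<n free (λ {j} _ → weight≤W u (slot j)) b<S best)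
        , ∑-bump price (update price b (price b + 1)) 1 b<S (λ i≢b → update-other price (price b + 1) i≢b)
            (update-same price b _)

    Sold : State → Set
    Sold τ = IsAuction (arrays τ 4) (arrays τ 5) × (∀ {v} → v < n → Assigned (arrays τ 5) v)

    x^≥ : ∀ {y d e} → y ≤ x ^ d → {_ : T (d ≤ᵇ e)} → y ≤ x ^ e
    x^≥ {d = d} {e} y≤ {h} = ≤-trans y≤ (^-mono (≤ᵇ⇒≤ d e h))

    total-price≤ : total-price ≤ x ^ 12
    total-price≤ = sum≤ {1} {S * suc W} {11} (lit≤ 11) (x^≥ {d = 10} {11} (prod≤ 5 5 S≤ W≤))
      where
      W≤ : suc W ≤ x ^ 5
      W≤ = sum≤ {1} {W} {4} (lit≤ 4) (sum≤ {suc n * n} {penalty} {3} (x^≥ {d = 2} {3} (prod≤ 1 1 1+n≤ n≤))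
          (prod≤ 2 1 (square< n<x) 1+n≤))
        where
        1+n≤ : suc n ≤ x ^ 1
        1+n≤ = ≤-trans n<x (≤-reflexive (sym (*-identityʳ x)))

    auctionR : ∀ {σ} → Env σ → arrays σ 3 ≡ p → Halts auction σ 44 Sold
    auctionR {σ} ρ e₃ =
      weak (fillR {k = 3} 5 S (λ _ → 0) S≤ (Env.slots ρ) (λ _ _ _ _ _ → refl)) then λ σ₁ φ₁ free →
      weak (fillR {k = 3} 5 S (λ _ → 0) S≤ (Env.slots (env-frame φ₁ ρ)) (λ _ _ _ _ _ → refl)) then λ σ₂ φ₂ empty →
      let ρ₂ = env-frame φ₂ (env-frame φ₁ ρ) in
      weak (findR ρ₂) then λ σ₃ φ₃ found →
      weak (whileR 26 12 I
        (λ m τ φ (auc , f , fuel) → body m τ (env-frame φ (env-frame φ₃ ρ₂))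
           (trans (keepArray φ 3) (trans (keepArray φ₃ 3)
               (trans (keepArray φ₂ 3) (trans (keepArray φ₁ 3) e₃)))) auc f fuel)
        (total-price ∸ ∑ S (arrays σ₃ 4)) (≤-trans (m∸n≤m total-price (∑ S (arrays σ₃ 4))) total-price≤)
        (let auc = initial (λ j<S → trans (keepArray φ₃ 4 · refl) (trans (keepArray φ₂ 4 · refl) (free j<S)))
                           (λ j<S → trans (keepArray φ₃ 5 · refl) (empty j<S)) in
         auc , found , m∸n+n≡m (m≤n⇒m≤1+n (∑-≤const S (bounded auc)))))
      where
      I : ℕ → State → Set
      I m τ = IsAuction (arrays τ 4) (arrays τ 5) × Found (arrays τ 5) n (regs τ 8) × m + ∑ S (arrays τ 4) ≡
          total-price
      body : ∀ m τ → Env τ → arrays τ 3 ≡ p → IsAuction (arrays τ 4) (arrays τ 5) → Found (arrays τ 5) n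
          (regs τ 8) →
        m + ∑ S (arrays τ 4) ≡ total-price →
        (regs τ 8 ≡ 0 × Sold τ) ⊎ (regs τ 8 ≢ 0 × ∃[ m′ ] m ≡ suc m′ × Halts (bidding ⨾ findUnassigned) τ 26 (I m′))
      body m τ ρτ e auc (inj₁ (z , all)) fuel = inj₁ (z , auc , all)
      body zero τ ρτ e auc (inj₂ _) fuel =
        contradiction (≤-trans (≤-reflexive (sym fuel)) (∑-≤const S (bounded auc))) (<-irrefl refl)
      body (suc m) τ ρτ e auc (inj₂ (u , r₈ , u<n , free)) fuel = inj₂
          ((λ z → contradiction (trans (sym r₈) z) λ ()) , m , refl ,
        (biddingR ρτ e auc r₈ u<n free then λ τ₁ ψ₁ (auc₁ , paid) →
         mapR (λ τ₂ ψ₂ f → subst₂ IsAuction (sym (keepArray ψ₂ 4)) (sym (keepArray ψ₂ 5)) auc₁ , f ,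
                trans (cong (λ g → m + ∑ S g) (keepArray ψ₂ 4)) (trans (cong (m +_) paid)
                  (trans (cong (m +_) (+-comm _ 1)) (trans (+-suc m _) fuel))))
              (findR (env-frame ψ₁ ρτ))))

    evaluateR : ∀ {σ} → Env σ → arrays σ 3 ≡ p → Sold σ → Incumbent (regs σ 6) (arrays σ 7) →
      Halts evaluate σ 19 (λ τ → Incumbent (regs τ 6) (arrays τ 7) × regs τ 6 ≤ regs σ 6 × Beaten p (regs τ 6))
    evaluateR {σ} ρ e₃ (auc , all) inc =
      weak scatter then λ σ₁ φ₁ wrote →
      setR 0 refl then λ σ₂ φ₂ e₂ →
      let ρ₂ = env-frame φ₂ (env-frame φ₁ ρ)
          F = λ v → arrays σ₁ 11 (v + 1) in
      forR 1 n (λ i τ → regs τ 8 ≡ ∑ i (λ u → ∑ n λ v → conj (a u v) (far (F u) (F v)))) n≤ (Env.order ρ₂) e₂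
        (λ u τ u<n φ ru inv → let ρτ = env-frame φ ρ₂ in
          mapR (λ υ ψ e → trans e (cong (_+ _) inv))
            (sumR {k = 6} 1 n (λ v → conj (a u v) (far (F u) (F v))) n≤ (Env.order ρτ) λ v υ v<n χ rv →
              let ru′ = trans (keepReg χ 10) ru
                  e₁₁ = trans (keepArray χ 11) (trans (keepArray φ 11) (keepArray φ₂ 11)) in
              cong₂ conj (edge-at (env-frame χ ρτ) ru′ rv u<n v<n)
                (cong₂ far (e₁₁ · cong (_+ 1) ru′) (e₁₁ · cong (_+ 1) rv))))
      then λ σ₃ φ₃ e₈ →
      let r₆ = trans (keepReg φ₃ 6) (trans (keepReg φ₂ 6) (keepReg φ₁ 6))
          s₇ = trans (keepArray φ₃ 7) (trans (keepArray φ₂ 7) (keepArray φ₁ 7))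
          sound , beats = assess F (λ {j} j<S o → trans
              (cong (arrays σ₁ 11) (trans (+-comm _ 1) (suc-pred (owner j) {{≢-nonZero o}}))) (wrote j<S o))
          inc₃ = subst₂ Incumbent (sym r₆) (sym s₇) inc in
      whenR
        (λ ne → setR (Λ n a F) e₈ then λ σ₄ φ₄ e₆ →
          mapR (λ τ φ copied →
              let r = trans (keepReg φ 6) e₆ in
              inj₂ (subst (λ y → Sound y (arrays τ 7)) (sym r) (Sound-cong (λ v<n → sym (copied v<n)) sound))
              , ≤-trans (≤-reflexive r) (≤-trans (≤-reflexive (sym e₈))
                  (≤-trans (<⇒≤ (m∸n≢0⇒n<m ne)) (≤-reflexive r₆)))
              , λ g g< fits ag → ≤-trans (≤-reflexive r) (beats g g< fits ag))
            (fillR {k = 4} 1 n F n≤ (trans (keepReg φ₄ 0) (Env.order (env-frame φ₃ ρ₂))) λ v τ v<n φ rv →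
              trans (keepArray φ 11) (trans (keepArray φ₄ 11) (trans (keepArray φ₃ 11) (keepArray φ₂ 11))) ·
                  cong (_+ 1) rv))
        (λ z → skipR 15 (inc₃ , ≤-reflexive r₆ , λ g g< fits ag →
          ≤-trans (m∸n≡0⇒m≤n z) (≤-trans (≤-reflexive e₈) (beats g g< fits ag))))
      where
      owner = arrays σ 5

      scatter : Halts (for 10 below 5 loop 11 [ arr 5 (reg 10) ]≔ arr 6 (reg 10)) σ 12
        (λ τ → ∀ {j} → j < S → owner j ≢ 0 → arrays τ 11 (owner j) ≡ slot j)
      scatter = forR {e = 3} 5 S (λ i τ → ∀ {j} → j < i → owner j ≢ 0 → arrays τ 11 (owner j) ≡ slot j) S≤
          (Env.slots ρ) (λ ())
        λ i τ i<S φ ri inv → storeR λ {j} j<1+i o → write i τ (keepArray φ 5 · ri)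
            (Env.bucketOf (env-frame φ ρ) · ri) i<S inv (m≤n⇒m<n∨m≡n (s≤s⁻¹ j<1+i)) o
        where
        write : ∀ i τ {k y} → k ≡ owner i → y ≡ slot i → i < S →
            (∀ {j} → j < i → owner j ≢ 0 → arrays τ 11 (owner j) ≡ slot j) →
          ∀ {j} → j < i ⊎ j ≡ i → owner j ≢ 0 → arrays (setCell τ 11 k y) 11 (owner j) ≡ slot j
        write i τ refl refl i<S inv {j} (inj₁ j<i) o = trans
          (update-other (arrays τ 11) (slot i) λ same → <⇒≢ j<i (distinct auc (<-trans j<i i<S) i<S o same))
              (inv j<i o)
        write i τ refl refl i<S inv (inj₂ refl) o = update-same (arrays τ 11) (owner i) (slot i)

      -- `f` selects the slot that each vertex holds. A competitor `g` is spread over slots by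
      -- `place`; `near-optimal` then compares the weights up to n, and `Λ-optimal` turns this into
      -- an exact comparison.
      assess : ∀ F → (∀ {j} → j < S → owner j ≢ 0 → F (pred (owner j)) ≡ slot j) → Sound (Λ n a F) F × Beaten
          p (Λ n a F)
      assess F at with choose n all
      ... | f , holds = ((λ v<n → subst (_< L + n) (sym (F≡ v<n)) (slot<M (proj₁ (holds v<n))))
                        , Fits-refine (λ u<n v<n e → trans (sym (F≡ u<n)) (trans e (F≡ v<n)))
                            (slots-fit (λ v<n → proj₁ (holds v<n)) f-injective)
                        , refl)
                      , λ g g< fits ag → let open Place g g< fits in
                          ≤-trans (≤-reflexive (Λ-cong n a F≡)) (Λ-optimal {λ v → slot (f v)} {g} ag (≤-trans
                            (near-optimal auc f holds place place<S place-injective)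
                            (≤-reflexive (cong (_+ n) (∑-cong n λ {v} v<n → cong (weight v) (slot-place v<n))))))
        where
        F≡ : ∀ {v} → v < n → F v ≡ slot (f v)
        F≡ {v} v<n with holds v<n
        ... | j<S , o = trans (cong (λ k → F (pred k)) (sym o)) (at j<S λ z → contradiction (trans (sym o) z) λ ())
        f-injective : InjectiveBelow n f
        f-injective u<n v<n e = suc-injective
            (trans (sym (proj₂ (holds u<n))) (trans (cong owner e) (proj₂ (holds v<n))))

  open Numeral n L D

  incrementR : ∀ {σ} → Env σ → Valid (arrays σ 3) →
    Halts increment σ 14 (λ τ → Stage (arrays σ 3) n (arrays τ 3) (regs τ 7))
  incrementR {σ} ρ vp =
    setR 1 refl then λ σ₁ φ₁ e₁ →
    forR 1 n (λ i τ → Stage p i (arrays τ 3) (regs τ 7)) n≤ (trans (keepReg φ₁ 0) (Env.order ρ))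
      (subst₂ (Stage p 0) (sym (keepArray φ₁ 3)) (sym e₁) (start vp))
      λ i τ i<n φ ri st →
        let ρτ = env-frame φ (env-frame φ₁ ρ)
            test = cong₂ conj (Env.cover ρτ · ri) (cong₂ (λ l k → l ∸ (arrays τ 3 k + 1)) (Env.range ρτ) ri) in
        whenR
          (λ ne → let st₁ = subst (Stage p i (arrays τ 3)) (carries ne st) st
                      room , full = advance D≤1 i<n st₁ in
            whenR
              (λ ne′ → storeR {Q = λ υ → arrays υ 3 ≡ update (arrays τ 3) i (suc (arrays τ 3 i))}
                         (cong₂ (λ k y → update (arrays τ 3) k y) ri
                             (trans (+-comm _ 1) (cong (λ k → suc (arrays τ 3 k)) ri)))
                       then λ υ ψ e → assignR (subst (λ f → Stage p (suc i) f 0) (sym e)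
                         (bump st₁ (room (λ z → ne′ (trans test z))))))
              (λ z → storeR (subst₂ (Stage p (suc i)) (cong (λ k → update (arrays τ 3) k 0) (sym ri))
                         (sym (carries ne st)) (wrap st₁ (full (trans (sym test) z))))))
          (λ z → skipR 7 (subst (Stage p (suc i) (arrays τ 3)) (sym z)
              (idle (subst (Stage p i (arrays τ 3)) z st))))
    where
    p = arrays σ 3
    carries : ∀ {i f r} → r ≢ 0 → Stage p i f r → r ≡ 1
    carries ne st with count st
    ... | inj₁ (e , _) = e
    ... | inj₂ (z , _) = contradiction z ne

  Exhausted : ℕ → Set
  Exhausted y = ∀ q → Valid q → Beaten q y

  -- Stated with `Runs` because the number of rounds, `radix n`, is not bounded by a fixed power of
  -- x; a single round is, with exponent 46. The 1 + 3 is the cost of the loop test.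
  searchR : ∀ {σ} → Env σ → (∀ v → arrays σ 3 v ≡ 0) → regs σ 7 ≡ 0 → Incumbent (regs σ 6) (arrays σ 7) →
    Runs search σ (1 + 3 + radix n * (1 + 3 + x ^ 46))
        (λ τ → Incumbent (regs τ 6) (arrays τ 7) × Exhausted (regs τ 6))
  searchR {σ} ρ₀ p0 z₇ inc₀ = whileRuns I step (radix n)
    (inc₀ , inj₁ (z₇ , valid₀ , trans (cong (radix n +_) value₀) (+-identityʳ _) ,
      λ q _ lt → contradiction (≤-trans lt (≤-reflexive value₀)) λ ()))
    where
    valid₀ : Valid (arrays σ 3)
    valid₀ {v} v<n = subst (_< base v) (sym (p0 v)) (base>0 v<n)
      where
      base>0 : ∀ {v} → v < n → 0 < base v
      base>0 {v} v<n with D v in eq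
      ... | zero = s≤s z≤n
      ... | suc k = m^n>0 L {{≢-nonZero L≢0}} (suc k)
        where
        L≢0 : L ≢ 0
        L≢0 = L-positive v<n (λ z → contradiction (trans (sym eq) z) λ ())
    value₀ : value (arrays σ 3) n ≡ 0
    value₀ = ∑-zero n λ {v} _ → cong (_* radix v) (p0 v)

    -- While the search is on, `m` is the number of numerals still to be tried, including the
    -- current one. After the overflow `m` is left unconstrained.
    I : ℕ → State → Set
    I m τ = Incumbent (regs τ 6) (arrays τ 7) ×
      ((regs τ 7 ≡ 0 × Valid (arrays τ 3) × m + value (arrays τ 3) n ≡ radix n ×
          (∀ q → Valid q → value q n < value (arrays τ 3) n → Beaten q (regs τ 6))) ⊎
       (regs τ 7 ≡ 1 × Exhausted (regs τ 6)))

    up-to : ∀ {p y y′} → Valid p → y′ ≤ y → Beaten p y′ →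
      (∀ q → Valid q → value q n < value p n → Beaten q y) →
      ∀ q → Valid q → value q n < suc (value p n) → Beaten q y′
    up-to vp y′≤y now before q vq lt g g< fits ag with m≤n⇒m<n∨m≡n (s≤s⁻¹ lt)
    ... | inj₁ q<p = ≤-trans y′≤y (before q vq q<p g g< fits ag)
    -- A valid numeral with the value of the current one has the same digits, so it is the guess
    -- just treated.
    ... | inj₂ q≡p = now g g< fits λ v<n Dv → trans (ag v<n Dv) (value-injective vq vp n ≤-refl q≡p v<n)

    round : ∀ {m τ} → Env τ → Incumbent (regs τ 6) (arrays τ 7) → Valid (arrays τ 3) →
      suc m + value (arrays τ 3) n ≡ radix n →
      (∀ q → Valid q → value q n < value (arrays τ 3) n → Beaten q (regs τ 6)) →
      Halts (auction ⨾ evaluate ⨾ increment) τ 46 (I m)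
    round {m} {τ} ρ inc vp fuel before =
      weak (auctionR ρ refl) then λ τ₁ ψ₁ sold →
      weak (evaluateR (env-frame ψ₁ ρ) (keepArray ψ₁ 3) sold
          (subst₂ Incumbent (sym (keepReg ψ₁ 6)) (sym (keepArray ψ₁ 7)) inc))
        then λ τ₂ ψ₂ (inc₂ , le , now) →
      let e₃ = trans (keepArray ψ₂ 3) (keepArray ψ₁ 3)
          le′ = ≤-trans le (≤-reflexive (keepReg ψ₁ 6))
          so-far = up-to vp le′ now before in
      mapR {d = 14} (λ τ₃ ψ₃ st →
          subst₂ Incumbent (sym (keepReg ψ₃ 6)) (sym (keepArray ψ₃ 7)) inc₂ ,
          next (sym (keepReg ψ₃ 6)) (subst (λ f → Stage f n _ _) e₃ st) so-far)
        (incrementR (env-frame ψ₂ (env-frame ψ₁ ρ)) (λ {v} → subst (λ f → Valid f) (sym e₃) vp {v}))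
      where
      p = arrays τ 3
      open Guess p
      next : ∀ {p′ r y y′} → y ≡ y′ → Stage p n p′ r → (∀ q → Valid q → value q n < suc (value p n) → Beaten q y) →
        (r ≡ 0 × Valid p′ × m + value p′ n ≡ radix n × (∀ q → Valid q → value q n < value p′ n → Beaten q y′)) ⊎
        (r ≡ 1 × Exhausted y′)
      next refl st before with count st
      ... | inj₁ (r , _ , last) = inj₂
          (r , λ q vq → before q vq (≤-trans (value< vq ≤-refl) (≤-reflexive (sym last))))
      ... | inj₂ (r , e) = inj₁ (r , valid st , trans (cong (m +_) e) (trans (+-suc m _) fuel) ,
              λ q vq lt → before q vq (≤-trans lt (≤-reflexive e)))

    step : ∀ m τ → Frame (auction ⨾ evaluate ⨾ increment) σ τ → I m τ →
      (1 ∸ regs τ 7 ≡ 0 × Incumbent (regs τ 6) (arrays τ 7) × Exhausted (regs τ 6)) ⊎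
      (1 ∸ regs τ 7 ≢ 0 × ∃[ m′ ] m ≡ suc m′ × Runs (auction ⨾ evaluate ⨾ increment) τ (x ^ 46) (I m′))
    step m τ φ (inc , inj₂ (r , done)) = inj₁ (cong (1 ∸_) r , inc , done)
    step zero τ φ (inc , inj₁ (r , vp , fuel , before)) =
      contradiction fuel (<⇒≢ (value< vp ≤-refl))
    step (suc m) τ φ (inc , inj₁ (r , vp , fuel , before)) =
      inj₂ ((λ z → contradiction (trans (sym (cong (1 ∸_) r)) z) λ ()) , m , refl ,
        run (round (env-frame φ ρ₀) inc vp fuel before))

-- Correctness of the tables, the matching and the slots

module SetupPhase (x : ℕ) (2≤x : 2 ≤ x) (n : ℕ) (n<x : n < x) where

  open Loops x 2≤x
  open Poly x 2≤x

  n≤ : n ≤ x ^ 1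
  n≤ = linear≤ n<x

  buckets≤ : ∀ {d} → d ≤ n → d + d + d + n ≤ x ^ 3
  buckets≤ {d} d≤n = ≤-trans (≤-reflexive (+-assoc (d + d) d n))
      (sum≤ {e = 2} (sum≤ {e = 1} d≤ d≤) (sum≤ {e = 1} d≤ n≤))
    where
    d≤ : d ≤ x ^ 1
    d≤ = ≤-trans d≤n n≤

  multiple : ∀ {y z} (f : ℕ → ℕ) → f 0 ≡ 0 → f 1 ≡ z → y ≤ 1 → f y ≡ z * y
  multiple {zero} {z} f f0 f1 _ = trans f0 (sym (*-zeroʳ z))
  multiple {suc zero} {z} f f0 f1 _ = trans f1 (sym (*-identityʳ z))
  multiple {suc (suc _)} f f0 f1 (s≤s ())

  record Constants (σ : State) : Set where
    field
      rows   : ∀ {i} → i ≤ n → arrays σ 8 i ≡ i * n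
      unit   : ∀ {y} → y ≤ 1 → arrays σ 9 y ≡ suc n * y
      charge : ∀ {y} → y ≤ 1 → arrays σ 10 y ≡ suc (n * n) * suc n * y
      worst  : regs σ 6 ≡ suc (n * n)

  constantsR : ∀ {σ} → regs σ 0 ≡ n → regs σ 8 ≡ 0 → arrays σ 8 0 ≡ 0 → arrays σ 9 0 ≡ 0 → arrays σ 10 0 ≡ 0 →
    Halts constants σ 16 Constants
  constantsR {σ} r₀ r₈ z₈ z₉ z₁₀ =
    weak (prefixR {k = 4} 1 n (λ _ → n) n≤ r₀ z₈ (λ i τ i<n φ ri → trans (keepReg φ 0) r₀)) then λ σ₁ φ₁ rows →
    let r₀¹ = trans (keepReg φ₁ 0) r₀ in
    setR (n * n) (trans (cong (arrays σ₁ 8) r₀¹) (trans (rows ≤-refl) (∑-const n n))) then λ σ₂ φ₂ e₂ →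
    let r₀² = trans (keepReg φ₂ 0) r₀¹ in
    setR (suc (n * n)) (trans (+-comm _ 1) (cong suc e₂)) then λ σ₃ φ₃ e₃ →
    let r₀³ = trans (keepReg φ₃ 0) r₀² in
    weak (sumR {k = 3} 2 (suc (n * n)) (λ _ → suc n) (square< n<x) e₃
       (λ i τ i<n φ ri → trans (+-comm _ 1) (cong suc (trans (keepReg φ 0) r₀³)))) then λ σ₄ φ₄ e₄ →
    storeR {Q = λ τ → arrays τ 9 1 ≡ suc n × arrays τ 9 0 ≡ 0}
      (trans (+-comm _ 1) (cong suc (trans (keepReg φ₄ 0) r₀³))
      , trans (keepArray φ₄ 9 · refl)
          (trans (keepArray φ₃ 9 · refl) (trans (keepArray φ₂ 9 · refl) (trans (keepArray φ₁ 9 · refl) z₉))))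
      then λ σ₅ φ₅ (e₅ , z₉⁵) →
    storeR {Q = λ τ → arrays τ 10 1 ≡ suc (n * n) * suc n × arrays τ 9 0 ≡ 0 × arrays τ 10 0 ≡ 0}
      (trans (keepReg φ₅ 8) (trans e₄
          (cong₂ _+_ (trans (keepReg φ₃ 8) (trans (keepReg φ₂ 8) (trans (keepReg φ₁ 8) r₈)))
              (∑-const (suc (n * n)) (suc n))))
      , z₉⁵
      , trans (keepArray φ₅ 10 · refl)
          (trans (keepArray φ₄ 10 · refl)
              (trans (keepArray φ₃ 10 · refl)
                  (trans (keepArray φ₂ 10 · refl) (trans (keepArray φ₁ 10 · refl) z₁₀))))
      ) then λ σ₆ φ₆ (e₁₀ , z₉′ , z₁₀′) →
    assignR (record
      { rows   = λ {i} i≤n → trans (keepArray φ₆ 8 · refl)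
          (trans (keepArray φ₅ 8 · refl) (trans (keepArray φ₄ 8 · refl)
                   (trans (keepArray φ₃ 8 · refl) (trans (keepArray φ₂ 8 · refl)
                       (trans (rows i≤n) (∑-const i n))))))
      ; unit   = multiple (arrays σ₆ 9) z₉′ (trans (keepArray φ₆ 9 · refl) e₅)
      ; charge = multiple (arrays σ₆ 10) z₁₀′ e₁₀
      ; worst  = trans (keepReg φ₆ 9) (trans (keepReg φ₅ 9) (trans (keepReg φ₄ 9) e₃))
      })

  module Match (a : ℕ → ℕ → ℕ) (irreflexive : ∀ {u} → u < n → a u u ≡ 0) (χ : ℕ → ℕ)
    (χ-covers : ∀ {u v} → u < n → v < n → a u v ≢ 0 → 1 ≤ χ u + χ v) where

    open Matching n χ public

    Hit : (ℕ → ℕ) → ℕ → ℕ → Set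
    Hit D u v = a u v ≢ 0 → D u + D v ≢ 0

    Hit-mono : ∀ {D D′ u v} → (∀ w → D w ≤ D′ w) → Hit D u v → Hit D′ u v
    Hit-mono {D} {D′} {u} {v} le hit e z = hit e (n≤0⇒n≡0 (≤-trans (+-mono-≤ (le u) (le v)) (≤-reflexive z)))

    set-grows : ∀ {D u} → D u ≡ 0 → ∀ w → D w ≤ update D u 1 w
    set-grows {D} {u} e w with w ≟ u
    ... | yes refl rewrite e = z≤n
    ... | no w≢u = ≤-reflexive (sym (update-other D 1 w≢u))

    -- The pairs are scanned row by row. Pairs that are done stay hit because the cover only grows.
    record Progress (D : ℕ → ℕ) (i j : ℕ) : Set where
      field
        fair  : HalfCovered D
        above : ∀ {u v} → u < i → v < n → Hit D u v
        left  : ∀ {v} → v < j → Hit D i v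

    open Progress

    pass : ∀ {D i j} → Hit D i j → Progress D i j → Progress D i (suc j)
    pass {D} {i} {j} hit pr = record { fair = fair pr ; above = above pr
      ; left = λ {v} v<1+j → cases (m≤n⇒m<n∨m≡n (s≤s⁻¹ v<1+j)) }
      where
      cases : ∀ {v} → v < j ⊎ v ≡ j → Hit D i v
      cases (inj₁ v<j)  = left pr v<j
      cases (inj₂ refl) = hit

    take : ∀ {D i j} → i < n → j < n → a i j ≢ 0 → D i + D j ≡ 0 → Progress D i j →
      Progress (update (update D i 1) j 1) i (suc j)
    take {D} {i} {j} i<n j<n e z pr = pass (λ _ → new) (record
      { fair  = match i<n j<n i≢j Di Dj (χ-covers i<n j<n e) (fair pr)
      ; above = λ u< v< → Hit-mono grows (above pr u< v<)
      ; left  = λ v< → Hit-mono grows (left pr v<) })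
      where
      i≢j : i ≢ j
      i≢j refl = e (irreflexive i<n)
      Di : D i ≡ 0
      Di = m+n≡0⇒m≡0 (D i) z
      Dj : D j ≡ 0
      Dj = m+n≡0⇒n≡0 (D i) z
      grows : ∀ w → D w ≤ update (update D i 1) j 1 w
      grows w = ≤-trans (set-grows Di w) (set-grows (trans (update-other D 1 (≢-sym i≢j)) Dj) w)
      new : update (update D i 1) j 1 i + update (update D i 1) j 1 j ≢ 0
      new w = contradiction (trans (sym (update-same (update D i 1) j 1))
          (m+n≡0⇒n≡0 (update (update D i 1) j 1 i) w)) λ ()

    matchingR : ∀ {σ} → regs σ 0 ≡ n → (∀ {u v} → u < n → v < n → arrays σ 0 (arrays σ 8 u + v) ≡ a u v) →
      (∀ v → arrays σ 2 v ≡ 0) →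
      Halts matching σ 16 (λ τ → HalfCovered (arrays τ 2) × (∀ {u v} → u < n → v < n → Hit (arrays τ 2) u v))
    matchingR {σ} r₀ edge D0 = mapR (λ τ φ pr → fair pr , above pr)
      (forR {e = 11} 1 n (λ i τ → Progress (arrays τ 2) i 0) n≤ r₀
        (record { fair = record { bits = λ v → ≤-trans (≤-reflexive (D0 v)) z≤n ; half = ≤-trans
            (≤-reflexive (∑-zero n λ {v} _ → D0 v)) z≤n }
                ; above = λ () ; left = λ () })
        λ i τ i<n φ ri pr → mapR {d = 11} (λ υ ψ done → record
            { fair = fair done ; left = λ ()
            ; above = λ {u} {v} u<1+i v<n → merge done v<n (m≤n⇒m<n∨m≡n (s≤s⁻¹ u<1+i)) })
          (forR {e = 6} 1 n (λ j υ → Progress (arrays υ 2) i j) n≤ (trans (keepReg φ 0) r₀) pr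
            λ j υ j<n ψ rj pr′ →
              let ru = trans (keepReg ψ 10) ri
                  e₀ = trans (keepArray ψ 0) (keepArray φ 0)
                  e₈ = trans (keepArray ψ 8) (keepArray φ 8)
                  uv = trans (e₀ · cong₂ _+_ (e₈ · ru) rj) (edge i<n j<n) in
              whenR
                (λ ne → storeR {Q = λ ω → arrays ω 2 ≡ update (arrays υ 2) i 1}
                    (cong (λ k → update (arrays υ 2) k 1) ru)
                  then λ ω χ e → storeR (subst₂ (λ f k → Progress (update f k 1) i (suc j)) (sym e)
                      (sym (trans (keepReg χ 11) rj))
                    (take i<n j<n (λ z → conj≢0ˡ {y = 1 ∸ (arrays υ 2 (regs υ 10) + arrays υ 2 (regs υ 11))}
                        ne (trans uv z))
                      (subst₂ (λ k l → arrays υ 2 k + arrays υ 2 l ≡ 0) ru rj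
                          (free (conj≢0ʳ {arrays υ 0 (arrays υ 8 (regs υ 10) + regs υ 11)} ne))) pr′)))
                (λ z → skipR 5 (pass (λ e D0′ → contradiction
                    (trans (sym (conj-one {x = arrays υ 0 (arrays υ 8 (regs υ 10) + regs υ 11)}
                        {y = 1 ∸ (arrays υ 2 (regs υ 10) + arrays υ 2 (regs υ 11))} (λ w → e (trans (sym uv) w))
                        (λ w → contradiction (trans (sym
                            (cong (1 ∸_) (trans (cong₂ (λ k l → arrays υ 2 k + arrays υ 2 l) ru rj) D0′))) w)
                                λ ()))) z) λ ()) pr′))))
      where
      free : ∀ {y} → 1 ∸ y ≢ 0 → y ≡ 0
      free {zero}  _ = refl
      free {suc y} h = contradiction (0∸n≡0 y) h
      merge : ∀ {D i u v} → Progress D i n → v < n → u < i ⊎ u ≡ i → Hit D u v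
      merge done v<n (inj₁ u<i)  = above done u<i v<n
      merge done v<n (inj₂ refl) = left done v<n

  module SlotTable (c : ℕ) (c≤n : c ≤ n) where

    Filled : (ℕ → ℕ) → ℕ → Set
    Filled f i = ∀ {k s} → k < i → s < c → f (k * c + s) ≡ k

    slotTableR : ∀ {σ} → regs σ 0 ≡ n → regs σ 1 ≡ c → regs σ 3 ≡ 0 → regs σ 5 ≡ 0 → (∀ v → arrays σ 2 v ≤ 1) →
      let d = ∑ n (arrays σ 2) ; L = d + d + d in
      Halts slotTable σ 21 (λ τ → regs τ 3 ≡ L × regs τ 4 ≡ L + n × regs τ 5 ≡ (L + n) * c × Filled
          (arrays τ 6) (L + n))
    slotTableR {σ} r₀ r₁ r₃ r₅ bits =
      weak (sumR {k = 4} 1 n (λ v → D v + D v + D v) n≤ r₀ (λ v τ v<n φ rv →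
        cong₂ _+_ (cong₂ _+_ (keepArray φ 2 · rv) (keepArray φ 2 · rv)) (keepArray φ 2 · rv))) then λ σ₁ φ₁ e₁ →
      let e₃ = trans e₁ (cong₂ _+_ r₃ (trans (∑-+ n (λ v → D v + D v) D) (cong (_+ d) (∑-+ n D D)))) in
      setR (L + n) (cong₂ _+_ e₃ (trans (keepReg φ₁ 0) r₀)) then λ σ₂ φ₂ e₄ →
      mapR {d = 18} (λ τ φ (r₅ , filled) → trans (keepReg φ 3) (trans (keepReg φ₂ 3) e₃) , trans (keepReg φ 4)
          e₄ , r₅ , filled)
        (forR {e = 11} 3 (L + n) (λ i τ → regs τ 5 ≡ i * c × Filled (arrays τ 6) i) M≤ e₄
          (trans (keepReg φ₂ 5) (trans (keepReg φ₁ 5) r₅) , λ ())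
          λ i τ i<M φ ri (at , filled) → mapR {d = 8} (λ υ ψ (at′ , filled′ , row) →
              trans at′ (+-comm (i * c) c) , λ k<1+i s<c → merge {arrays υ 6} filled′ row s<c
                  (m≤n⇒m<n∨m≡n (s≤s⁻¹ k<1+i)))
            (forR {e = 3} 1 c (λ j υ → regs υ 5 ≡ i * c + j × Filled (arrays υ 6) i ×
                (∀ {s} → s < j → arrays υ 6 (i * c + s) ≡ i))
              (≤-trans c≤n n≤) (trans (keepReg φ 1) (trans (keepReg φ₂ 1) (trans (keepReg φ₁ 1) r₁)))
              (trans at (sym (+-identityʳ (i * c))) , filled , λ ())
              λ j υ j<c ψ rj (at′ , filled′ , row) →
                storeR {Q = λ ω → arrays ω 6 ≡ update (arrays υ 6) (i * c + j) i}
                    (cong₂ (update (arrays υ 6)) at′ (trans (keepReg ψ 10) ri))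
                then λ ω χ e → assignR
                  ( trans (cong (_+ 1) (trans (keepReg χ 5) at′))
                      (trans (+-assoc (i * c) j 1) (cong (i * c +_) (+-comm j 1)))
                  , (λ {k} {s} k<i s<c → trans (e · refl)
                      (trans (update-other (arrays υ 6) i (<⇒≢ (≤-trans (before k<i s<c) (m≤m+n (i * c) j))))
                          (filled′ k<i s<c)))
                  , λ {s} s<1+j → trans (e · refl) (extend i j (arrays υ 6) row (m≤n⇒m<n∨m≡n (s≤s⁻¹ s<1+j))) )))
      where
      D = arrays σ 2
      d = ∑ n D
      L = d + d + d
      before : ∀ {k i s} → k < i → s < c → k * c + s < i * c
      before {k} {i} {s} k<i s<c = ≤-trans (+-monoʳ-< (k * c) s<c)
          (≤-trans (≤-reflexive (+-comm (k * c) c)) (*-monoˡ-≤ c k<i))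
      extend : ∀ i j f → (∀ {s} → s < j → f (i * c + s) ≡ i) → ∀ {s} → s < j ⊎ s ≡ j → update f (i * c + j) i
          (i * c + s) ≡ i
      extend i j f row (inj₁ s<j)  = trans (update-other f i λ e → <⇒≢ s<j (+-cancelˡ-≡ (i * c) _ _ e)) (row s<j)
      extend i j f row (inj₂ refl) = update-same f (i * c + j) i
      merge : ∀ {f i k s} → Filled f i → (∀ {s} → s < c → f (i * c + s) ≡ i) → s < c → k < i ⊎ k ≡ i → f
          (k * c + s) ≡ k
      merge filled row s<c (inj₁ k<i)  = filled k<i s<c
      merge filled row s<c (inj₂ refl) = row s<c
      M≤ : L + n ≤ x ^ 3
      M≤ = buckets≤ (≤-trans (∑-≤const n λ {v} _ → bits v) (≤-reflexive (*-identityʳ n)))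

-- Graphs and arrangements as numerical functions

extend : ∀ {n} → (Fin n → ℕ) → ℕ → ℕ
extend {n} g v with v <? n
... | yes v<n = g (fromℕ< v<n)
... | no  _   = 0

extend-< : ∀ {n} (g : Fin n → ℕ) {v} (v<n : v < n) → extend g v ≡ g (fromℕ< v<n)
extend-< {n} g {v} v<n with v <? n
... | yes p  = cong (λ q → g (fromℕ< q)) (<-irrelevant p v<n)
... | no ¬p  = contradiction v<n ¬p

extend-toℕ : ∀ {n} (g : Fin n → ℕ) v → extend g (toℕ v) ≡ g v
extend-toℕ g v = trans (extend-< g (toℕ<n v)) (cong g (fromℕ<-toℕ v (toℕ<n v)))

extend-≮ : ∀ {n} (g : Fin n → ℕ) {v} → ¬ v < n → extend g v ≡ 0
extend-≮ {n} g {v} ¬p with v <? n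
... | yes p = contradiction p ¬p
... | no _  = refl

bit : ∀ {P : Set} → Dec P → ℕ
bit d = if does d then 1 else 0

bit-yes : ∀ {P : Set} (d : Dec P) → P → bit d ≡ 1
bit-yes (yes _) _ = refl
bit-yes (no ¬p) p = contradiction p ¬p

bit-no : ∀ {P : Set} (d : Dec P) → ¬ P → bit d ≡ 0
bit-no (yes p) ¬p = contradiction p ¬p
bit-no (no _)  _  = refl

tally : ∀ {A : Set} → (A → ℕ) → List A → ℕ
tally w []       = 0
tally w (x ∷ xs) = w x + tally w xs

tally-++ : ∀ {A : Set} (w : A → ℕ) xs ys → tally w (xs ++ ys) ≡ tally w xs + tally w ys
tally-++ w []       ys = refl
tally-++ w (x ∷ xs) ys = trans (cong (w x +_) (tally-++ w xs ys)) (sym (+-assoc (w x) _ _))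

tally-tabulate : ∀ {A : Set} (w : A → ℕ) {n} (h : Fin n → A) f → (∀ i → f (toℕ i) ≡ w (h i)) →
  tally w (tabulate h) ≡ ∑ n f
tally-tabulate w {zero}  h f e = refl
tally-tabulate w {suc n} h f e = trans
  (cong₂ _+_ (sym (e Fin.zero)) (tally-tabulate w (h ∘ Fin.suc) (f ∘ suc) (e ∘ Fin.suc)))
  (sym (∑-head n f))

length-filter : ∀ {A : Set} {P : A → Set} (P? : ∀ x → Dec (P x)) xs →
  length (filter P? xs) ≡ tally (λ x → bit (P? x)) xs
length-filter P? [] = refl
length-filter P? (x ∷ xs) with does (P? x)
... | true  = cong suc (length-filter P? xs)
... | false = length-filter P? xs

tally-filter : ∀ {A : Set} {P : A → Set} (w : A → ℕ) (P? : ∀ x → Dec (P x)) xs →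
  tally w (filter P? xs) ≡ tally (λ x → if does (P? x) then w x else 0) xs
tally-filter w P? [] = refl
tally-filter w P? (x ∷ xs) with does (P? x)
... | true  = cong (w x +_) (tally-filter w P? xs)
... | false = tally-filter w P? xs

tally-product : ∀ {A : Set} (w : A × A → ℕ) {m n} (g : Fin m → A) (h : Fin n → A) (f : ℕ → ℕ → ℕ) →
  (∀ i j → f (toℕ i) (toℕ j) ≡ w (g i , h j)) →
  tally w (cartesianProduct (tabulate g) (tabulate h)) ≡ ∑ m λ u → ∑ n (f u)
tally-product w {zero}  {n} g h f e = refl
tally-product w {suc m} {n} g h f e = trans (tally-++ w (map (g Fin.zero ,_) (tabulate h)) _)
  (trans (cong₂ _+_
      (trans (cong (tally w) (map-tabulate h (g Fin.zero ,_)))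
          (tally-tabulate w (λ j → g Fin.zero , h j) (f 0) (e Fin.zero)))
      (tally-product w (g ∘ Fin.suc) h (f ∘ suc) (e ∘ Fin.suc)))
    (sym (∑-head m (λ u → ∑ n (f u)))))

differ≡∣-∣ : ∀ i j → differ i j ≡ ∣ i - j ∣
differ≡∣-∣ i j with ≤-total i j
... | inj₁ i≤j = trans (differ-≤ i≤j) (sym (m≤n⇒∣m-n∣≡n∸m i≤j))
... | inj₂ j≤i = trans (differ-comm i j) (trans (differ-≤ j≤i) (trans (sym (m≤n⇒∣m-n∣≡n∸m j≤i)) (∣-∣-comm j i)))

short-far : ∀ {i j} → ∣ i - j ∣ < 2 → far i j ≡ 0
short-far {i} {j} short = m≤n⇒m∸n≡0 (≤-trans (≤-reflexive (differ≡∣-∣ i j)) (s≤s⁻¹ short))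

long-far : ∀ {i j} → ¬ ∣ i - j ∣ < 2 → far i j ≢ 0
long-far {i} {j} long e = long (s≤s (≤-trans (≤-reflexive (sym (differ≡∣-∣ i j))) (m∸n≡0⇒m≤n e)))

module Adjacency {n : ℕ} (G : Graph n) where

  edgeBit : ℕ → ℕ → ℕ
  edgeBit u v = extend (λ i → extend (λ j → if adj G i j then 1 else 0) v) u

  edgeBit-toℕ : ∀ i j → edgeBit (toℕ i) (toℕ j) ≡ (if adj G i j then 1 else 0)
  edgeBit-toℕ i j = trans (extend-toℕ _ i) (extend-toℕ (λ j → if adj G i j then 1 else 0) j)

  private
    bits : Fin n → Fin n → ℕ
    bits i j = if adj G i j then 1 else 0

    inside : ∀ {u v} (p : u < n) (q : v < n) → edgeBit u v ≡ bits (fromℕ< p) (fromℕ< q)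
    inside {v = v} p q = trans (extend-< (λ i → extend (bits i) v) p) (extend-< (bits (fromℕ< p)) q)

    outsideˡ : ∀ {u} v → ¬ u < n → edgeBit u v ≡ 0
    outsideˡ v ¬p = extend-≮ (λ i → extend (bits i) v) ¬p

    outsideʳ : ∀ u {v} → ¬ v < n → edgeBit u v ≡ 0
    outsideʳ u {v} ¬q = go (u <? n)
      where
      go : Dec (u < n) → edgeBit u v ≡ 0
      go (yes p) = trans (extend-< (λ i → extend (bits i) v) p) (extend-≮ (bits (fromℕ< p)) ¬q)
      go (no ¬p) = outsideˡ v ¬p

  edgeBit-sym : ∀ u v → edgeBit u v ≡ edgeBit v u
  edgeBit-sym u v = go (u <? n) (v <? n)
    where
    go : Dec (u < n) → Dec (v < n) → edgeBit u v ≡ edgeBit v u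
    go (yes p) (yes q) = trans (inside p q)
      (trans (cong (λ b → if b then 1 else 0) (Graph.sym G (fromℕ< p) (fromℕ< q))) (sym (inside q p)))
    go (no ¬p) _       = trans (outsideˡ v ¬p) (sym (outsideʳ v ¬p))
    go (yes _) (no ¬q) = trans (outsideʳ u ¬q) (sym (outsideˡ u ¬q))

  edgeBit-irrefl : ∀ {u} → u < n → edgeBit u u ≡ 0
  edgeBit-irrefl p = trans (inside p p) (cong (λ b → if b then 1 else 0) (Graph.irrefl G (fromℕ< p)))

  edgeBit-adj : ∀ {u v} (p : u < n) (q : v < n) → edgeBit u v ≢ 0 → T (adj G (fromℕ< p) (fromℕ< q))
  edgeBit-adj p q ne with adj G (fromℕ< p) (fromℕ< q) | inside p q
  ... | true  | _ = _
  ... | false | e = ne e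

  adjacency-cell : ∀ {u v} → u < n → v < n → adjacencyArray G (u * n + v) ≡ edgeBit u v
  adjacency-cell {u} {v} p q with u * n + v <? n * n
  ... | no out = contradiction bound out
    where
    bound : u * n + v < n * n
    bound = ≤-trans (+-monoʳ-< (u * n) q) (≤-trans (≤-reflexive (+-comm (u * n) n)) (*-monoˡ-≤ n p))
  ... | yes r = trans (cong (λ z → if uncurry (adj G) z then 1 else 0)
                        (trans (cong (remQuot {n} n) same) (remQuot-combine (fromℕ< p) (fromℕ< q))))
                            (sym (inside p q))
    where
    same : fromℕ< r ≡ combine (fromℕ< p) (fromℕ< q)
    same = toℕ-injective (trans (toℕ-fromℕ< r) (sym (trans (toℕ-combine (fromℕ< p) (fromℕ< q))
      (cong₂ _+_ (trans (*-comm n _) (cong (_* n) (toℕ-fromℕ< p))) (toℕ-fromℕ< q)))))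

  index : Arrangement n → ℕ → ℕ
  index A = extend (toℕ ∘ bucket A)

  private
    forward : (ℕ → ℕ) → ℕ → ℕ → ℕ
    forward f u v = if does (u <? v) then conj (edgeBit u v) (far (f u) (f v)) else 0

    -- By symmetry each unordered pair occurs in both orders with the same value, and by
    -- irreflexivity the diagonal contributes nothing.
    Λ-forward : ∀ f → Λ n edgeBit f ≡ ∑ n (λ u → ∑ n (forward f u)) + ∑ n (λ u → ∑ n (forward f u))
    Λ-forward f = trans
      (∑-cong n λ {u} u<n → trans (∑-cong n λ {v} v<n → split u<n v<n) (∑-+ n (forward f u) (λ v → forward f v u)))
      (trans (∑-+ n _ _) (cong (∑ n (λ u → ∑ n (forward f u)) +_) (∑-swap n n λ u v → forward f v u)))
      where
      t : ℕ → ℕ → ℕ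
      t u v = conj (edgeBit u v) (far (f u) (f v))
      t-comm : ∀ u v → t u v ≡ t v u
      t-comm u v = cong₂ conj (edgeBit-sym u v) (far-comm (f u) (f v))
      on : ∀ {u v} → u < v → forward f u v ≡ t u v
      on {u} {v} u<v = cong (λ b → if b then t u v else 0) (dec-true (u <? v) u<v)
      off : ∀ {u v} → ¬ u < v → forward f u v ≡ 0
      off {u} {v} ¬p = cong (λ b → if b then t u v else 0) (dec-false (u <? v) ¬p)
      split : ∀ {u v} → u < n → v < n → t u v ≡ forward f u v + forward f v u
      split {u} {v} u<n v<n with <-cmp u v
      ... | tri< u<v _ ¬v<u = trans (sym (+-identityʳ _)) (sym (cong₂ _+_ (on u<v) (off ¬v<u)))
      ... | tri> ¬u<v _ v<u = trans (t-comm u v) (sym (cong₂ _+_ (off ¬u<v) (on v<u)))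
      ... | tri≈ ¬u<u refl _ = trans (conj-zeroˡ (far (f u) (f u)) (edgeBit-irrefl u<n))
          (sym (cong₂ _+_ (off ¬u<u) (off ¬u<u)))

    longEdges-forward : ∀ A → longEdges G A ≡ ∑ n λ u → ∑ n (forward (index A) u)
    longEdges-forward A = trans (length-filter (long? A) (edges G))
      (trans (tally-filter _ edge? (cartesianProduct (allFin n) (allFin n)))
        (tally-product _ id id (forward (index A)) λ i j → sym (entry i j)))
      where
      edge? : (e : Fin n × Fin n) → Dec (proj₁ e Fin.< proj₂ e × T (adj G (proj₁ e) (proj₂ e)))
      edge? = λ (u , v) → u Fin.<? v ×-dec T? (adj G u v)
      entry : ∀ i j → (if does (edge? (i , j)) then bit (long? A (i , j)) else 0) ≡ forward (index A) (toℕ i)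
          (toℕ j)
      entry i j rewrite edgeBit-toℕ i j | extend-toℕ (toℕ ∘ bucket A) i | extend-toℕ (toℕ ∘ bucket A) j
        with toℕ i <ᵇ toℕ j | adj G i j
      ... | false | _     = refl
      ... | true  | false = sym (conj-zeroˡ (far (toℕ (bucket A i)) (toℕ (bucket A j))) refl)
      ... | true  | true  = go (∣ x - y ∣ <? 2)
        where
        x y : ℕ
        x = toℕ (bucket A i)
        y = toℕ (bucket A j)
        go : Dec (∣ x - y ∣ < 2) → bit (long? A (i , j)) ≡ conj 1 (far x y)
        go (yes short) = trans (bit-no (long? A (i , j)) (λ l → l short))
            (sym (conj-zeroʳ 1 (short-far {x} {y} short)))
        go (no long)   = trans (bit-yes (long? A (i , j)) long) (sym (conj-one {1} (λ ()) (long-far {x} {y} long)))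

  Λ-longEdges : ∀ A → Λ n edgeBit (index A) ≡ longEdges G A + longEdges G A
  Λ-longEdges A = trans (Λ-forward (index A)) (sym (cong₂ _+_ (longEdges-forward A) (longEdges-forward A)))

bucketSize-index : ∀ {n} (A : Arrangement n) i →
  bucketSize A i ≡ ∑ n (λ v → δ (extend (toℕ ∘ bucket A) v) (toℕ i))
bucketSize-index {n} A i = trans (length-filter (λ v → bucket A v Fin.≟ i) (allFin n))
  (tally-tabulate _ id _ λ v → trans (cong (λ k → δ k (toℕ i)) (extend-toℕ (toℕ ∘ bucket A) v)) (entry v))
  where
  entry : ∀ v → δ (toℕ (bucket A v)) (toℕ i) ≡ bit (bucket A v Fin.≟ i)
  entry v with bucket A v Fin.≟ i
  ... | yes e = δ-yes (cong toℕ e)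
  ... | no ne = δ-no λ e → ne (toℕ-injective e)

width⇒Fits : ∀ {n c} (A : Arrangement n) → width A ≤ c → Fits n c (extend (toℕ ∘ bucket A))
width⇒Fits {n} {c} A w i with i <? k A
... | yes i<k = subst (λ j → ∑ n (λ v → δ (extend (toℕ ∘ bucket A) v) j) ≤ c) (toℕ-fromℕ< i<k)
      (≤-trans (≤-reflexive (sym (bucketSize-index A (fromℕ< i<k))))
        (≤-trans (All.lookup (xs≤max 0 (map (bucketSize A) (allFin (k A))))
            (∈-map⁺ (bucketSize A) (∈-allFin (fromℕ< i<k)))) w))
... | no i≮k = ≤-trans (≤-reflexive (∑-zero n λ {v} v<n → δ-no λ e → i≮k
      (subst (_< k A) (trans (sym (extend-< (toℕ ∘ bucket A) v<n)) e) (toℕ<n (bucket A (fromℕ< v<n)))))) z≤n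

Fits⇒width : ∀ {n c} (A : Arrangement n) → Fits n c (extend (toℕ ∘ bucket A)) → width A ≤ c
Fits⇒width {n} {c} A fits = max≤v⁺ {xs = map (bucketSize A) (allFin (k A))} z≤n
  (All.map⁺ (All.universal (λ i → ≤-trans (≤-reflexive (bucketSize-index A i)) (fits (toℕ i))) (allFin (k A))))

indicator : ∀ {n} → Subset n → Fin n → ℕ
indicator C i = if lookup C i then 1 else 0

∑-indicator : ∀ {n} (C : Subset n) → ∑ n (extend (indicator C)) ≡ ∣ C ∣
∑-indicator {n} C = trans (sym (tally-tabulate (indicator C) id _ (extend-toℕ (indicator C)))) (tally-indicator C)
  where
  tally-count : ∀ {m n} (C : Subset n) (g : Fin m → ℕ) (h : Fin n → Fin m) → (∀ i → g (h i) ≡ indicator C i) →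
    tally g (tabulate h) ≡ ∣ C ∣
  tally-count [] g h e = refl
  tally-count (true  ∷ C) g h e = cong₂ _+_ (e Fin.zero) (tally-count C g (h ∘ Fin.suc) (e ∘ Fin.suc))
  tally-count (false ∷ C) g h e = cong₂ _+_ (e Fin.zero) (tally-count C g (h ∘ Fin.suc) (e ∘ Fin.suc))
  tally-indicator : ∀ {n} (C : Subset n) → tally (indicator C) (tabulate id) ≡ ∣ C ∣
  tally-indicator C = tally-count C (indicator C) id λ _ → refl

indicator-∈ : ∀ {n} {C : Subset n} {i} → i ∈ C → indicator C i ≡ 1
indicator-∈ i∈C = cong (λ b → if b then 1 else 0) ([]=⇒lookup i∈C)

record Occupancy (n : ℕ) (f occ : ℕ → ℕ) : Set where
  field
    bits  : ∀ i → occ i ≤ 1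
    full  : ∀ {v} → v < n → occ (f v) ≡ 1
    only  : ∀ {i} → occ i ≢ 0 → ∃[ v ] v < n × f v ≡ i

-- Closing up empty buckets in the output

module OutputPhase (x : ℕ) (2≤x : 2 ≤ x) (n : ℕ) (n<x : n < x) where

  open Loops x 2≤x
  open Poly x 2≤x

  n≤ : n ≤ x ^ 1
  n≤ = linear≤ n<x

  Written : ℕ → (ℕ → ℕ) → State → Set
  Written M f τ = ∃[ occ ] Occupancy n f occ × regs τ 0 ≡ ∑ M occ × (∀ {v} → v < n → arrays τ 1 v ≡ ∑ (f v) occ)

  outputR : ∀ {σ M} → regs σ 0 ≡ n → regs σ 4 ≡ M → M ≤ x ^ 3 → (∀ {v} → v < n → arrays σ 7 v < M) →
    (∀ i → arrays σ 12 i ≡ 0) → arrays σ 13 0 ≡ 0 →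
    Halts output σ 15 (Written M (arrays σ 7))
  outputR {σ} {M} r₀ r₄ M≤ f< occ0 rank0 =
    weak (forR {e = 3} 1 n (λ i τ → Occupancy i f (arrays τ 12)) n≤ r₀
      (record { bits = λ i → ≤-trans (≤-reflexive (occ0 i)) z≤n ; full = λ () ; only = λ {i} ne →
          contradiction (occ0 i) ne })
      λ v τ v<n φ rv occ → storeR (subst (λ k → Occupancy (suc v) f (update (arrays τ 12) k 1))
          (sym (keepArray φ 7 · rv)) (mark occ)))
    then λ σ₁ φ₁ occ →
    weak (prefixR {k = 4} 3 M (arrays σ₁ 12) M≤ (trans (keepReg φ₁ 4) r₄) (trans (keepArray φ₁ 13 · refl) rank0)
      λ i τ i<M φ ri → keepArray φ 12 · ri)
    then λ σ₂ φ₂ ranks →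
    let r₀′ = trans (keepReg φ₂ 0) (trans (keepReg φ₁ 0) r₀) in
    weak (fillR {k = 3} 1 n (λ v → ∑ (f v) (arrays σ₁ 12)) n≤ r₀′ λ v τ v<n φ rv →
      trans (keepArray φ 13 · (trans (keepArray φ 7) (trans (keepArray φ₂ 7) (keepArray φ₁ 7)) · rv))
          (ranks (<⇒≤ (f< v<n))))
    then λ σ₃ φ₃ written →
    assignR (arrays σ₁ 12 , occ ,
      trans (keepArray φ₃ 13 · trans (keepReg φ₃ 4) (trans (keepReg φ₂ 4) (trans (keepReg φ₁ 4) r₄)))
          (ranks ≤-refl) , written)
    where
    f = arrays σ 7
    mark : ∀ {v occ} → Occupancy v f occ → Occupancy (suc v) f (update occ (f v) 1)
    mark {v} {occ} o = record { bits = bits′ ; full = full′ ; only = only′ }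
      where
      open Occupancy o
      bits′ : ∀ i → update occ (f v) 1 i ≤ 1
      bits′ i with i ≟ f v
      ... | yes refl = ≤-reflexive (update-same occ (f v) 1)
      ... | no ne = ≤-trans (≤-reflexive (update-other occ 1 ne)) (bits i)
      full′ : ∀ {u} → u < suc v → update occ (f v) 1 (f u) ≡ 1
      full′ {u} u<1+v with f u ≟ f v | m≤n⇒m<n∨m≡n (s≤s⁻¹ u<1+v)
      ... | yes e | _ = trans (cong (update occ (f v) 1) e) (update-same occ (f v) 1)
      ... | no ne | inj₁ u<v  = trans (update-other occ 1 ne) (full u<v)
      ... | no ne | inj₂ refl = contradiction refl ne
      only′ : ∀ {i} → update occ (f v) 1 i ≢ 0 → ∃[ u ] u < suc v × f u ≡ i
      only′ {i} h with i ≟ f v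
      ... | yes refl = v , ≤-refl , refl
      ... | no ne with only (λ z → h (trans (update-other occ 1 ne) z))
      ...   | u , u<v , e = u , m<n⇒m<1+n u<v , e

-- A discrete intermediate value argument: prefix sums of bits rise by at most 1, so every value
-- below the total is left behind at some occupied index. This provides the surjectivity demanded of
-- an `Arrangement`.
rank-onto : ∀ {occ} → (∀ i → occ i ≤ 1) → ∀ m {r} → r < ∑ m occ → ∃[ i ] i < m × occ i ≢ 0 × ∑ i occ ≡ r
rank-onto {occ} bits (suc m) {r} r< with r <? ∑ m occ
... | yes r<′ with rank-onto bits m r<′
...   | i , i<m , ne , e = i , m<n⇒m<1+n i<m , ne , e
rank-onto {occ} bits (suc m) {r} r< | no r≮ = m , ≤-refl , occupied , ≤-antisym (≮⇒≥ r≮)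
    (s≤s⁻¹ (≤-trans r< (≤-trans (+-monoʳ-≤ (∑ m occ) (bits m)) (≤-reflexive (+-comm (∑ m occ) 1)))))
  where
  occupied : occ m ≢ 0
  occupied z = r≮ (≤-trans r< (≤-reflexive (trans (cong (∑ m occ +_) z) (+-identityʳ _))))

module Result {n M : ℕ} {f occ : ℕ → ℕ} (o : Occupancy n f occ) (f< : ∀ {v} → v < n → f v < M) where

  open Occupancy o
  open Rank occ bits

  full≢0 : ∀ {v} → v < n → occ (f v) ≢ 0
  full≢0 v<n z = contradiction (trans (sym (full v<n)) z) λ ()

  rank<k : ∀ (v : Fin n) → rank (f (toℕ v)) < ∑ M occ
  rank<k v = rank-< (full≢0 (toℕ<n v)) (f< (toℕ<n v))

  compressed : Arrangement n
  compressed = record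
    { k        = ∑ M occ
    ; bucket   = λ v → fromℕ< (rank<k v)
    ; nonempty = onto
    }
    where
    onto : ∀ (y : Fin (∑ M occ)) → ∃[ v ] fromℕ< (rank<k v) ≡ y
    onto y with rank-onto bits M (toℕ<n y)
    ... | i , i<M , ne , e with only ne
    ...   | v , v<n , refl = fromℕ< v<n , toℕ-injective (trans (toℕ-fromℕ< (rank<k (fromℕ< v<n)))
            (trans (cong (rank ∘ f) (toℕ-fromℕ< v<n)) e))

  compressed-index : ∀ {v} → v < n → extend (toℕ ∘ bucket compressed) v ≡ rank (f v)
  compressed-index v<n = trans (extend-< (toℕ ∘ bucket compressed) v<n)
    (trans (toℕ-fromℕ< (rank<k (fromℕ< v<n))) (cong (rank ∘ f) (toℕ-fromℕ< v<n)))

  compressed-fits : ∀ {c} → Fits n c f → Fits n c (extend (toℕ ∘ bucket compressed))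
  compressed-fits = Fits-refine λ u<n v<n e → rank-injective (full≢0 u<n) (full≢0 v<n)
    (trans (sym (compressed-index u<n)) (trans e (compressed-index v<n)))

  compressed-Λ : ∀ a → Λ n a (extend (toℕ ∘ bucket compressed)) ≤ Λ n a f
  compressed-Λ a = ≤-trans (≤-reflexive (Λ-cong n a compressed-index))
    (∑-mono n λ {u} _ → ∑-mono n λ {v} _ → conj-monoʳ (a u v) (far-rank (f u) (f v)))

∸∸≡⊓ : ∀ m n → m ∸ (m ∸ n) ≡ m ⊓ n
∸∸≡⊓ m n with ≤-total m n
... | inj₁ m≤n = trans (cong (m ∸_) (m≤n⇒m∸n≡0 m≤n)) (sym (m≤n⇒m⊓n≡m m≤n))
... | inj₂ n≤m = trans (m∸[m∸n]≡n n≤m) (sym (m≥n⇒m⊓n≡n n≤m))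

Fits-⊓ : ∀ {n c f} → Fits n c f → Fits n (c ⊓ n) f
Fits-⊓ {n} {f = f} fits i = ⊓-glb (fits i)
    (≤-trans (∑-≤const n λ {v} _ → δ≤1 (f v) i) (≤-reflexive (*-identityʳ n)))

Fits-weaken : ∀ {n b c f} → b ≤ c → Fits n b f → Fits n c f
Fits-weaken b≤c fits i = ≤-trans (fits i) b≤c

-- The program stops at once in this case. If n is 0, the untouched register 0 already holds the
-- right number of buckets; if n is positive, the capacity is 0 and vertex 0 already contradicts the
-- assumed width.
no-capacity : ∀ {n} (G : Graph n) {c} → c ⊓ n ≡ 0 → (A : Arrangement n) → width A ≤ c →
  ∃[ A ] IsOptimal G c A × Outputs (setReg (input G c) 1 (c ∸ (c ∸ n))) A
no-capacity {zero} G e A w = A , (w , λ _ _ → z≤n) , no-buckets A , λ ()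
  where
  no-buckets : (A : Arrangement 0) → 0 ≡ k A
  no-buckets record { k = zero } = refl
  no-buckets record { k = suc _ ; nonempty = onto } with onto Fin.zero
  ... | () , _
no-capacity {suc n} G {c} e A w = contradiction
  (≤-trans (≤-trans (≤-reflexive (sym (δ-yes {f 0} refl)))
      (term≤∑ {suc n} {0} (λ v → δ (f v) (f 0)) (s≤s z≤n)))
          (≤-trans (Fits-⊓ {suc n} {f = f} (width⇒Fits A w) (f 0)) (≤-reflexive e))) λ ()
  where
  f = extend (toℕ ∘ bucket A)

eight-terms : ∀ {a b c d e f g h z} → a ≤ z → b ≤ z → c ≤ z → d ≤ z → e ≤ z → f ≤ z → g ≤ z → h ≤ z →
  a + (b + (c + (d + (e + (f + g + h))))) ≤ 2 ^ 3 * z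
eight-terms {z = z} a b c d e f g h = ≤-trans
  (+-mono-≤ a (+-mono-≤ b (+-mono-≤ c (+-mono-≤ d (+-mono-≤ e (+-mono-≤ (+-mono-≤ f g) h))))))
  (≤-reflexive (eight z))
  where
  eight : ∀ z → z + (z + (z + (z + (z + (z + z + z))))) ≡ 8 * z
  eight = solve-∀

-- The phases put together

module Solve (x : ℕ) (2≤x : 2 ≤ x) {n : ℕ} (n<x : n < x) (G : Graph n) (c₀ : ℕ) (C : Subset n)
  (C-covers : IsVertexCover G C) where

  open Adjacency G

  c : ℕ
  c = c₀ ∸ (c₀ ∸ n)

  open Poly x 2≤x

  c≤n : c ≤ n
  c≤n = ≤-trans (≤-reflexive (∸∸≡⊓ c₀ n)) (m⊓n≤n c₀ n)

  σ₁ : State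
  σ₁ = setReg (input G c₀) 1 c

  χ : ℕ → ℕ
  χ = extend (indicator C)

  χ-covers : ∀ {u v} → u < n → v < n → edgeBit u v ≢ 0 → 1 ≤ χ u + χ v
  χ-covers {u} {v} p q ne with C-covers (fromℕ< p) (fromℕ< q) (edgeBit-adj p q ne)
  ... | inj₁ i = ≤-trans (≤-reflexive (sym (trans (extend-< (indicator C) p) (indicator-∈ i)))) (m≤m+n (χ u) (χ v))
  ... | inj₂ i = ≤-trans (≤-reflexive (sym (trans (extend-< (indicator C) q) (indicator-∈ i)))) (m≤n+m (χ v) (χ u))

  cover-factor candidates : ℕ
  cover-factor = 2 ^ (8 * (∣ C ∣ * ⌈log₂ ∣ C ∣ ⌉))
  candidates = cover-factor * x ^ 6

  Solved : State → Set
  Solved τ = ∃[ A ] IsOptimal G c₀ A × Outputs τ A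

  open SetupPhase x 2≤x n n<x
  open Match edgeBit edgeBit-irrefl χ χ-covers
  open SlotTable c c≤n
  open OutputPhase x 2≤x n n<x using (Written; outputR)

  module Finish (c≢0 : c ≢ 0) (D : ℕ → ℕ) (half : HalfCovered D)
    (hits : ∀ {u v} → u < n → v < n → Hit D u v) (slot : ℕ → ℕ)
    (filled : Filled slot (∑ n D + ∑ n D + ∑ n D + n)) where

    d L M : ℕ
    d = ∑ n D
    L = d + d + d
    M = L + n

    M≤ : M ≤ x ^ 3
    M≤ = buckets≤ (≤-trans (∑-≤const n λ {v} _ → bits half v) (≤-reflexive (*-identityʳ n)))

    covers : ∀ {u v} → u < n → v < n → edgeBit u v ≢ 0 → D u ≢ 0 ⊎ D v ≢ 0
    covers {u} {v} p q e with D u ≟ 0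
    ... | no ne = inj₁ ne
    ... | yes z = inj₂ λ z′ → hits p q e (cong₂ _+_ z z′)

    n≤S : n ≤ M * c
    n≤S = ≤-trans (≤-reflexive (sym (*-identityʳ n))) (*-mono-≤ (m≤n+m n L) (n≢0⇒n>0 c≢0))

    L-positive : ∀ {v} → v < n → D v ≢ 0 → L ≢ 0
    L-positive v<n Dv z = Dv (∑≡0 D (m+n≡0⇒n≡0 (d + d) z) v<n)

    S≤ : M * c ≤ x ^ 5
    S≤ = ≤-trans (prod≤ 3 1 M≤ (≤-trans c≤n n≤)) (^-mono (≤ᵇ⇒≤ 4 5 _))

    open SearchPhase x 2≤x n c L edgeBit edgeBit-sym D (bits half) covers slot filled n≤S L-positive n<x S≤
      hiding (n≤) public
    open Numeral n L D

    radix≤ : radix n ≤ candidates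
    radix≤ = candidates-bound {d} {∣ C ∣} x 2≤x (≤-trans (half≤ half) (≤-reflexive (cong (2 *_) (∑-indicator C))))

    -- `f` itself may follow no guess, but its normal form does: restricted to the cover it stays
    -- below `L`, and its value is no larger.
    best≤ : ∀ {y} → Exhausted y → ∀ f → Fits n c f → y ≤ Λ n edgeBit f
    best≤ {y} ex f fits = ≤-trans (ex guess guess-valid normal normal< (normal-fits fits) agrees) normal-Λ
      where
      open Normalise n edgeBit edgeBit-sym D (bits half) covers f using
          (normal; normal<; normal-fits; normal-Λ; normal-cover)
      guess : ℕ → ℕ
      guess v with D v ≟ 0
      -- Outside the cover the digit has base 1, so 0 is its only valid value.
      ... | yes _ = 0
      ... | no _  = normal v
      guess-valid : Valid guess
      guess-valid {v} v<n with D v ≟ 0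
      ... | yes e rewrite e = s≤s z≤n
      ... | no ne rewrite ≤-antisym (bits half v) (n≢0⇒n>0 ne) =
        ≤-trans (normal-cover v<n ne) (≤-reflexive (sym (*-identityʳ L)))
      agrees : ∀ {v} → v < n → D v ≢ 0 → normal v ≡ guess v
      agrees {v} _ ne with D v ≟ 0
      ... | yes e = contradiction e ne
      ... | no _  = refl

    sound : ∀ {y f} → Incumbent y f → Exhausted y → Sound y f
    sound (inj₂ s) _ = s
    -- With positive capacity the arrangement that gives every vertex its own bucket is feasible, so
    -- the final value is at most n² and cannot be the initial mark.
    sound (inj₁ refl) ex = contradiction (≤-trans (best≤ ex id spread) (Λ≤ n edgeBit id)) (<⇒≱ ≤-refl)
      where
      spread : Fits n c id
      spread i = ≤-trans (count-injective n i λ _ _ e → e) (n≢0⇒n>0 c≢0)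

    solved : ∀ {y f τ} → Sound y f → Exhausted y → Written M f τ → Solved τ
    solved {y} {f} {τ} (f< , fits , Λf) ex (occ , o , r₀ , written) =
      compressed , (narrow , minimal) , r₀ ,
      λ v → trans (written (toℕ<n v)) (sym (toℕ-fromℕ< (rank<k v)))
      where
      open Result o f<
      open ≤-Reasoning
      narrow : width compressed ≤ c₀
      narrow = Fits⇒width compressed (Fits-weaken {n} {f = index compressed}
          (≤-trans (≤-reflexive (∸∸≡⊓ c₀ n)) (m⊓n≤m c₀ n)) (compressed-fits {c} fits))
      minimal : ∀ A′ → width A′ ≤ c₀ → longEdges G compressed ≤ longEdges G A′
      minimal A′ w = *-cancelˡ-≤ 2 (begin
        2 * longEdges G compressed                     ≡⟨ twice (longEdges G compressed) ⟩
        longEdges G compressed + longEdges G compressed ≡⟨ sym (Λ-longEdges compressed) ⟩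
        Λ n edgeBit (index compressed)                 ≤⟨ compressed-Λ edgeBit ⟩
        Λ n edgeBit f                                  ≡⟨ Λf ⟩
        y                                              ≤⟨ best≤ ex (index A′)
            (subst (λ b → Fits n b (index A′)) (sym (∸∸≡⊓ c₀ n)) (Fits-⊓ {f = index A′} (width⇒Fits A′ w))) ⟩
        Λ n edgeBit (index A′)                         ≡⟨ Λ-longEdges A′ ⟩
        longEdges G A′ + longEdges G A′                ≡⟨ sym (twice (longEdges G A′)) ⟩
        2 * longEdges G A′                             ∎)
        where
        twice : ∀ y → 2 * y ≡ y + y
        twice = solve-∀

    finishR : ∀ {σ} → Env σ → regs σ 4 ≡ M → (∀ v → arrays σ 3 v ≡ 0) → regs σ 7 ≡ 0 → regs σ 6 ≡ suc (n * n) →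
      (∀ i → arrays σ 12 i ≡ 0) → arrays σ 13 0 ≡ 0 →
      Runs (search ⨾ output) σ (4 + candidates * (4 + x ^ 46) + x ^ 15) Solved
    finishR {σ} ρ r₄ z₃ z₇ r₆ z₁₂ z₁₃ =
      seqRuns (weaken (+-monoʳ-≤ 4 (*-monoˡ-≤ (4 + x ^ 46) radix≤)) (λ _ _ q → q) (searchR ρ z₃ z₇ (inj₁ r₆)))
        λ τ φ (inc , ex) → let s = sound inc ex in
          weaken ≤-refl (λ υ ψ wr → solved {τ = υ} s ex wr)
            (run (outputR (trans (keepReg φ 0) (Env.order ρ)) (trans (keepReg φ 4) r₄) M≤ (proj₁ s)
              (λ i → trans (keepArray φ 12 · refl) (z₁₂ i)) (trans (keepArray φ 13 · refl) z₁₃)))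

  solveTime : ℕ
  solveTime = x ^ 16 + (x ^ 16 + (x ^ 21 + (4 + candidates * (4 + x ^ 46) + x ^ 15)))

  solveR : c ≢ 0 → Runs (constants ⨾ matching ⨾ slotTable ⨾ search ⨾ output) σ₁ solveTime Solved
  solveR c≢0 =
    seqRuns (run (constantsR {σ₁} refl refl refl refl refl)) λ τ₁ φ₁ consts →
    let open Constants consts in
    seqRuns (run (matchingR {τ₁} (keepReg φ₁ 0) (λ {u} {v} u<n v<n →
        trans (keepArray φ₁ 0 · cong (_+ v) (rows (<⇒≤ u<n))) (adjacency-cell u<n v<n))
        (λ v → keepArray φ₁ 2 · refl))) λ τ₂ φ₂ (half , hits) →
    seqRuns (run (slotTableR {τ₂} (trans (keepReg φ₂ 0) (keepReg φ₁ 0)) (trans (keepReg φ₂ 1) (keepReg φ₁ 1))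
        (trans (keepReg φ₂ 3) (keepReg φ₁ 3)) (trans (keepReg φ₂ 5) (keepReg φ₁ 5)) (bits half)))
    λ τ₃ φ₃ (r₃ , r₄ , r₅ , filled) →
    let module F = Finish c≢0 (arrays τ₂ 2) half hits (arrays τ₃ 6) filled in
    F.finishR {τ₃} (record
        { order    = trans (keepReg φ₃ 0) (trans (keepReg φ₂ 0) (keepReg φ₁ 0))
        ; range    = r₃
        ; slots    = r₅
        ; edge     = λ {u} {v} u<n v<n → trans
            (trans (keepArray φ₃ 0) (trans (keepArray φ₂ 0) (keepArray φ₁ 0)) ·
              cong (_+ v) (trans (trans (keepArray φ₃ 8) (keepArray φ₂ 8) · refl) (rows (<⇒≤ u<n))))
            (adjacency-cell u<n v<n)
        ; cover    = keepArray φ₃ 2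
        ; bucketOf = refl
        ; unit     = λ y≤1 → trans (trans (keepArray φ₃ 9) (keepArray φ₂ 9) · refl) (unit y≤1)
        ; charge   = λ y≤1 → trans (trans (keepArray φ₃ 10) (keepArray φ₂ 10) · refl) (charge y≤1)
        })
      r₄
      (λ v → trans (keepArray φ₃ 3) (trans (keepArray φ₂ 3) (keepArray φ₁ 3)) · refl)
      (trans (keepReg φ₃ 7) (trans (keepReg φ₂ 7) (keepReg φ₁ 7)))
      (trans (keepReg φ₃ 6) (trans (keepReg φ₂ 6) worst))
      (λ i → trans (keepArray φ₃ 12) (trans (keepArray φ₂ 12) (keepArray φ₁ 12)) · refl)
      (trans (keepArray φ₃ 13) (trans (keepArray φ₂ 13) (keepArray φ₁ 13)) · refl)

  -- The search dominates: its cost is at most the cover factor times `x ^ (6 + 47)`. Each of the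
  -- eight summands stays below this, and the factor 8 becomes `x ^ 3`, whence 56.
  withinTime : 6 + (2 + solveTime) ≤ cover-factor * x ^ 56
  withinTime = begin
    6 + (2 + solveTime)
      ≤⟨ eight-terms {6} {2} {x ^ 16} {x ^ 16} {x ^ 21} {4} {candidates * (4 + x ^ 46)} {x ^ 15} {z}
           (up (lit≤ 53)) (up (lit≤ 53)) (up (^-mono {16} {53} (≤ᵇ⇒≤ 16 53 _)))
               (up (^-mono {16} {53} (≤ᵇ⇒≤ 16 53 _)))
           (up (^-mono {21} {53} (≤ᵇ⇒≤ 21 53 _))) (up (lit≤ 53)) searching (up (^-mono {15} {53} (≤ᵇ⇒≤ 15 53 _))) ⟩
    2 ^ 3 * z                                ≤⟨ *-monoˡ-≤ z (^-monoˡ-≤ 3 2≤x) ⟩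
    x ^ 3 * z                                ≡⟨ swap (x ^ 3) cover-factor (x ^ 53) ⟩
    cover-factor * (x ^ 3 * x ^ 53)          ≡⟨ cong (cover-factor *_) (sym (^-distribˡ-+-* x 3 53)) ⟩
    cover-factor * x ^ 56                    ∎
    where
    open ≤-Reasoning
    z : ℕ
    z = cover-factor * x ^ 53
    up : ∀ {y} → y ≤ x ^ 53 → y ≤ z
    up y≤ = ≤-trans y≤ (m≤n*m (x ^ 53) cover-factor {{>-nonZero (m^n>0 2 (8 * (∣ C ∣ * ⌈log₂ ∣ C ∣ ⌉)))}})
    searching : candidates * (4 + x ^ 46) ≤ z
    searching = ≤-trans (*-monoʳ-≤ candidates (sum≤ {4} {x ^ 46} {46} (lit≤ 46) ≤-refl))
      (≤-reflexive (trans (*-assoc cover-factor (x ^ 6) (x ^ 47))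
          (cong (cover-factor *_) (sym (^-distribˡ-+-* x 6 47)))))
    swap : ∀ a b c → a * (b * c) ≡ b * (a * c)
    swap = solve-∀

  -- The summands 6 and 2 pay for clamping the capacity and for testing it. Termination within the
  -- bound is unconditional; only the answer presupposes that some arrangement has the required
  -- width.
  bucketIntegrityR : Runs bucketIntegrity (input G c₀) (6 + (2 + solveTime)) λ τ →
    (∃[ A ] width {n} A ≤ c₀) → Solved τ
  bucketIntegrityR = cases (c ≟ 0)
    where
    cases : Dec (c ≡ 0) → Runs bucketIntegrity (input G c₀) (6 + (2 + solveTime)) λ τ →
      (∃[ A ] width {n} A ≤ c₀) → Solved τ
    cases (yes z) = σ₁ , _ , seq assign (when-false z skip) , +-monoʳ-≤ 6 (+-monoʳ-≤ 2 1≤) ,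
      λ (A , w) → no-capacity G (trans (sym (∸∸≡⊓ c₀ n)) z) A w
      where
      1≤ : 1 ≤ solveTime
      1≤ = ≤-trans (lit≤ 16) (m≤m+n (x ^ 16) _)
    cases (no nz) = proceed (solveR nz)
      where
      proceed : Runs (constants ⨾ matching ⨾ slotTable ⨾ search ⨾ output) σ₁ solveTime Solved →
        Runs bucketIntegrity (input G c₀) (6 + (2 + solveTime)) λ τ → (∃[ A ] width {n} A ≤ c₀) → Solved τ
      proceed (τ , _ , d , t≤ , s) =
        τ , _ , seq assign (when-true nz d) , +-monoʳ-≤ 6 (+-monoʳ-≤ 2 t≤) , λ _ → s

theorem6 : Σ[ P ∈ Program ] Σ[ a ∈ ℕ ] Σ[ b ∈ ℕ ]
    (∀ {n : ℕ} (G : Graph n) (c : ℕ) (C : Subset n) →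
    IsMinimumVertexCover G C →
    ∃[ σ ] ∃[ t ]
    (P from input G c ⇓ σ inTime t) ×
    t ≤ 2 ^ (a * (∣ C ∣ * ⌈log₂ ∣ C ∣ ⌉)) * (2 + n) ^ b ×
    ((∃[ A ] width {n} A ≤ c) → ∃[ A ] IsOptimal G c A × Outputs σ A))
theorem6 = bucketIntegrity , 8 , 56 , λ {n} G c C (covers , _) → present n G c C covers
  where
  present : ∀ n (G : Graph n) c (C : Subset n) → IsVertexCover G C →
    Runs bucketIntegrity (input G c) (2 ^ (8 * (∣ C ∣ * ⌈log₂ ∣ C ∣ ⌉)) * (2 + n) ^ 56)
      λ σ → (∃[ A ] width {n} A ≤ c) → ∃[ A ] IsOptimal G c A × Outputs σ A
  present n G c C covers = weaken withinTime (λ _ _ q → q) bucketIntegrityR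
    where open Solve (2 + n) (s≤s (s≤s z≤n)) (s≤s (n≤1+n n)) G c C covers
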